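{- The Hierarchical Word Rectangle Adjacency Contact (Hi-WRAC) problem can be solved in polynomial time.
   Context: A box is an axis-aligned rectangle with a fixed width and height. A representation of boxes places each box (by translation) in the plane so that the interiors of the boxes are pairwise disjoint; two boxes touch if they have a common boundary. In the Hi-WRAC problem the input is a plane embedded graph $G$ whose vertices are boxes $B_1,\dots,B_n$ (each with given width $w_i$ and height $h_i$), together with an orientation of the edges of $G$ that is acyclic and in which exactly one vertex has no outgoing edges (the unique sink). The task is to decide whether there is a representation that hierarchically realizes $G$, and to compute one if it exists: i.e., a representation whose contact graph is $G$ with its given embedding, and such that for every directed edge $B_i\to B_j$ of $G$ the top side of $B_i$ touches (the bottom side of) $B_j$; in particular all contacts are horizontal. -}

module Defs where

open import Level using (0ℓ) renaming (suc to lsuc)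
open import Data.Bool using (Bool; true; false)
open import Data.Empty using (⊥)
open import Data.Fin using (Fin; toℕ)
open import Data.Integer using (ℤ; -[1+_]) renaming (+_ to pos)
open import Data.List using (List; []; _∷_; _++_; map; length; filter; allFin; sum; foldr)
open import Data.List.Membership.Propositional using (_∈_)
open import Data.List.Relation.Unary.All using (All)
open import Data.List.Relation.Unary.AllPairs using (AllPairs)
open import Data.List.Relation.Unary.Unique.Propositional using (Unique)
open import Data.Maybe using (Maybe; just; nothing)
open import Data.Nat using (ℕ; zero; suc)
import Data.Nat as ℕ
open import Data.Nat.Binary using (ℕᵇ; 2[1+_]; 1+[2_])
import Data.Nat.Binary as ℕᵇ
open import Data.Product using (Σ; Σ-syntax; ∃; ∃-syntax; ∃!; _×_; _,_; proj₁; proj₂)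
open import Data.Rational.Unnormalised using (ℚᵘ; 0ℚᵘ; 1ℚᵘ; _+_; _-_; -_; ↥_; ↧ₙ_; _≃_)
import Data.Rational.Unnormalised as ℚ
import Data.Rational.Unnormalised.Properties as ℚₚ
open import Data.Sum using (_⊎_; inj₁; inj₂)
open import Data.Vec using (Vec; _∷_; replicate; lookup; head; _[_]≔_)
open import Function.Base using (_∘_)
open import Function.Bundles using (_⇔_; mk⇔)
open import Relation.Binary.Construct.Closure.Equivalence using (EqClosure)
open import Relation.Binary.Construct.Closure.Transitive using (TransClosure)
open import Relation.Binary.Definitions using (DecidableEquality; tri<; tri≈; tri>)
open import Relation.Binary.PropositionalEquality using (_≡_; _≢_; refl)
open import Relation.Nullary using (¬_; yes; no)

-- The machine model is N. D. Jones's WHILE language over binary trees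
-- ("Computability and Complexity from a Programming Perspective"), which
-- is polynomially equivalent to Turing machines.

data Tree : Set where
  nil  : Tree
  cons : Tree → Tree → Tree

size : Tree → ℕ
size nil        = 1
size (cons s t) = suc (size s ℕ.+ size t)

hdᵗ tlᵗ : Tree → Tree
hdᵗ nil        = nil
hdᵗ (cons s _) = s
tlᵗ nil        = nil
tlᵗ (cons _ t) = t

data Expr (k : ℕ) : Set where
  var   : Fin k → Expr k
  nil   : Expr k
  cons  : Expr k → Expr k → Expr k
  hd tl : Expr k → Expr k

Store : ℕ → Set
Store k = Vec Tree k

eval : ∀ {k} → Store k → Expr k → Tree
eval σ (var x)    = lookup σ x
eval σ nil        = nil
eval σ (cons e f) = cons (eval σ e) (eval σ f)
eval σ (hd e)     = hdᵗ (eval σ e)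
eval σ (tl e)     = tlᵗ (eval σ e)

infix  6 _≔_
infixr 5 _⍮_

data Cmd (k : ℕ) : Set where
  _≔_           : Fin k → Expr k → Cmd k
  _⍮_           : Cmd k → Cmd k → Cmd k
  if_then_else_ : Expr k → Cmd k → Cmd k → Cmd k
  while_loop_   : Expr k → Cmd k → Cmd k

-- Tests succeed on every tree other than nil.
IsCons : Tree → Set
IsCons t = ∃[ u ] ∃[ v ] t ≡ cons u v

-- ⟨ c , σ ⟩⇓⟨ τ , t ⟩: c started in σ halts in τ after t assignments and
-- tests.  Each costs one unit: the expressions have fixed size for a fixed
-- program, and pointers make cons, hd and tl constant-time.
data ⟨_,_⟩⇓⟨_,_⟩ {k : ℕ} : Cmd k → Store k → Store k → ℕ → Set where
  assign     : ∀ {x e σ} → ⟨ x ≔ e , σ ⟩⇓⟨ σ [ x ]≔ eval σ e , 1 ⟩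
  seq        : ∀ {c d σ τ ρ s t} →
               ⟨ c , σ ⟩⇓⟨ τ , s ⟩ → ⟨ d , τ ⟩⇓⟨ ρ , t ⟩ →
               ⟨ c ⍮ d , σ ⟩⇓⟨ ρ , s ℕ.+ t ⟩
  if-true    : ∀ {e c d σ τ t} → IsCons (eval σ e) →
               ⟨ c , σ ⟩⇓⟨ τ , t ⟩ → ⟨ if e then c else d , σ ⟩⇓⟨ τ , suc t ⟩
  if-false   : ∀ {e c d σ τ t} → eval σ e ≡ nil →
               ⟨ d , σ ⟩⇓⟨ τ , t ⟩ → ⟨ if e then c else d , σ ⟩⇓⟨ τ , suc t ⟩
  while-true : ∀ {e c σ τ ρ s t} → IsCons (eval σ e) →
               ⟨ c , σ ⟩⇓⟨ τ , s ⟩ → ⟨ while e loop c , τ ⟩⇓⟨ ρ , t ⟩ →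
               ⟨ while e loop c , σ ⟩⇓⟨ ρ , suc (s ℕ.+ t) ⟩
  while-false : ∀ {e c σ} → eval σ e ≡ nil →
                ⟨ while e loop c , σ ⟩⇓⟨ σ , 1 ⟩

-- Variable 0 holds the input at the start and the output at the end.
record Program : Set where
  field
    extra : ℕ
    body  : Cmd (suc extra)

_on_outputs_within_ : Program → Tree → Tree → ℕ → Set
P on d outputs e within t =
  ∃[ τ ] ⟨ body , d ∷ replicate extra nil ⟩⇓⟨ τ , t ⟩ × head τ ≡ e
  where open Program P

-- A promise search problem: Input contains the legal instances only.
record Problem : Set₂ where
  field
    Input        : Set
    Output       : Input → Set
    encodeInput  : Input → Tree
    encodeOutput : ∀ {I} → Output I → Tree
    Correct      : (I : Input) → Output I → Set₁

-- The size of the output is bounded along with the time, since the tree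
-- produced by t steps on shared pointers may have size exponential in t.
-- Every tree has positive size, so the bounds a · nᵏ dominate all polynomials.
PolynomialTime : Problem → Set₁
PolynomialTime Π =
  Σ[ P ∈ Program ] ∃[ a ] ∃[ k ] ((I : Input) →
    Σ[ O ∈ Output I ] ∃[ t ]
      (P on encodeInput I outputs encodeOutput O within t) ×
      t ℕ.+ size (encodeOutput O) ℕ.≤ a ℕ.* size (encodeInput I) ℕ.^ k ×
      Correct I O)
  where open Problem Π

encodeList : ∀ {A : Set} → (A → Tree) → List A → Tree
encodeList f = foldr (λ a t → cons (f a) t) nil

encodeBool : Bool → Tree
encodeBool false = nil
encodeBool true  = cons nil nil

-- Bijective base 2, least significant digit first.
encodeℕᵇ : ℕᵇ → Tree
encodeℕᵇ ℕᵇ.zero  = nil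
encodeℕᵇ 2[1+ b ] = cons (encodeBool false) (encodeℕᵇ b)
encodeℕᵇ 1+[2 b ] = cons (encodeBool true) (encodeℕᵇ b)

encodeℕ : ℕ → Tree
encodeℕ n = encodeℕᵇ (ℕᵇ.fromℕ n)

encodeℤ : ℤ → Tree
encodeℤ (pos n)  = cons (encodeBool true) (encodeℕ n)
encodeℤ -[1+ n ] = cons (encodeBool false) (encodeℕ (suc n))

encodeℚ : ℚᵘ → Tree
encodeℚ q = cons (encodeℤ (↥ q)) (encodeℕ (↧ₙ q))

record ℝ : Set₁ where
  field
    L U       : ℚᵘ → Set
    L-inhab   : ∃ L
    U-inhab   : ∃ U
    L-rounded : ∀ q → L q ⇔ (∃[ r ] q ℚ.< r × L r)
    U-rounded : ∀ q → U q ⇔ (∃[ r ] r ℚ.< q × U r)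
    disjoint  : ∀ q → L q → U q → ⊥
    located   : ∀ {q r} → q ℚ.< r → L q ⊎ U r

infix 4 _<ᴿ_ _≤ᴿ_ _≈ᴿ_

_<ᴿ_ : ℝ → ℝ → Set
x <ᴿ y = ∃[ q ] ℝ.U x q × ℝ.L y q

_≤ᴿ_ : ℝ → ℝ → Set
x ≤ᴿ y = ∀ q → ℝ.L x q → ℝ.L y q

_≈ᴿ_ : ℝ → ℝ → Set
x ≈ᴿ y = (x ≤ᴿ y) × (y ≤ᴿ x)

private
  q-r+r : ∀ q r → (q - r) + r ≃ q
  q-r+r q r = ℚₚ.≃-trans (ℚₚ.+-assoc q (- r) r)
    (ℚₚ.≃-trans (ℚₚ.+-congʳ q (ℚₚ.+-inverseˡ r)) (ℚₚ.+-identityʳ q))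

  q+r-r : ∀ q r → (q + r) - r ≃ q
  q+r-r q r = ℚₚ.≃-trans (ℚₚ.+-assoc q r (- r))
    (ℚₚ.≃-trans (ℚₚ.+-congʳ q (ℚₚ.+-inverseʳ r)) (ℚₚ.+-identityʳ q))

  q<q+1 : ∀ q → q ℚ.< q + 1ℚᵘ
  q<q+1 q = ℚₚ.<-respˡ-≃ (ℚₚ.+-identityʳ q) (ℚₚ.+-monoʳ-< q (ℚₚ.positive⁻¹ 1ℚᵘ))

  q-1<q : ∀ q → q - 1ℚᵘ ℚ.< q
  q-1<q q = ℚₚ.<-respʳ-≃ (ℚₚ.+-identityʳ q) (ℚₚ.+-monoʳ-< q (ℚₚ.negative⁻¹ (- 1ℚᵘ)))

fromℚ : ℚᵘ → ℝ
fromℚ p = record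
  { L         = ℚ._< p
  ; U         = p ℚ.<_
  ; L-inhab   = p - 1ℚᵘ , q-1<q p
  ; U-inhab   = p + 1ℚᵘ , q<q+1 p
  ; L-rounded = λ q → mk⇔ ℚₚ.<-dense (λ (r , q<r , r<p) → ℚₚ.<-trans q<r r<p)
  ; U-rounded = λ q → mk⇔
      (λ p<q → let (r , p<r , r<q) = ℚₚ.<-dense p<q in r , r<q , p<r)
      (λ (r , r<q , p<r) → ℚₚ.<-trans p<r r<q)
  ; disjoint  = λ q q<p p<q → ℚₚ.<-irrefl ℚₚ.≃-refl (ℚₚ.<-trans q<p p<q)
  ; located   = located
  }
  where
  located : ∀ {q r} → q ℚ.< r → q ℚ.< p ⊎ p ℚ.< r
  located {q} q<r with ℚₚ.<-cmp q p
  ... | tri< q<p _ _ = inj₁ q<p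
  ... | tri≈ _ q≃p _ = inj₂ (ℚₚ.<-respˡ-≃ q≃p q<r)
  ... | tri> _ _ p<q = inj₂ (ℚₚ.<-trans p<q q<r)

infixl 6 _⊕_

_⊕_ : ℝ → ℚᵘ → ℝ
x ⊕ p = record
  { L         = λ q → L (q - p)
  ; U         = λ q → U (q - p)
  ; L-inhab   = let (q , Lq) = L-inhab in q + p , L-resp (ℚₚ.≃-sym (q+r-r q p)) Lq
  ; U-inhab   = let (q , Uq) = U-inhab in q + p , U-resp (ℚₚ.≃-sym (q+r-r q p)) Uq
  ; L-rounded = λ q → mk⇔
      (λ Lq → let (r , q<r , Lr) = to (L-rounded _) Lq in
        r + p ,
        ℚₚ.<-respˡ-≃ (q-r+r q p) (ℚₚ.+-monoˡ-< p q<r) ,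
        L-resp (ℚₚ.≃-sym (q+r-r r p)) Lr)
      (λ (r , q<r , Lr) → from (L-rounded _) (r - p , ℚₚ.+-monoˡ-< (- p) q<r , Lr))
  ; U-rounded = λ q → mk⇔
      (λ Uq → let (r , r<q , Ur) = to (U-rounded _) Uq in
        r + p ,
        ℚₚ.<-respʳ-≃ (q-r+r q p) (ℚₚ.+-monoˡ-< p r<q) ,
        U-resp (ℚₚ.≃-sym (q+r-r r p)) Ur)
      (λ (r , r<q , Ur) → from (U-rounded _) (r - p , ℚₚ.+-monoˡ-< (- p) r<q , Ur))
  ; disjoint  = λ q → disjoint (q - p)
  ; located   = λ q<r → located (ℚₚ.+-monoˡ-< (- p) q<r)
  }
  where
  open ℝ x
  open Function.Bundles.Equivalence using (to; from)
  L-resp : ∀ {q r} → q ≃ r → L q → L r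
  L-resp q≃r Lq = let (s , q<s , Ls) = to (L-rounded _) Lq in
    from (L-rounded _) (s , ℚₚ.<-respˡ-≃ q≃r q<s , Ls)
  U-resp : ∀ {q r} → q ≃ r → U q → U r
  U-resp q≃r Uq = let (s , s<q , Us) = to (U-rounded _) Uq in
    from (U-rounded _) (s , ℚₚ.<-respʳ-≃ q≃r s<q , Us)

-- As in a doubly connected edge list, every edge is split into two
-- half-edges, and every vertex carries the counterclockwise list of the
-- half-edges leaving it.

data Direction : Set where
  out in′ : Direction

_≟ᵈ_ : DecidableEquality Direction
out ≟ᵈ out = yes refl
out ≟ᵈ in′ = no λ ()
in′ ≟ᵈ out = no λ ()
in′ ≟ᵈ in′ = yes refl

-- direction is relative to the orientation of the edge: out if the edge
-- points away from the vertex in whose list the half-edge occurs.  face is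
-- the face on the left when walking along the half-edge towards its target.
record HalfEdge (n f : ℕ) : Set where
  constructor halfEdge
  field
    direction : Direction
    target    : Fin n
    face      : Fin f
open HalfEdge public

-- In the cyclic list xs, the entry after a is b (b is a if xs = [ a ]).
CyclicNext : ∀ {A : Set} → List A → A → A → Set
CyclicNext xs a b = ∃[ ys ] ∃[ zs ] ∃[ ws ]
  xs ≡ ys ++ a ∷ zs × zs ++ ys ++ a ∷ [] ≡ b ∷ ws

CyclicShift : ∀ {A : Set} → List A → List A → Set
CyclicShift xs ys = ∃[ us ] ∃[ vs ] xs ≡ us ++ vs × ys ≡ vs ++ us

record PlaneDigraph (n f : ℕ) : Set where
  field
    rotation  : Fin n → List (HalfEdge n f)
    outerFace : Fin f

  Arc : Fin n → Fin n → Set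
  Arc i j = ∃[ e ] e ∈ rotation i × direction e ≡ out × target e ≡ j

  Adjacent : Fin n → Fin n → Set
  Adjacent i j = Arc i j ⊎ Arc j i

  IsSink : Fin n → Set
  IsSink i = ∀ j → ¬ Arc i j

  edges : ℕ
  edges = sum (map (λ i → length (filter (λ e → direction e ≟ᵈ out) (rotation i))) (allFin n))

  -- FaceStep (i , d) (j , e): the half-edge d leads from i to j, and the
  -- walk with the face on its left continues along e, which precedes the
  -- half-edge back to i in the counterclockwise order at j.
  FaceStep : Fin n × HalfEdge n f → Fin n × HalfEdge n f → Set
  FaceStep (i , d) (j , e) =
    d ∈ rotation i × target d ≡ j ×
    ∃[ d′ ] d′ ∈ rotation j × target d′ ≡ i × CyclicNext (rotation j) e d′

  field
    simple   : ∀ i → Unique (map target (rotation i))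
    twins    : ∀ i j → Arc i j ⇔ (∃[ e ] e ∈ rotation j × direction e ≡ in′ × target e ≡ i)
    acyclic  : ∀ i → ¬ TransClosure Arc i i
    oneSink  : ∃! _≡_ IsSink
    -- The face labels are exactly the orbits of FaceStep.  The single
    -- vertex graph has one face but no half-edge.
    faces    : ∀ {i j d e} → d ∈ rotation i → e ∈ rotation j →
               face d ≡ face e ⇔ EqClosure FaceStep (i , d) (j , e)
    allFaces : ∀ k → n ≡ 1 ⊎ (∃[ i ] ∃[ e ] e ∈ rotation i × face e ≡ k)
    -- By Euler's formula the embedding is planar; the graph is connected
    -- because every vertex has a directed path to the sink.
    planar   : n ℕ.+ f ≡ edges ℕ.+ 2

record Instance : Set where
  field
    n f           : ℕ
    width height  : Fin n → ℚᵘ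
    width>0       : ∀ i → 0ℚᵘ ℚ.< width i
    height>0      : ∀ i → 0ℚᵘ ℚ.< height i
    graph         : PlaneDigraph n f

-- a lies strictly between x and x + w.
_∈⟨_,_⟩ : ℝ → ℝ → ℚᵘ → Set
a ∈⟨ x , w ⟩ = (x <ᴿ a) × (a <ᴿ x ⊕ w)

-- x i and y i are the coordinates of the lower left corner of box i.
module Placement (I : Instance) (x y : Fin (Instance.n I) → ℝ) where
  open Instance I
  open PlaneDigraph graph

  InInterior : ℝ × ℝ → Fin n → Set
  InInterior (a , b) i = a ∈⟨ x i , width i ⟩ × b ∈⟨ y i , height i ⟩

  -- The common part of the two sides has positive length exactly if the
  -- open sides have a common point.
  TopTouches : Fin n → Fin n → Set₁
  TopTouches i j =
    y i ⊕ height i ≈ᴿ y j × ∃[ a ] a ∈⟨ x i , width i ⟩ × a ∈⟨ x j , width j ⟩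

  RightTouches : Fin n → Fin n → Set₁
  RightTouches i j =
    x i ⊕ width i ≈ᴿ x j × ∃[ b ] b ∈⟨ y i , height i ⟩ × b ∈⟨ y j , height j ⟩

  Touch : Fin n → Fin n → Set₁
  Touch i j = (TopTouches i j ⊎ TopTouches j i) ⊎ (RightTouches i j ⊎ RightTouches j i)

  LeftOf RightOf : HalfEdge n f → HalfEdge n f → Set
  LeftOf  d e = x (target d) <ᴿ x (target e)
  RightOf d e = LeftOf e d

  -- Counterclockwise around the boundary of box i, the contacts on the top
  -- side are met from right to left, then those on the bottom side from left
  -- to right.
  RotationAt : Fin n → Set
  RotationAt i = ∃[ ts ] ∃[ bs ]
    CyclicShift (rotation i) (ts ++ bs) ×
    All (λ e → direction e ≡ out) ts × AllPairs RightOf ts ×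
    All (λ e → direction e ≡ in′) bs × AllPairs LeftOf bs

  -- Every directed path rises, so the sink is the highest box and the outer
  -- face lies above it.  All contacts of the sink are on its bottom side; the
  -- angle above it follows counterclockwise after the rightmost one, hence is
  -- on the left of that half-edge.
  OuterFaceAt : Fin n → Set
  OuterFaceAt s = ∀ e → e ∈ rotation s →
    (∀ d → d ∈ rotation s → x (target d) ≤ᴿ x (target e)) → face e ≡ outerFace

  record HierarchicallyRealizes : Set₁ where
    field
      disjointInteriors : ∀ i j → i ≢ j →
                          ¬ (∃[ p ] InInterior p i × InInterior p j)
      contactGraph      : ∀ i j → Touch i j ⇔ Adjacent i j
      hierarchy         : ∀ i j → Arc i j → TopTouches i j
      embedding         : ∀ i → RotationAt i
      outer             : ∀ s → IsSink s → OuterFaceAt s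

open Placement public using (HierarchicallyRealizes)

encodeDirection : Direction → Tree
encodeDirection out = encodeBool true
encodeDirection in′ = encodeBool false

encodeHalfEdge : ∀ {n f} → HalfEdge n f → Tree
encodeHalfEdge e =
  cons (encodeDirection (direction e)) (cons (encodeℕ (toℕ (target e))) (encodeℕ (toℕ (face e))))

encodeInstance : Instance → Tree
encodeInstance I =
  cons (cons (encodeℕ f) (encodeℕ (toℕ outerFace))) (encodeList box (allFin n))
  where
  open Instance I
  open PlaneDigraph graph
  box : Fin n → Tree
  box i = cons (cons (encodeℚ (width i)) (encodeℚ (height i)))
               (encodeList encodeHalfEdge (rotation i))

encodePlacement : ∀ {n} → Maybe (Fin n → ℚᵘ × ℚᵘ) → Tree
encodePlacement nothing  = nil
encodePlacement {n} (just p) = cons nil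
  (encodeList (λ i → cons (encodeℚ (proj₁ (p i))) (encodeℚ (proj₂ (p i)))) (allFin n))

CorrectAnswer : (I : Instance) → Maybe (Fin (Instance.n I) → ℚᵘ × ℚᵘ) → Set₁
CorrectAnswer I (just p) = HierarchicallyRealizes I (fromℚ ∘ proj₁ ∘ p) (fromℚ ∘ proj₂ ∘ p)
CorrectAnswer I nothing  = ¬ (∃[ x ] ∃[ y ] HierarchicallyRealizes I x y)

Hi-WRAC : Problem
Hi-WRAC = record
  { Input        = Instance
  ; Output       = λ I → Maybe (Fin (Instance.n I) → ℚᵘ × ℚᵘ)
  ; encodeInput  = encodeInstance
  ; encodeOutput = encodePlacement
  ; Correct      = CorrectAnswer
  }

{-# OPTIONS --safe #-}

-- The vertical positions are forced: every box hangs below the target of its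
-- first outgoing arc, so its depth is a sum of heights along a path to the
-- sink.  The rotations also force which of two boxes at overlapping heights
-- is on the left: replacing the lower one by its parent keeps the side, until
-- two in-neighbours of a common box remain, whose order is read off the
-- rotation.  Only the rotation of the sink has to be cut open; all cuts are
-- tried.  What remains is a system of difference constraints for the
-- horizontal positions.  In units such that all widths are multiples of 1 + n,
-- a strict inequality may be replaced by a gap of one unit, because a cycle
-- without repetitions has at most n edges; hence n rounds of Bellman-Ford
-- relaxation either solve the system or refute realizability.
--
-- For the running time, every function is a composition of structural
-- recursions on lists.  A structural recursion runs in polynomial time as soon
-- as its step does and the size of its result is polynomially bounded.

module Submission where

-- A negative answer has to exclude placements at arbitrary Dedekind reals, whose order is not
-- decidable. This shapes the completeness proof: from a realization only weak inequalities and
-- their negations are drawn, weak inequalities are stable, and alternatives such as "left or right"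
-- stay under a double negation. The real unknowns disappear when a box is compared with itself: a
-- closed chain of constraints compares two multiples of `1 + n` on one box, and if they differ,
-- they differ by more than the at most `n` unit gaps collected on the way.
--
-- Passing to the parent keeps the side because a box and its parent overlap horizontally, while two
-- nonadjacent boxes at meeting heights cannot. The sink is special because its rotation has only
-- incoming half-edges; at every other box the outgoing ones show where the bottom side begins.
--
-- The program checks its candidate completely, so soundness does not depend on how the candidate
-- was found. Completeness has to show that some cut yields a candidate that passes.

open import Defs

-- Dedekind reals

module Reals where

  open import Data.Empty using (⊥-elim)
  import Data.Integer as ℤ
  open import Data.Integer using (ℤ; -[1+_]; +≤+; ∣_∣) renaming (+_ to pos)
  import Data.Integer.Properties as ℤₚ
  import Data.Integer.Tactic.RingSolver as ℤSolver
  import Data.Nat as ℕ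
  open import Data.Nat using (ℕ; zero; suc)
  import Data.Nat.Properties as ℕₚ
  open import Data.Product using (∃-syntax; _×_; _,_; proj₁; proj₂)
  import Data.Rational.Unnormalised as ℚ
  open import Data.Rational.Unnormalised using (ℚᵘ; mkℚᵘ; 0ℚᵘ; _+_; _-_; -_; _≃_; *≡*; *≤*; *<*; _⊔_; _⊓_)
  import Data.Rational.Unnormalised.Properties as ℚₚ
  open import Data.Rational.Unnormalised.Solver using (module +-*-Solver)
  open import Data.Sum using (inj₁; inj₂)
  open import Function.Bundles using (Equivalence)
  open import Relation.Binary.PropositionalEquality
  open import Relation.Nullary using (¬_)

  open Equivalence using (to; from)

  frac-+ : ∀ m y z → mkℚᵘ y m + mkℚᵘ z m ≃ mkℚᵘ (y ℤ.+ z) m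
  frac-+ m y z = *≡* (ring y z (pos (suc m)))
    where ring : ∀ y z d → (y ℤ.* d ℤ.+ z ℤ.* d) ℤ.* d ≡ (y ℤ.+ z) ℤ.* (d ℤ.* d)
          ring = ℤSolver.solve-∀

  frac-mono-≤ : ∀ m {y z} → y ℤ.≤ z → mkℚᵘ y m ℚ.≤ mkℚᵘ z m
  frac-mono-≤ m y≤z = *≤* (ℤₚ.*-monoʳ-≤-nonNeg (pos (suc m)) y≤z)

  frac-mono-< : ∀ m {y z} → y ℤ.< z → mkℚᵘ y m ℚ.< mkℚᵘ z m
  frac-mono-< m y<z = *<* (ℤₚ.*-monoʳ-<-pos (pos (suc m)) y<z)

  frac-cancel-≤ : ∀ m {y z} → mkℚᵘ y m ℚ.≤ mkℚᵘ z m → y ℤ.≤ z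
  frac-cancel-≤ m h = ℤₚ.*-cancelʳ-≤-pos _ _ (pos (suc m)) (ℚₚ.drop-*≤* h)

  frac-cancel-< : ∀ m {y z} → mkℚᵘ y m ℚ.< mkℚᵘ z m → y ℤ.< z
  frac-cancel-< m h = ℤₚ.*-cancelʳ-<-nonNeg (pos (suc m)) (ℚₚ.drop-*<* h)

  -+- : ∀ q p r → (q - r) - p ≃ q - (p + r)
  -+- = solve 3 (λ q p r → (q :- r) :- p := q :- (p :+ r)) ℚₚ.≃-refl
    where open +-*-Solver

  q+p-p : ∀ q p → (q + p) - p ≃ q
  q+p-p = solve 2 (λ q p → (q :+ p) :- p := q) ℚₚ.≃-refl
    where open +-*-Solver

  q-p+p : ∀ q p → (q - p) + p ≃ q
  q-p+p = solve 2 (λ q p → (q :- p) :+ p := q) ℚₚ.≃-refl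
    where open +-*-Solver

  module _ (x : ℝ) where
    open ℝ x

    L-down : ∀ {q r} → q ℚ.< r → L r → L q
    L-down q<r Lr = from (L-rounded _) (_ , q<r , Lr)

    U-up : ∀ {q r} → q ℚ.< r → U q → U r
    U-up q<r Uq = from (U-rounded _) (_ , q<r , Uq)

    L-≤ : ∀ {q r} → q ℚ.≤ r → L r → L q
    L-≤ q≤r Lr = let (s , r<s , Ls) = to (L-rounded _) Lr in L-down (ℚₚ.≤-<-trans q≤r r<s) Ls

    U-≤ : ∀ {q r} → q ℚ.≤ r → U q → U r
    U-≤ q≤r Uq = let (s , s<q , Us) = to (U-rounded _) Uq in U-up (ℚₚ.<-≤-trans s<q q≤r) Us

    L-≃ : ∀ {q r} → q ≃ r → L r → L q
    L-≃ q≃r = L-≤ (ℚₚ.≤-reflexive q≃r)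

    L<U : ∀ {q r} → L q → U r → q ℚ.< r
    L<U {q} {r} Lq Ur = ℚₚ.≰⇒> λ r≤q → disjoint q Lq (U-≤ r≤q Ur)

  module _ {x y : ℝ} where

    <ᴿ⇒¬≥ : x <ᴿ y → ¬ y ≤ᴿ x
    <ᴿ⇒¬≥ (q , Ux , Ly) y≤x = ℝ.disjoint x q (y≤x q Ly) Ux

    -- An element `q` of the lower cut of `y` can be enlarged to some `r` in it. Locatedness of `x`
    -- then puts `q` below `x` or `r` above `x`, and the latter would witness `x <ᴿ y`.
    ¬<ᴿ⇒≥ : ¬ x <ᴿ y → y ≤ᴿ x
    ¬<ᴿ⇒≥ ¬x<y q Lq with to (ℝ.L-rounded y q) Lq
    ... | r , q<r , Lr with ℝ.located x q<r
    ...   | inj₁ Lq′ = Lq′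
    ...   | inj₂ Ur  = ⊥-elim (¬x<y (r , Ur , Lr))

    <ᴿ⇒≤ : x <ᴿ y → x ≤ᴿ y
    <ᴿ⇒≤ (q , Ux , Ly) r Lr = L-down y (L<U x Lr Ux) Ly

  ≤ᴿ-trans : ∀ {x y z} → x ≤ᴿ y → y ≤ᴿ z → x ≤ᴿ z
  ≤ᴿ-trans x≤y y≤z q Lq = y≤z q (x≤y q Lq)

  -- A weak inequality is the negation of a strict one. So case distinctions about reals are
  -- admissible in its proofs although the order is not decidable.
  ≤ᴿ-stable : ∀ {x y} → ¬ ¬ x ≤ᴿ y → x ≤ᴿ y
  ≤ᴿ-stable {x} {y} h = ¬<ᴿ⇒≥ {y} {x} λ y<x → h (<ᴿ⇒¬≥ {y} {x} y<x)

  ≤ᴿ-total : ∀ {x y} → ¬ x ≤ᴿ y → y ≤ᴿ x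
  ≤ᴿ-total {x} {y} h = ¬<ᴿ⇒≥ {x} {y} λ x<y → h (<ᴿ⇒≤ {x} {y} x<y)

  <-≤ᴿ-trans : ∀ {x y z} → x <ᴿ y → y ≤ᴿ z → x <ᴿ z
  <-≤ᴿ-trans (q , Ux , Ly) y≤z = q , Ux , y≤z q Ly

  ≤ᴿ⇒U : ∀ {x y} → x ≤ᴿ y → ∀ {q} → ℝ.U y q → ℝ.U x q
  ≤ᴿ⇒U {x} {y} x≤y {q} Uq with to (ℝ.U-rounded y q) Uq
  ... | r , r<q , Ur with ℝ.located x r<q
  ...   | inj₁ Lr = ⊥-elim (ℝ.disjoint y r (x≤y r Lr) Ur)
  ...   | inj₂ Uq′ = Uq′

  ≤-<ᴿ-trans : ∀ {x y z} → x ≤ᴿ y → y <ᴿ z → x <ᴿ z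
  ≤-<ᴿ-trans {x} {y} x≤y (q , Uy , Lz) = q , ≤ᴿ⇒U {x} {y} x≤y Uy , Lz

  <ᴿ-trans : ∀ {x y z} → x <ᴿ y → y <ᴿ z → x <ᴿ z
  <ᴿ-trans {x} {y} {z} x<y = ≤-<ᴿ-trans {x} {y} {z} (<ᴿ⇒≤ {x} {y} x<y)

  ⊕-mono : ∀ {x y} p → x ≤ᴿ y → x ⊕ p ≤ᴿ y ⊕ p
  ⊕-mono p x≤y q = x≤y (q - p)

  ⊕-monoʳ : ∀ x {p q} → p ℚ.≤ q → x ⊕ p ≤ᴿ x ⊕ q
  ⊕-monoʳ x {p} {q} p≤q r = L-≤ x (ℚₚ.+-monoʳ-≤ r (ℚₚ.neg-mono-≤ p≤q))

  ⊕-assoc-≤ : ∀ x p q → (x ⊕ p) ⊕ q ≤ᴿ x ⊕ (p + q)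
  ⊕-assoc-≤ x p q r = L-≃ x (ℚₚ.≃-sym (-+- r p q))

  ⊕-assoc-≥ : ∀ x p q → x ⊕ (p + q) ≤ᴿ (x ⊕ p) ⊕ q
  ⊕-assoc-≥ x p q r = L-≃ x (-+- r p q)

  fromℚ-⊕-≤ : ∀ a p → fromℚ a ⊕ p ≤ᴿ fromℚ (a + p)
  fromℚ-⊕-≤ a p q q-p<a = ℚₚ.<-respˡ-≃ (q-p+p q p) (ℚₚ.+-monoˡ-< p q-p<a)

  fromℚ-⊕-≥ : ∀ a p → fromℚ (a + p) ≤ᴿ fromℚ a ⊕ p
  fromℚ-⊕-≥ a p q q<a+p = ℚₚ.<-respʳ-≃ (q+p-p a p) (ℚₚ.+-monoˡ-< (- p) q<a+p)

  fromℚ-mono-≤ : ∀ {a b} → a ℚ.≤ b → fromℚ a ≤ᴿ fromℚ b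
  fromℚ-mono-≤ a≤b q q<a = ℚₚ.<-≤-trans q<a a≤b

  fromℚ-mono-< : ∀ {a b} → a ℚ.< b → fromℚ a <ᴿ fromℚ b
  fromℚ-mono-< = ℚₚ.<-dense

  fromℚ-cancel-< : ∀ {a b} → fromℚ a <ᴿ fromℚ b → a ℚ.< b
  fromℚ-cancel-< (q , a<q , q<b) = ℚₚ.<-trans a<q q<b

  fromℚ-cancel-≤ : ∀ {a b} → fromℚ a ≤ᴿ fromℚ b → a ℚ.≤ b
  fromℚ-cancel-≤ {a} {b} h = ℚₚ.≮⇒≥ λ b<a → <ᴿ⇒¬≥ {fromℚ b} {fromℚ a} (fromℚ-mono-< b<a) h

  -- If `q` were less than `p`, the hypothesis would close the lower cut of `x` under adding
  -- `p - q`, and the cut would climb past any element of the upper one. `unit≤` shrinks the step to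
  -- a unit fraction, and `≤frac` counts how many such steps are enough.
  module Archimedean (x : ℝ) {p q : ℚᵘ} (x+p≤x+q : x ⊕ p ≤ᴿ x ⊕ q) where
    open ℝ x

    private
      raise : ∀ {u} → L u → L (u + (p - q))
      raise {u} Lu = L-≃ x (solve 3 (λ u p q → u :+ (p :- q) := (u :+ p) :- q) ℚₚ.≃-refl u p q)
        (x+p≤x+q (u + p) (L-≃ x (q+p-p u p) Lu))
        where open +-*-Solver

      climbs : ∀ {u b} → mkℚᵘ (pos 1) b ℚ.≤ p - q → L u → ∀ k → L (u + mkℚᵘ (pos k) b)
      climbs {u} {b} small Lu zero = L-≃ x (ℚₚ.≃-trans (ℚₚ.+-congʳ u (*≡* refl)) (ℚₚ.+-identityʳ u)) Lu
      climbs {u} {b} small Lu (suc k) = L-≤ x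
        (ℚₚ.≤-trans (ℚₚ.≤-reflexive (ℚₚ.≃-trans (ℚₚ.+-congʳ u (ℚₚ.≃-trans (ℚₚ.≃-reflexive (cong (λ z → mkℚᵘ (pos z) b) (ℕₚ.+-comm 1 k))) (ℚₚ.≃-sym (frac-+ b (pos k) (pos 1))))) (ℚₚ.≃-sym (ℚₚ.+-assoc u _ _))))
          (ℚₚ.+-monoʳ-≤ (u + mkℚᵘ (pos k) b) small))
        (raise (climbs small Lu k))

      ≤frac : ∀ d b → ∃[ k ] d ℚ.≤ mkℚᵘ (pos k) b
      ≤frac (mkℚᵘ n d-1) b = ∣ n ∣ ℕ.* suc b , *≤* (ℤₚ.≤-trans
        (ℤₚ.*-monoʳ-≤-nonNeg (pos (suc b)) (n≤∣n∣ n))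
        (subst₂ ℤ._≤_ (ℤₚ.pos-* ∣ n ∣ (suc b)) (ℤₚ.pos-* (∣ n ∣ ℕ.* suc b) (suc d-1)) (+≤+ (ℕₚ.m≤m*n (∣ n ∣ ℕ.* suc b) (suc d-1)))))
        where
        n≤∣n∣ : ∀ n → n ℤ.≤ pos ∣ n ∣
        n≤∣n∣ (pos n)    = ℤₚ.≤-refl
        n≤∣n∣ (-[1+ n ]) = ℤ.-≤+

      unit≤ : ∀ {d} → 0ℚᵘ ℚ.< d → ∃[ b ] mkℚᵘ (pos 1) b ℚ.≤ d
      unit≤ {mkℚᵘ n b} (*<* h) = b , *≤* (ℤₚ.*-monoʳ-≤-nonNeg (pos (suc b)) (ℤₚ.i<j⇒suc[i]≤j (subst (ℤ.0ℤ ℤ.<_) (ℤₚ.*-identityʳ n) h)))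

    shift-cancel : p ℚ.≤ q
    shift-cancel = ℚₚ.≮⇒≥ λ q<p →
      let (b , small) = unit≤ (ℚₚ.<-respˡ-≃ (ℚₚ.+-inverseʳ q) (ℚₚ.+-monoˡ-< (- q) q<p))
          (u , Lu) = L-inhab
          (v , Uv) = U-inhab
          (k , large) = ≤frac (v - u) b in
      disjoint v (L-≤ x (ℚₚ.≤-trans (ℚₚ.≤-reflexive (solve 2 (λ u v → v := u :+ (v :- u)) ℚₚ.≃-refl u v)) (ℚₚ.+-monoʳ-≤ u large)) (climbs small Lu k)) Uv
      where open +-*-Solver

  open Archimedean public using (shift-cancel)

  -- The double negation is enough: this is applied only where a common point of two boxes is about
  -- to be refuted.
  <⊕ : ∀ x {p} → 0ℚᵘ ℚ.< p → ¬ ¬ x <ᴿ x ⊕ p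
  <⊕ x {p} 0<p h = ℚₚ.<⇒≱ 0<p (shift-cancel x {p} {0ℚᵘ}
    (≤ᴿ-trans {x ⊕ p} {x} {x ⊕ 0ℚᵘ} (¬<ᴿ⇒≥ {x} {x ⊕ p} h) λ q → L-≃ x (ℚₚ.+-identityʳ q)))

  -- A common point is the larger of two points just above the respective left ends.
  common-point : ∀ {x y v w} → x <ᴿ x ⊕ v → y <ᴿ y ⊕ w → x <ᴿ y ⊕ w → y <ᴿ x ⊕ v →
    ∃[ a ] a ∈⟨ x , v ⟩ × a ∈⟨ y , w ⟩
  common-point {x} {y} {v} {w} (q₃ , in₃) (q₄ , in₄) (q₁ , Ux₁ , Ly₁) (q₂ , Uy₂ , Lx₂) =
    fromℚ q , (below {x} Ux , above {x ⊕ v} Lx) , (below {y} Uy , above {y ⊕ w} Ly)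
    where
    q : ℚᵘ
    q = (q₁ ⊓ q₃) ⊔ (q₂ ⊓ q₄)
    below : ∀ {z} → ℝ.U z q → z <ᴿ fromℚ q
    below {z} Uq = let (r , r<q , Ur) = to (ℝ.U-rounded z q) Uq in r , Ur , r<q
    above : ∀ {z} → ℝ.L z q → fromℚ q <ᴿ z
    above {z} Lq = let (r , q<r , Lr) = to (ℝ.L-rounded z q) Lq in r , q<r , Lr
    max-L : ∀ z {a b} → ℝ.L z a → ℝ.L z b → ℝ.L z (a ⊔ b)
    max-L z {a} {b} La Lb with ℚₚ.≤-total a b
    ... | inj₁ a≤b = L-≤ z (ℚₚ.≤-reflexive (ℚₚ.p≤q⇒p⊔q≃q a≤b)) Lb
    ... | inj₂ b≤a = L-≤ z (ℚₚ.≤-reflexive (ℚₚ.p≥q⇒p⊔q≃p b≤a)) La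
    min-U : ∀ z {a b} → ℝ.U z a → ℝ.U z b → ℝ.U z (a ⊓ b)
    min-U z {a} {b} Ua Ub with ℚₚ.≤-total a b
    ... | inj₁ a≤b = U-≤ z (ℚₚ.≤-reflexive (ℚₚ.≃-sym (ℚₚ.p≤q⇒p⊓q≃p a≤b))) Ua
    ... | inj₂ b≤a = U-≤ z (ℚₚ.≤-reflexive (ℚₚ.≃-sym (ℚₚ.p≥q⇒p⊓q≃q b≤a))) Ub
    Ux : ℝ.U x q
    Ux = U-≤ x (ℚₚ.p≤p⊔q (q₁ ⊓ q₃) (q₂ ⊓ q₄)) (min-U x Ux₁ (proj₁ in₃))
    Uy : ℝ.U y q
    Uy = U-≤ y (ℚₚ.p≤q⊔p (q₁ ⊓ q₃) (q₂ ⊓ q₄)) (min-U y Uy₂ (proj₁ in₄))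
    Lx : ℝ.L (x ⊕ v) q
    Lx = max-L (x ⊕ v) {q₁ ⊓ q₃} {q₂ ⊓ q₄} (L-≤ (x ⊕ v) (ℚₚ.p⊓q≤q q₁ q₃) (proj₂ in₃)) (L-≤ (x ⊕ v) (ℚₚ.p⊓q≤p q₂ q₄) Lx₂)
    Ly : ℝ.L (y ⊕ w) q
    Ly = max-L (y ⊕ w) {q₁ ⊓ q₃} {q₂ ⊓ q₄} (L-≤ (y ⊕ w) (ℚₚ.p⊓q≤p q₁ q₃) Ly₁) (L-≤ (y ⊕ w) (ℚₚ.p⊓q≤q q₂ q₄) (proj₂ in₄))

open Reals

-- Polynomial-time programs

module Programs where

  open import Data.Bool using (Bool; true; false) renaming (if_then_else_ to cond)
  open import Data.Fin using (zero; suc)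
  open import Data.List using (List; []; _∷_; _++_; length; reverse; _ʳ++_)
  open import Data.List.Properties using (ʳ++-defn; ++-identityʳ; reverse-involutive; length-ʳ++)
  open import Data.Nat using (ℕ; >-nonZero; zero; suc; _+_; _*_; _^_; _≤_; z≤n; s≤s)
  open import Data.Nat.Properties
  open import Data.Nat.Tactic.RingSolver using (solve-∀)
  open import Data.Product using (∃-syntax; _×_; _,_; proj₁; proj₂)
  open import Data.Vec using ([]; _∷_)
  open import Relation.Binary.PropositionalEquality

  record Data : Set₁ where
    constructor data′
    field
      ∣_∣ : Set
      enc : ∣_∣ → Tree
  open Data public

  sz : (A : Data) → ∣ A ∣ → ℕ
  sz A x = size (enc A x)

  1≤size : ∀ t → 1 ≤ size t
  1≤size nil        = s≤s z≤n
  1≤size (cons _ _) = s≤s z≤n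

  infixr 4 _⊗_
  _⊗_ : Data → Data → Data
  A ⊗ B = data′ (∣ A ∣ × ∣ B ∣) (λ (a , b) → cons (enc A a) (enc B b))

  𝕃 : Data → Data
  𝕃 A = data′ (List ∣ A ∣) (encodeList (enc A))

  𝔹 : Data
  𝔹 = data′ Bool encodeBool

  record PolyBounded (A : Data) (m : ∣ A ∣ → ℕ) : Set where
    constructor poly
    field
      coeff expo : ℕ
      bounded    : ∀ x → m x ≤ coeff * sz A x ^ expo

  module _ {A : Data} where

    private
      pow≤ : ∀ x {k l} → k ≤ l → sz A x ^ k ≤ sz A x ^ l
      pow≤ x = ^-monoʳ-≤ (sz A x) {{>-nonZero (1≤size (enc A x))}}

    bd-const : ∀ c → PolyBounded A (λ _ → c)
    bd-const c = poly c 0 λ x → ≤-reflexive (sym (*-identityʳ c))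

    bd-sz : PolyBounded A (sz A)
    bd-sz = poly 1 1 λ x → ≤-reflexive (sym (trans (*-identityˡ _) (*-identityʳ _)))

    bd-≤ : ∀ {m m′} → (∀ x → m x ≤ m′ x) → PolyBounded A m′ → PolyBounded A m
    bd-≤ le (poly a k b) = poly a k λ x → ≤-trans (le x) (b x)

    bd-+ : ∀ {m m′} → PolyBounded A m → PolyBounded A m′ → PolyBounded A (λ x → m x + m′ x)
    bd-+ (poly a k p) (poly b l q) = poly (a + b) (k + l) λ x →
      ≤-trans (+-mono-≤ (≤-trans (p x) (*-monoʳ-≤ a (pow≤ x (m≤m+n k l))))
                        (≤-trans (q x) (*-monoʳ-≤ b (pow≤ x (m≤n+m l k)))))
              (≤-reflexive (sym (*-distribʳ-+ (sz A x ^ (k + l)) a b)))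

    bd-* : ∀ {m m′} → PolyBounded A m → PolyBounded A m′ → PolyBounded A (λ x → m x * m′ x)
    bd-* (poly a k p) (poly b l q) = poly (a * b) (k + l) λ x →
      ≤-trans (*-mono-≤ (p x) (q x))
        (≤-reflexive (trans ([m*n]*[o*p]≡[m*o]*[n*p] a (sz A x ^ k) b (sz A x ^ l))
          (cong (a * b *_) (sym (^-distribˡ-+-* (sz A x) k l)))))

    bd-^ : ∀ {m} k → PolyBounded A m → PolyBounded A (λ x → m x ^ k)
    bd-^ zero    p = bd-const 1
    bd-^ (suc k) p = bd-* p (bd-^ k p)

  bd-∘ : ∀ {A B} {m : ∣ B ∣ → ℕ} {f : ∣ A ∣ → ∣ B ∣} → PolyBounded B m → PolyBounded A (λ x → sz B (f x)) →
         PolyBounded A (λ x → m (f x))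
  bd-∘ {A} {B} {m} {f} (poly a k p) q =
    bd-≤ (λ x → p (f x)) (bd-* (bd-const a) (bd-^ k q))

  -- Variable 1 is a stack that the code leaves as it was, so that programs
  -- can be nested without renaming variables.
  record PT (A B : Data) (f : ∣ A ∣ → ∣ B ∣) : Set where
    field
      code    : Cmd 2
      time    : ∣ A ∣ → ℕ
      runs    : ∀ x s → ∃[ t ] ⟨ code , enc A x ∷ s ∷ [] ⟩⇓⟨ enc B (f x) ∷ s ∷ [] , t ⟩ × t ≤ time x
      bd-time : PolyBounded A time
      -- Composition depends on this: the time of the next program is measured in the size of this
      -- result, which sharing can make exponential in the time of the present one.
      bd-out  : PolyBounded A (λ x → sz B (f x))
  open PT public

  val stk : Expr 2
  val = var zero
  stk = var (suc zero)

  infix 6 val≔_ stk≔_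
  val≔_ stk≔_ : Expr 2 → Cmd 2
  val≔ e = zero ≔ e
  stk≔ e = suc zero ≔ e

  module _ {A B : Data} where

    assign-PT : ∀ {f} (e : Expr 2) → (∀ x s → eval (enc A x ∷ s ∷ []) e ≡ enc B (f x)) →
                PolyBounded A (λ x → sz B (f x)) → PT A B f
    assign-PT e eq bd = record
      { code    = val≔ e
      ; time    = λ _ → 1
      ; runs    = λ x s → 1 , subst (λ v → ⟨ val≔ e , _ ⟩⇓⟨ v ∷ s ∷ [] , 1 ⟩) (eq x s) assign , ≤-refl
      ; bd-time = bd-const 1
      ; bd-out  = bd
      }

    recode : ∀ {f} → (∀ x → enc A x ≡ enc B (f x)) → PT A B f
    recode eq = assign-PT val (λ x s → eq x)
      (bd-≤ (λ x → ≤-reflexive (cong size (sym (eq x)))) bd-sz)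

    PT-cong : ∀ {f g} → PT A B f → (∀ x → f x ≡ g x) → PT A B g
    PT-cong p eq = record
      { code = code p ; time = time p ; bd-time = bd-time p
      ; runs = λ x s → subst (λ y → ∃[ t ] ⟨ code p , _ ⟩⇓⟨ enc B y ∷ s ∷ [] , t ⟩ × t ≤ time p x) (eq x) (runs p x s)
      ; bd-out = bd-≤ (λ x → ≤-reflexive (cong (sz B) (sym (eq x)))) (bd-out p)
      }

  id′ : ∀ {A} → PT A A (λ x → x)
  id′ = recode λ _ → refl

  infixr 9 _∘′_
  _∘′_ : ∀ {A B C g f} → PT B C g → PT A B f → PT A C (λ x → g (f x))
  _∘′_ {f = f} q p = record
    { code = code p ⍮ code q
    ; time = λ x → time p x + time q (f x)
    ; runs = λ x s → let (t , r , b) = runs p x s ; (t′ , r′ , b′) = runs q (f x) s in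
                     t + t′ , seq r r′ , +-mono-≤ b b′
    ; bd-time = bd-+ (bd-time p) (bd-∘ (bd-time q) (bd-out p))
    ; bd-out = bd-∘ (bd-out q) (bd-out p)
    }

  infixr 5 _&_
  _&_ : ∀ {A B C f g} → PT A B f → PT A C g → PT A (B ⊗ C) (λ x → f x , g x)
  _&_ {A} {B} {C} {f} {g} p q = record
    -- The input is saved on the stack. After `p` the saved entry becomes the pair of its result and
    -- the input; `q` then runs on the input, and the pair is popped.
    { code = stk≔ cons val stk ⍮ code p ⍮
             stk≔ cons (cons val (hd stk)) (tl stk) ⍮ val≔ tl (hd stk) ⍮
             code q ⍮ val≔ cons (hd (hd stk)) val ⍮ stk≔ tl stk
    ; time = λ x → time p x + time q x + 5
    ; runs = λ x s → let (t , r , b) = runs p x (cons (enc A x) s)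
                         (t′ , r′ , b′) = runs q x (cons (cons (enc B (f x)) (enc A x)) s) in
        1 + (t + (1 + (1 + (t′ + (1 + 1))))) ,
        seq assign (seq r (seq assign (seq assign (seq r′ (seq assign assign))))) ,
        ≤-trans (≤-reflexive (shuffle t t′)) (+-monoˡ-≤ 5 (+-mono-≤ b b′))
    ; bd-time = bd-+ (bd-+ (bd-time p) (bd-time q)) (bd-const 5)
    ; bd-out = bd-+ (bd-const 1) (bd-+ (bd-out p) (bd-out q))
    }
    where
    shuffle : ∀ t t′ → 1 + (t + (1 + (1 + (t′ + (1 + 1))))) ≡ t + t′ + 5
    shuffle = solve-∀

  fst : ∀ {A B} → PT (A ⊗ B) A proj₁
  fst {A} = assign-PT (hd val) (λ _ _ → refl)
    (bd-≤ (λ (a , b) → ≤-trans (m≤m+n _ _) (n≤1+n _)) bd-sz)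

  snd : ∀ {A B} → PT (A ⊗ B) B proj₂
  snd {A} = assign-PT (tl val) (λ _ _ → refl)
    (bd-≤ (λ (a , b) → ≤-trans (m≤n+m _ (sz A a)) (n≤1+n _)) bd-sz)

  quoteTree : Tree → Expr 2
  quoteTree nil        = nil
  quoteTree (cons s t) = cons (quoteTree s) (quoteTree t)

  const′ : ∀ {A B} b → PT A B (λ _ → b)
  const′ {B = B} b = assign-PT (quoteTree (enc B b)) (λ x s → ok _ (enc B b)) (bd-const _)
    where
    ok : ∀ σ t → eval σ (quoteTree t) ≡ t
    ok σ nil        = refl
    ok σ (cons s t) = cong₂ cons (ok σ s) (ok σ t)

  if′ : ∀ {A B t f g} → PT A 𝔹 t → PT A B f → PT A B g → PT A B (λ x → cond (t x) (f x) (g x))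
  if′ {A} {B} {t} {f} {g} c p q = record
    { code = stk≔ cons val stk ⍮ code c ⍮
             if val then (val≔ hd stk ⍮ stk≔ tl stk ⍮ code p)
                    else (val≔ hd stk ⍮ stk≔ tl stk ⍮ code q)
    ; time = λ x → 4 + (time c x + (time p x + time q x))
    ; runs = λ x s → let (u , r , b) = runs c x (cons (enc A x) s) in branch x s u r b
    ; bd-time = bd-+ (bd-const 4) (bd-+ (bd-time c) (bd-+ (bd-time p) (bd-time q)))
    ; bd-out = bd-≤ out≤ (bd-+ (bd-out p) (bd-out q))
    }
    where
    out≤ : ∀ x → sz B (cond (t x) (f x) (g x)) ≤ sz B (f x) + sz B (g x)
    out≤ x with t x
    ... | true  = m≤m+n _ _
    ... | false = m≤n+m _ (sz B (f x))

    count : ∀ {u v w z z′} → u ≤ w → v ≤ z + z′ → 1 + (u + suc (1 + (1 + v))) ≤ 4 + (w + (z + z′))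
    count {u} {v} {w} {z} {z′} p q = s≤s (≤-trans (≤-reflexive (trans (+-suc u _) (cong suc (trans (+-suc u _) (cong suc (+-suc u _))))))
       (+-monoʳ-≤ 3 (+-mono-≤ p q)))

    branch : ∀ x s u → ⟨ code c , enc A x ∷ cons (enc A x) s ∷ [] ⟩⇓⟨ encodeBool (t x) ∷ cons (enc A x) s ∷ [] , u ⟩ → u ≤ time c x →
      ∃[ k ] ⟨ _ , enc A x ∷ s ∷ [] ⟩⇓⟨ enc B (cond (t x) (f x) (g x)) ∷ s ∷ [] , k ⟩ × k ≤ 4 + (time c x + (time p x + time q x))
    branch x s u r b with t x
    ... | true  = let (v , r′ , b′) = runs p x s in
      _ , seq assign (seq r (if-true (nil , nil , refl) (seq assign (seq assign r′)))) ,
      count {z = time p x} b (≤-trans b′ (m≤m+n _ _))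
    ... | false = let (v , r′ , b′) = runs q x s in
      _ , seq assign (seq r (if-false refl (seq assign (seq assign r′)))) ,
      count {z = time p x} b (≤-trans b′ (m≤n+m _ (time p x)))

  case-list : ∀ {E X : Data} {B : Set} → (∣ E ∣ → B) → (∣ E ∣ × (∣ X ∣ × List ∣ X ∣) → B) → ∣ E ∣ × List ∣ X ∣ → B
  case-list n c (e , [])     = n e
  case-list n c (e , x ∷ xs) = c (e , x , xs)

  case′ : ∀ {E X B f g} → PT E B f → PT (E ⊗ X ⊗ 𝕃 X) B g → PT (E ⊗ 𝕃 X) B (case-list {E} {X} f g)
  case′ {E} {X} {B} {f} {g} p q = record
    { code = if tl val then code q else (val≔ hd val ⍮ code p)
    ; time = λ (e , xs) → 2 + case-list {E} {X} (time p) (time q) (e , xs)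
    ; runs = λ { (e , []) s → let (t , r , b) = runs p e s in _ , if-false refl (seq assign r) , s≤s (s≤s b)
               ; (e , x ∷ xs) s → let (t , r , b) = runs q (e , x , xs) s in
                   _ , if-true (_ , _ , refl) r , s≤s (≤-trans b (n≤1+n _)) }
    ; bd-time = bd-+ (bd-const 2) (bd-case (bd-time p) (bd-time q))
    ; bd-out = bd-≤ (λ { (e , []) → ≤-refl ; (e , x ∷ xs) → ≤-refl }) (bd-case (bd-out p) (bd-out q))
    }
    where
    bd-case : ∀ {m m′} → PolyBounded E m → PolyBounded (E ⊗ X ⊗ 𝕃 X) m′ →
              PolyBounded (E ⊗ 𝕃 X) (case-list {E} {X} m m′)
    bd-case {m} {m′} u (poly b l v) =
      bd-≤ le (bd-+ (bd-∘ {A = E ⊗ 𝕃 X} u (bd-out (fst {E} {𝕃 X})))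
                (bd-* (bd-const b) (bd-^ l bd-sz)))
      where
      le : ∀ x → case-list {E} {X} m m′ x ≤ m (proj₁ x) + b * sz (E ⊗ 𝕃 X) x ^ l
      le (e , [])     = m≤m+n _ _
      le (e , x ∷ xs) = ≤-trans (v (e , x , xs)) (m≤n+m _ (m e))

  -- `F` is a primitive recursion whose step also sees the tail. The bound `bd` concerns `F` itself:
  -- a polynomial bound on the step alone would compound from element to element and become
  -- exponential. As a loop can only work from the end of the list towards its front, the list is
  -- reversed first.
  module _ {E X B : Data} (F : ∣ E ∣ → List ∣ X ∣ → ∣ B ∣)
    {z : ∣ E ∣ → ∣ B ∣} {f : ∣ E ∣ × (∣ X ∣ × (List ∣ X ∣ × ∣ B ∣)) → ∣ B ∣}
    (F-[] : ∀ e → F e [] ≡ z e)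
    (F-∷ : ∀ e x xs → F e (x ∷ xs) ≡ f (e , x , xs , F e xs))
    (pz : PT E B z) (pf : PT (E ⊗ X ⊗ 𝕃 X ⊗ B) B f)
    (bd : PolyBounded (E ⊗ 𝕃 X) (λ (e , xs) → sz B (F e xs)))
    where

    private
      elt env xs₁ rev₁ : Expr 2
      env  = hd val
      xs₁  = hd (tl val)
      rev₁ = tl (tl val)

      moveLoop stepLoop : Cmd 2
      moveLoop = while xs₁ loop (val≔ cons env (cons (tl xs₁) (cons (hd xs₁) rev₁)))
      elt = hd (hd (tl val))
      -- The value is (e , rest , suffix , F e suffix), where rest lists the
      -- elements still to be treated, the last one first.
      stepBody : Cmd 2
      stepBody =
        stk≔ cons (cons env (cons (tl (hd (tl val))) (cons elt (hd (tl (tl val)))))) stk ⍮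
        val≔ cons env (cons elt (tl (tl val))) ⍮
        code pf ⍮
        val≔ cons (hd (hd stk)) (cons (hd (tl (hd stk))) (cons (tl (tl (hd stk))) val)) ⍮
        stk≔ tl stk
      stepLoop = while hd (tl val) loop stepBody

      rec-code : Cmd 2
      rec-code =
        val≔ cons env (cons (tl val) nil) ⍮ moveLoop ⍮
        stk≔ cons (cons env rev₁) stk ⍮ val≔ env ⍮ code pz ⍮
        val≔ cons (hd (hd stk)) (cons (tl (hd stk)) (cons nil val)) ⍮ stk≔ tl stk ⍮
        stepLoop ⍮ val≔ tl (tl (tl val))

      encL : List ∣ X ∣ → Tree
      encL = encodeList (enc X)

      moves : ∀ e xs ys s →
        ⟨ moveLoop , cons (enc E e) (cons (encL xs) (encL ys)) ∷ s ∷ [] ⟩⇓⟨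
                     cons (enc E e) (cons nil (encL (xs ʳ++ ys))) ∷ s ∷ [] , 1 + length xs * 2 ⟩
      moves e []       ys s = while-false refl
      moves e (x ∷ xs) ys s = while-true (_ , _ , refl) assign (moves e xs (x ∷ ys) s)

      -- Throughout the loop `zs ʳ++ xs` is the whole list `ys`. The bound `τ` is required for all
      -- suffixes of `ys` at once because each of them occurs as an argument of the step.
      steps : ∀ e zs xs ys s τ → ys ≡ zs ʳ++ xs →
        (∀ us x vs → ys ≡ us ++ x ∷ vs → time pf (e , x , vs , F e vs) ≤ τ) →
        ∃[ t ] ⟨ stepLoop , cons (enc E e) (cons (encL zs) (cons (encL xs) (enc B (F e xs)))) ∷ s ∷ [] ⟩⇓⟨
                     cons (enc E e) (cons nil (cons (encL ys) (enc B (F e ys)))) ∷ s ∷ [] , t ⟩ ×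
               t ≤ 1 + length zs * (5 + τ)
      steps e []       xs .xs s τ refl bnd = 1 , while-false refl , ≤-refl
      steps e (z ∷ zs) xs ys s τ eq bnd
        with steps e zs (z ∷ xs) ys s τ eq bnd
           | runs pf (e , z , xs , F e xs) (cons (cons (enc E e) (cons (encL zs) (encL (z ∷ xs)))) s)
      ... | t′ , r′ , b′ | t , r , b rewrite F-∷ e z xs =
        _ , while-true (_ , _ , refl) (seq assign (seq assign (seq r (seq assign assign)))) r′ ,
        s≤s (≤-trans (+-mono-≤ (≤-reflexive (shuffle t)) b′)
          (≤-trans (≤-reflexive (+-suc (4 + t) (length zs * (5 + τ))))
            (+-monoˡ-≤ (length zs * (5 + τ)) (+-monoʳ-≤ 5 (≤-trans b
              (bnd (reverse zs) z xs (trans eq (ʳ++-defn zs))))))))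
        where
        shuffle : ∀ t → 1 + (1 + (t + (1 + 1))) ≡ 4 + t
        shuffle = solve-∀

      len≤ : ∀ xs → length xs ≤ sz (𝕃 X) xs
      len≤ []       = z≤n
      len≤ (x ∷ xs) = s≤s (≤-trans (len≤ xs) (m≤n+m _ (sz X x)))

      suffix≤ : ∀ us x vs → sz X x + sz (𝕃 X) vs ≤ sz (𝕃 X) (us ++ x ∷ vs)
      suffix≤ []       x vs = n≤1+n _
      suffix≤ (u ∷ us) x vs = ≤-trans (suffix≤ us x vs) (≤-trans (m≤n+m _ (sz X u)) (n≤1+n _))

      bout bin : ℕ → ℕ
      bout m = PolyBounded.coeff bd * m ^ PolyBounded.expo bd
      bin m = PolyBounded.coeff (bd-time pf) * m ^ PolyBounded.expo (bd-time pf)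

      -- An argument of the step consists of pieces of the whole input and a value of `F` on a
      -- suffix. It is thus no larger than the whole input plus the output bound, up to the three
      -- pairing cells, of which one is already counted in the whole; this leaves the 2.
      stepTime : ∣ E ⊗ 𝕃 X ∣ → ℕ
      stepTime x = bin (2 + (sz (E ⊗ 𝕃 X) x + bout (sz (E ⊗ 𝕃 X) x)))

      stepTime-ok : ∀ e us x vs → time pf (e , x , vs , F e vs) ≤ stepTime (e , us ++ x ∷ vs)
      stepTime-ok e us x vs = ≤-trans (PolyBounded.bounded (bd-time pf) _)
        (*-monoʳ-≤ (PolyBounded.coeff (bd-time pf)) (^-monoˡ-≤ (PolyBounded.expo (bd-time pf)) le))
        where
        whole : ℕ
        whole = sz (E ⊗ 𝕃 X) (e , us ++ x ∷ vs)
        le′ : sz E e + (sz X x + sz (𝕃 X) vs) ≤ whole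
        le′ = ≤-trans (+-monoʳ-≤ (sz E e) (suffix≤ us x vs)) (n≤1+n _)
        le″ : sz B (F e vs) ≤ bout whole
        le″ = ≤-trans (PolyBounded.bounded bd (e , vs))
          (*-monoʳ-≤ (PolyBounded.coeff bd) (^-monoˡ-≤ (PolyBounded.expo bd)
            (s≤s (+-monoʳ-≤ (sz E e) (≤-trans (m≤n+m _ (sz X x)) (suffix≤ us x vs))))))
        shuffle : ∀ a b c d → suc (a + suc (b + suc (c + d))) ≡ 3 + (a + (b + c)) + d
        shuffle = solve-∀
        le : sz (E ⊗ X ⊗ 𝕃 X ⊗ B) (e , x , vs , F e vs) ≤ 2 + (whole + bout whole)
        le = ≤-trans (≤-reflexive (shuffle (sz E e) (sz X x) (sz (𝕃 X) vs) (sz B (F e vs))))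
          (+-mono-≤ {3 + _} {2 + whole}
            (s≤s (s≤s (s≤s (+-monoʳ-≤ (sz E e) (suffix≤ us x vs))))) le″)

    rec′ : PT (E ⊗ 𝕃 X) B (λ (e , xs) → F e xs)
    rec′ = record
      { code = rec-code
      ; time = λ x → (9 + time pz (proj₁ x)) + (length (proj₂ x) * 2 + length (proj₂ x) * (5 + stepTime x))
      ; runs = runs′
      ; bd-time = bd-+ (bd-+ (bd-const 9) (bd-∘ {f = proj₁} (bd-time pz) (bd-out (fst {E} {𝕃 X}))))
          (bd-+ (bd-* bd-len (bd-const 2))
                (bd-* bd-len (bd-+ (bd-const 5) (bd-* (bd-const (PolyBounded.coeff (bd-time pf)))
                  (bd-^ (PolyBounded.expo (bd-time pf)) (bd-+ (bd-const 2) (bd-+ bd-sz (bd-* (bd-const (PolyBounded.coeff bd)) (bd-^ (PolyBounded.expo bd) bd-sz)))))))))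
      ; bd-out = bd
      }
      where
      bd-len : PolyBounded (E ⊗ 𝕃 X) (λ x → length (proj₂ x))
      bd-len = bd-≤ (λ (e , xs) → len≤ xs) (bd-out (snd {E} {𝕃 X}))
      count : ∀ {a b c d l l′ : ℕ} → a ≤ c → l′ ≡ l → b ≤ 1 + l′ * d →
        1 + ((1 + l * 2) + (1 + (1 + (a + (1 + (1 + (b + 1))))))) ≤ (9 + c) + (l * 2 + l * d)
      count {a} {b} {c} {d} {l} p refl q = ≤-trans (≤-reflexive (shuffle a b l))
         (≤-trans (+-monoˡ-≤ (l * 2) (+-mono-≤ (+-monoʳ-≤ 7 p) q)) (≤-trans (≤-reflexive (shuffle′ c l (l * d))) (n≤1+n _)))
        where
        shuffle : ∀ a b l → 1 + ((1 + l * 2) + (1 + (1 + (a + (1 + (1 + (b + 1))))))) ≡ ((7 + a) + b) + l * 2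
        shuffle = solve-∀
        shuffle′ : ∀ c l m → ((7 + c) + (1 + m)) + l * 2 ≡ (8 + c) + (l * 2 + m)
        shuffle′ = solve-∀
      runs′ : ∀ x s → ∃[ t ] ⟨ rec-code , enc (E ⊗ 𝕃 X) x ∷ s ∷ [] ⟩⇓⟨ enc B (F (proj₁ x) (proj₂ x)) ∷ s ∷ [] , t ⟩ ×
              t ≤ (9 + time pz (proj₁ x)) + (length (proj₂ x) * 2 + length (proj₂ x) * (5 + stepTime x))
      runs′ (e , xs) s
        with steps e (xs ʳ++ []) [] xs s (stepTime (e , xs)) (sym (trans (cong (_ʳ++ []) (trans (ʳ++-defn xs) (++-identityʳ _))) (trans (ʳ++-defn (reverse xs)) (trans (++-identityʳ _) (reverse-involutive xs)))))
               (λ { us x vs refl → stepTime-ok e us x vs })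
           | runs pz e (cons (cons (enc E e) (encL (xs ʳ++ []))) s)
      ... | t′ , r′ , b′ | t , r , b rewrite F-[] e =
        _ , seq assign (seq (moves e xs [] s) (seq assign (seq assign (seq r (seq assign (seq assign (seq r′ assign))))))) ,
        count {l = length xs} b (trans (length-ʳ++ xs) (+-identityʳ _)) b′

open Programs

open import Data.Bool using (Bool; true; false; _∧_; _∨_; not; T; T?) renaming (if_then_else_ to cond)
open import Data.Bool.ListAction using (all; any)
open import Data.Empty using (⊥; ⊥-elim)
open import Data.Fin using (Fin; toℕ; fromℕ<; zero; suc)
open import Data.Fin.Properties using (pigeonhole; fromℕ<-toℕ; toℕ<n; fromℕ<-injective; toℕ-injective; toℕ-fromℕ<)
import Data.Integer as ℤ
open import Data.Integer using (ℤ; -[1+_]; +≤+; +<+) renaming (+_ to pos)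
import Data.Integer.Properties as ℤₚ
import Data.Integer.Tactic.RingSolver as ℤSolver
open import Data.List using (List; []; _∷_; _++_; map; length; drop; filterᵇ; concat; concatMap; allFin; tabulate)
open import Data.List.Membership.Propositional using (_∈_; find; lose)
open import Data.List.Membership.Propositional.Properties using (∈-++⁺ˡ; ∈-++⁺ʳ; ∈-++⁻; ∈-map⁺; ∈-filter⁺; ∈-map⁻; ∈-concatMap⁺; ∈-concatMap⁻; ∈-tabulate⁺; ∈-tabulate⁻; ∈-filter⁻)
open import Data.List.Properties using (length-++; map-++; length-map; ++-identityʳ; ++-assoc; ∷-injective; filter-++; filter-all; filter-none; map-tabulate; length-tabulate; map-∘)
import Data.List.Relation.Unary.All as All
open import Data.List.Relation.Unary.All using (All; []; _∷_)
import Data.List.Relation.Unary.All.Properties as Allₚ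
open import Data.List.Relation.Unary.All.Properties using (map⁺)
import Data.List.Relation.Unary.AllPairs as AllPairs
open import Data.List.Relation.Unary.AllPairs using (AllPairs; []; _∷_)
import Data.List.Relation.Unary.AllPairs.Properties as AllPairsₚ
open import Data.List.Relation.Unary.Any using (here; there)
open import Data.List.Relation.Unary.Unique.Propositional using (Unique)
import Data.List.Relation.Unary.Unique.Propositional.Properties as Uniqueₚ
open import Data.Maybe using (Maybe; just; nothing)
open import Data.Nat using (ℕ; >-nonZero; zero; suc; pred; _+_; _*_; _∸_; _⊔_; _^_; _≤_; _≤ᵇ_; _≡ᵇ_; z≤n; s≤s; _<_; _≟_; _≤′_; ≤′-refl; ≤′-step; _<?_)
open import Data.Nat.Binary using (ℕᵇ; 2[1+_]; 1+[2_]) renaming (toℕ to toℕᵇ; fromℕ to fromℕᵇ)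
open import Data.Nat.Binary.Properties using () renaming (toℕ-fromℕ to toℕᵇ-fromℕᵇ; fromℕ-toℕ to fromℕᵇ-toℕᵇ)
open import Data.Nat.Divisibility using (_∣_; ∣m∣n⇒∣m+n; _∣0; divides; m∣m*n)
open import Data.Nat.ListAction using (sum; product)
open import Data.Nat.ListAction.Properties using (sum-++)
open import Data.Nat.Properties
open import Data.Nat.Tactic.RingSolver using (solve-∀)
open import Data.Product using (Σ; ∃-syntax; _×_; _,_; proj₁; proj₂)
import Data.Rational.Unnormalised as ℚ
open import Data.Rational.Unnormalised using (ℚᵘ; ↥_; ↧ₙ_; mkℚᵘ; 0ℚᵘ; _≃_; *≡*; *<*)
import Data.Rational.Unnormalised.Properties as ℚₚ
open import Data.Sum using (_⊎_; inj₁; inj₂)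
open import Data.Unit using (⊤; tt)
open import Data.Vec using ([]; _∷_; head)
open import Function.Base using (_∘_)
open import Function.Bundles using (Equivalence; mk⇔)
open import Relation.Binary.Construct.Closure.Transitive using (TransClosure; [_]; _∷_)
open import Relation.Binary.Definitions using (tri<; tri≈; tri>)
open import Relation.Binary.PropositionalEquality
open import Relation.Nullary using (¬_; yes; no)

open Equivalence using (to; from)

-- Boolean and list combinators

𝟙 : Data
𝟙 = data′ ⊤ (λ _ → nil)

ℕ̂ : Data
ℕ̂ = data′ ℕ encodeℕ

not′ : ∀ {A p} → PT A 𝔹 p → PT A 𝔹 (λ x → not (p x))
not′ {p = p} pp = PT-cong (if′ pp (const′ false) (const′ true)) λ x → h (p x)
  where h : ∀ b → cond b false true ≡ not b
        h true = refl
        h false = refl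

infixr 6 _∧′_
infixr 5 _∨′_
_∧′_ _∨′_ : ∀ {A p q} → PT A 𝔹 p → PT A 𝔹 q → PT A 𝔹 _
_∧′_ {p = p} {q} pp pq = PT-cong {g = λ x → p x ∧ q x} (if′ pp pq (const′ false)) λ x → h (p x) (q x)
  where h : ∀ b c → cond b c false ≡ (b ∧ c)
        h true c = refl
        h false c = refl
_∨′_ {p = p} {q} pp pq = PT-cong {g = λ x → p x ∨ q x} (if′ pp (const′ true) pq) λ x → h (p x) (q x)
  where h : ∀ b c → cond b true c ≡ (b ∨ c)
        h true c = refl
        h false c = refl

sz-Bool : ∀ b → size (encodeBool b) ≤ 3
sz-Bool true  = ≤-refl
sz-Bool false = s≤s z≤n

sumOver : ∀ {E X : Set} → (E × X → ℕ) → E → List X → ℕ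
sumOver g e []       = 0
sumOver g e (x ∷ xs) = g (e , x) + sumOver g e xs

sz-∷ : ∀ X (x : ∣ X ∣) xs → sz (𝕃 X) xs ≤ sz (𝕃 X) (x ∷ xs)
sz-∷ X x xs = ≤-trans (m≤n+m _ (sz X x)) (n≤1+n _)

length≤sz : ∀ X (xs : List ∣ X ∣) → length xs ≤ sz (𝕃 X) xs
length≤sz X []       = z≤n
length≤sz X (x ∷ xs) = s≤s (≤-trans (length≤sz X xs) (m≤n+m _ (sz X x)))

bd-length : ∀ {A X} {f : ∣ A ∣ → List ∣ X ∣} → PolyBounded A (λ x → sz (𝕃 X) (f x)) → PolyBounded A (λ x → length (f x))
bd-length {X = X} {f} = bd-≤ λ x → length≤sz X (f x)

bd-sumOver : ∀ {E X g} → PolyBounded (E ⊗ X) g → PolyBounded (E ⊗ 𝕃 X) (λ (e , xs) → sumOver g e xs)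
bd-sumOver {E} {X} {g} (poly a k b) =
  bd-≤ (λ (e , xs) → le e xs (sz (E ⊗ 𝕃 X) (e , xs)) (s≤s ≤-refl))
    (bd-* (bd-length {X = X} {f = proj₂} (bd-out (snd {E} {𝕃 X}))) (bd-* (bd-const a) (bd-^ k bd-sz)))
  where
  le : ∀ e xs m → suc (sz E e + sz (𝕃 X) xs) ≤ m → sumOver g e xs ≤ length xs * (a * m ^ k)
  le e []       m h = z≤n
  le e (x ∷ xs) m h = +-mono-≤
    (≤-trans (b (e , x)) (*-monoʳ-≤ a (^-monoˡ-≤ k (≤-trans (s≤s (+-monoʳ-≤ (sz E e) (≤-trans (m≤m+n _ _) (n≤1+n _)))) h))))
    (le e xs m (≤-trans (s≤s (+-monoʳ-≤ (sz E e) (sz-∷ X x xs))) h))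

-- Recursion in which every element adds a bounded amount to the size.
additive : ∀ {E X B : Data} (F : ∣ E ∣ → List ∣ X ∣ → ∣ B ∣) {z f} {g : ∣ E ⊗ X ∣ → ℕ}
  (F-[] : ∀ e → F e [] ≡ z e) (F-∷ : ∀ e x xs → F e (x ∷ xs) ≡ f (e , x , xs , F e xs)) →
  PT E B z → PT (E ⊗ X ⊗ 𝕃 X ⊗ B) B f → PolyBounded (E ⊗ X) g →
  (∀ e x xs b → sz B (f (e , x , xs , b)) ≤ g (e , x) + sz B b) →
  PT (E ⊗ 𝕃 X) B (λ (e , xs) → F e xs)
additive {E} {X} {B} F {z} {f} {g} F-[] F-∷ pz pf bg le =
  rec′ F F-[] F-∷ pz pf (bd-≤ (λ (e , xs) → bnd e xs)
    (bd-+ (bd-sumOver bg) (bd-out (pz ∘′ fst {E} {𝕃 X}))))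
  where
  bnd : ∀ e xs → sz B (F e xs) ≤ sumOver g e xs + sz B (z e)
  bnd e []       = ≤-reflexive (cong (sz B) (F-[] e))
  bnd e (x ∷ xs) = ≤-trans (≤-reflexive (cong (sz B) (F-∷ e x xs)))
    (≤-trans (le e x xs _) (≤-trans (+-monoʳ-≤ (g (e , x)) (bnd e xs))
      (≤-reflexive (sym (+-assoc (g (e , x)) _ _)))))

π-elem : ∀ {E X Y : Data} → PT (E ⊗ X ⊗ Y) (E ⊗ X) (λ (e , x , y) → e , x)
π-elem = fst & (fst ∘′ snd)

π-acc : ∀ {E X L B : Data} → PT (E ⊗ X ⊗ L ⊗ B) B (λ (e , x , l , b) → b)
π-acc = snd ∘′ snd ∘′ snd

cons′ : ∀ {A X f g} → PT A X f → PT A (𝕃 X) g → PT A (𝕃 X) (λ a → f a ∷ g a)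
cons′ {A} {X} {f} {g} p q = recode {A = X ⊗ 𝕃 X} {f = λ (x , xs) → x ∷ xs} (λ _ → refl) ∘′ (p & q)

[]′ : ∀ {A X} → PT A (𝕃 X) (λ _ → [])
[]′ = const′ []

map′ : ∀ {Γ X Y F xs} → PT (Γ ⊗ X) Y F → PT Γ (𝕃 X) xs → PT Γ (𝕃 Y) (λ γ → map (λ x → F (γ , x)) (xs γ))
map′ {Γ} {X} {Y} {F} p q =
  additive (λ γ → map (λ x → F (γ , x))) (λ _ → refl) (λ _ _ _ → refl)
    []′ (cons′ (p ∘′ π-elem) π-acc) (bd-+ (bd-const 1) (bd-out p)) (λ _ _ _ _ → ≤-refl)
  ∘′ (id′ & q)

filterᵇ-∷ : ∀ {A : Set} (p : A → Bool) x xs → filterᵇ p (x ∷ xs) ≡ cond (p x) (x ∷ filterᵇ p xs) (filterᵇ p xs)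
filterᵇ-∷ p x xs with p x
... | true  = refl
... | false = refl

filter′ : ∀ {Γ X P xs} → PT (Γ ⊗ X) 𝔹 P → PT Γ (𝕃 X) xs → PT Γ (𝕃 X) (λ γ → filterᵇ (λ x → P (γ , x)) (xs γ))
filter′ {Γ} {X} {P} p q =
  additive (λ γ → filterᵇ (λ x → P (γ , x))) (λ _ → refl) (λ γ → filterᵇ-∷ (λ x → P (γ , x)))
    []′ (if′ (p ∘′ π-elem) (cons′ (fst ∘′ snd) π-acc) π-acc) (bd-+ (bd-const 1) (bd-out (snd {Γ} {X})))
    (λ γ x xs b → le (P (γ , x)) x b)
  ∘′ (id′ & q)
  where
  le : ∀ c x b → sz (𝕃 X) (cond c (x ∷ b) b) ≤ 1 + sz X x + sz (𝕃 X) b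
  le true  x b = ≤-refl
  le false x b = m≤n+m _ (suc (sz X x))

module _ {Γ X : Data} {P : ∣ Γ ⊗ X ∣ → Bool} {xs : ∣ Γ ∣ → List ∣ X ∣} (p : PT (Γ ⊗ X) 𝔹 P) (q : PT Γ (𝕃 X) xs) where

  all′ : PT Γ 𝔹 (λ γ → all (λ x → P (γ , x)) (xs γ))
  all′ = rec′ (λ γ → all (λ x → P (γ , x))) (λ _ → refl) (λ _ _ _ → refl)
      (const′ true) ((p ∘′ π-elem) ∧′ π-acc) (bd-≤ (λ _ → sz-Bool _) (bd-const 3))
    ∘′ (id′ & q)

  any′ : PT Γ 𝔹 (λ γ → any (λ x → P (γ , x)) (xs γ))
  any′ = rec′ (λ γ → any (λ x → P (γ , x))) (λ _ → refl) (λ _ _ _ → refl)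
      (const′ false) ((p ∘′ π-elem) ∨′ π-acc) (bd-≤ (λ _ → sz-Bool _) (bd-const 3))
    ∘′ (id′ & q)

append′ : ∀ {X} → PT (𝕃 X ⊗ 𝕃 X) (𝕃 X) (λ (ys , xs) → xs ++ ys)
append′ {X} = additive (λ ys xs → xs ++ ys) (λ _ → refl) (λ _ _ _ → refl) id′ (cons′ (fst ∘′ snd) π-acc)
    (bd-+ (bd-const 1) (bd-out (snd {𝕃 X} {X}))) (λ _ _ _ _ → ≤-refl)

infixr 5 _++′_
_++′_ : ∀ {Γ X f g} → PT Γ (𝕃 X) f → PT Γ (𝕃 X) g → PT Γ (𝕃 X) (λ γ → f γ ++ g γ)
p ++′ q = append′ ∘′ (q & p)

sz-++ : ∀ X xs ys → sz (𝕃 X) (xs ++ ys) ≤ sz (𝕃 X) xs + sz (𝕃 X) ys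
sz-++ X []       ys = n≤1+n _
sz-++ X (x ∷ xs) ys = s≤s (≤-trans (+-monoʳ-≤ (sz X x) (sz-++ X xs ys)) (≤-reflexive (sym (+-assoc (sz X x) _ _))))

concat′ : ∀ {X} → PT (𝕃 (𝕃 X)) (𝕃 X) concat
concat′ {X} = additive {E = 𝟙} (λ _ → concat) (λ _ → refl) (λ _ _ _ → refl) []′ ((fst ∘′ snd) ++′ π-acc)
    (bd-out (snd {𝟙} {𝕃 X})) (λ _ x _ b → sz-++ X x b)
  ∘′ (const′ tt & id′)

concatMap′ : ∀ {Γ X Y F xs} → PT (Γ ⊗ X) (𝕃 Y) F → PT Γ (𝕃 X) xs → PT Γ (𝕃 Y) (λ γ → concatMap (λ x → F (γ , x)) (xs γ))
concatMap′ p q = concat′ ∘′ map′ p q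

drop1 : ∀ {X} → PT (𝕃 X) (𝕃 X) (drop 1)
drop1 {X} = PT-cong (case′ {E = 𝟙} {X = X} []′ (snd ∘′ snd) ∘′ (const′ tt & id′))
  λ { [] → refl ; (x ∷ xs) → refl }

-- Binary numerals as lists of digits

digitsᵇ : ℕᵇ → List Bool
digitsᵇ ℕᵇ.zero  = []
digitsᵇ 2[1+ b ] = false ∷ digitsᵇ b
digitsᵇ 1+[2 b ] = true ∷ digitsᵇ b

undigitsᵇ : List Bool → ℕᵇ
undigitsᵇ []           = ℕᵇ.zero
undigitsᵇ (false ∷ bs) = 2[1+ undigitsᵇ bs ]
undigitsᵇ (true ∷ bs)  = 1+[2 undigitsᵇ bs ]

digits : ℕ → List Bool
digits n = digitsᵇ (fromℕᵇ n)

digit : Bool → ℕ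
digit false = 2
digit true  = 1

value : List Bool → ℕ
value []       = 0
value (b ∷ bs) = digit b + 2 * value bs

toℕᵇ-undigitsᵇ : ∀ bs → toℕᵇ (undigitsᵇ bs) ≡ value bs
toℕᵇ-undigitsᵇ []           = refl
toℕᵇ-undigitsᵇ (false ∷ bs) = trans (*-distribˡ-+ 2 1 (toℕᵇ (undigitsᵇ bs))) (cong (λ v → 2 + 2 * v) (toℕᵇ-undigitsᵇ bs))
toℕᵇ-undigitsᵇ (true ∷ bs)  = cong (λ v → suc (2 * v)) (toℕᵇ-undigitsᵇ bs)

undigits-digitsᵇ : ∀ b → undigitsᵇ (digitsᵇ b) ≡ b
undigits-digitsᵇ ℕᵇ.zero  = refl
undigits-digitsᵇ 2[1+ b ] = cong 2[1+_] (undigits-digitsᵇ b)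
undigits-digitsᵇ 1+[2 b ] = cong 1+[2_] (undigits-digitsᵇ b)

value-digits : ∀ n → value (digits n) ≡ n
value-digits n = trans (sym (toℕᵇ-undigitsᵇ (digits n))) (trans (cong toℕᵇ (undigits-digitsᵇ (fromℕᵇ n))) (toℕᵇ-fromℕᵇ n))

encode-digitsᵇ : ∀ b → encodeℕᵇ b ≡ enc (𝕃 𝔹) (digitsᵇ b)
encode-digitsᵇ ℕᵇ.zero  = refl
encode-digitsᵇ 2[1+ b ] = cong (cons _) (encode-digitsᵇ b)
encode-digitsᵇ 1+[2 b ] = cong (cons _) (encode-digitsᵇ b)

encode-undigitsᵇ : ∀ bs → encodeℕᵇ (undigitsᵇ bs) ≡ enc (𝕃 𝔹) bs
encode-undigitsᵇ []           = refl
encode-undigitsᵇ (false ∷ bs) = cong (cons _) (encode-undigitsᵇ bs)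
encode-undigitsᵇ (true ∷ bs)  = cong (cons _) (encode-undigitsᵇ bs)

-- In bijective base 2 every list of digits is a numeral and no number has two of them, so a number
-- and its list of digits are the same tree. Conversion in either direction is a mere
-- reinterpretation.
digits′ : PT ℕ̂ (𝕃 𝔹) digits
digits′ = recode λ n → encode-digitsᵇ (fromℕᵇ n)

value′ : PT (𝕃 𝔹) ℕ̂ value
value′ = recode λ bs → trans (sym (encode-undigitsᵇ bs))
  (cong encodeℕᵇ (trans (sym (fromℕᵇ-toℕᵇ (undigitsᵇ bs))) (cong fromℕᵇ (toℕᵇ-undigitsᵇ bs))))

2^length≤ : ∀ bs → 2 ^ length bs ≤ suc (value bs)
2^length≤ []       = ≤-refl
2^length≤ (b ∷ bs) = ≤-trans (*-monoʳ-≤ 2 (2^length≤ bs))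
  (≤-trans (≤-reflexive (*-distribˡ-+ 2 1 (value bs))) (+-monoˡ-≤ (2 * value bs) (lo b)))
  where lo : ∀ b → 2 ≤ suc (digit b)
        lo false = s≤s (s≤s z≤n)
        lo true  = ≤-refl

-- Equality holds when all digits are 2.
value≤ : ∀ bs → 2 + value bs ≤ 2 ^ suc (length bs)
value≤ []       = ≤-refl
value≤ (b ∷ bs) = ≤-trans (≤-trans (+-monoʳ-≤ 2 (+-monoˡ-≤ (2 * value bs) (hi b)))
     (≤-reflexive (sym (*-distribˡ-+ 2 2 (value bs))))) (*-monoʳ-≤ 2 (value≤ bs))
  where hi : ∀ b → digit b ≤ 2
        hi false = ≤-refl
        hi true  = s≤s z≤n

sz-Bools : ∀ bs → sz (𝕃 𝔹) bs ≤ 1 + 4 * length bs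
sz-Bools []       = ≤-refl
sz-Bools (b ∷ bs) = ≤-trans (s≤s (+-mono-≤ (sz-Bool b) (sz-Bools bs))) (≤-reflexive (shuffle (length bs)))
  where shuffle : ∀ l → 1 + (3 + (1 + 4 * l)) ≡ 1 + 4 * (1 + l)
        shuffle = solve-∀

length<sz-Bools : ∀ bs → suc (length bs) ≤ sz (𝕃 𝔹) bs
length<sz-Bools []       = ≤-refl
length<sz-Bools (b ∷ bs) = s≤s (≤-trans (length<sz-Bools bs) (m≤n+m _ (size (encodeBool b))))

n≤2^sz : ∀ n → n ≤ 2 ^ sz ℕ̂ n
n≤2^sz n = ≤-trans (≤-reflexive (sym (value-digits n)))
  (≤-trans (≤-trans (m≤n+m _ 2) (value≤ (digits n)))
    (^-monoʳ-≤ 2 (≤-trans (length<sz-Bools (digits n)) (≤-reflexive (cong size (sym (encode-digitsᵇ (fromℕᵇ n))))))))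

sz-ℕ≤ : ∀ {n} p → n ≤ 2 ^ p → sz ℕ̂ n ≤ 5 + 4 * p
sz-ℕ≤ {n} p n≤ = ≤-trans (≤-reflexive (cong size (encode-digitsᵇ (fromℕᵇ n))))
  (≤-trans (sz-Bools (digits n)) (≤-trans (s≤s (*-monoʳ-≤ 4 len≤)) (≤-reflexive (cong suc (*-distribˡ-+ 4 1 p)))))
  where
  len≤ : length (digits n) ≤ suc p
  len≤ = ≮⇒≥ λ p< → <-irrefl refl
    (≤-trans (^-monoʳ-< 2 (s≤s (s≤s z≤n)) p<)
    (≤-trans (2^length≤ (digits n)) (≤-trans (s≤s (≤-trans (≤-reflexive (value-digits n)) n≤))
      (≤-trans (+-monoˡ-≤ (2 ^ p) (m^n>0 2 p)) (≤-reflexive (cong (2 ^ p +_) (sym (+-identityʳ (2 ^ p)))))))))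

-- Numerals have logarithmic size. Hence a computed number is harmless as soon as it is at most 2 to
-- the power of a polynomial; all size bounds for arithmetic results go through this.
bd-ℕ : ∀ {A} {f p : ∣ A ∣ → ℕ} → (∀ x → f x ≤ 2 ^ p x) → PolyBounded A p → PolyBounded A (λ x → sz ℕ̂ (f x))
bd-ℕ {p = p} le b = bd-≤ (λ x → sz-ℕ≤ (p x) (le x)) (bd-+ (bd-const 5) (bd-* (bd-const 4) b))

bd-Bools : ∀ {A} (f : ∣ A ∣ → List Bool) → PolyBounded A (λ x → length (f x)) → PolyBounded A (λ x → sz (𝕃 𝔹) (f x))
bd-Bools f b = bd-≤ (λ x → sz-Bools (f x)) (bd-+ (bd-const 1) (bd-* (bd-const 4) b))

inc : List Bool → List Bool
inc []           = true ∷ []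
inc (true ∷ bs)  = false ∷ bs
inc (false ∷ bs) = true ∷ inc bs

dbl : List Bool → List Bool
dbl []           = []
dbl (true ∷ bs)  = false ∷ dbl bs
dbl (false ∷ bs) = false ∷ true ∷ bs

dec : List Bool → List Bool
dec []           = []
-- Dropping the lowest digit 1 would leave a digit 0, which the numerals do not have; the doubling
-- is carried out on the remaining digits instead.
dec (true ∷ bs)  = dbl bs
dec (false ∷ bs) = true ∷ bs

value-inc : ∀ bs → value (inc bs) ≡ suc (value bs)
value-inc []           = refl
value-inc (true ∷ bs)  = refl
value-inc (false ∷ bs) = cong suc (trans (cong (2 *_) (value-inc bs)) (*-distribˡ-+ 2 1 (value bs)))

value-dbl : ∀ bs → value (dbl bs) ≡ 2 * value bs
value-dbl []           = refl
value-dbl (true ∷ bs)  = trans (cong (λ v → 2 + 2 * v) (value-dbl bs)) (sym (*-distribˡ-+ 2 1 (2 * value bs)))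
value-dbl (false ∷ bs) = shuffle (value bs)
  where shuffle : ∀ v → 2 + 2 * (1 + 2 * v) ≡ 2 * (2 + 2 * v)
        shuffle = solve-∀

value-dec : ∀ bs → value (dec bs) ≡ pred (value bs)
value-dec []           = refl
value-dec (true ∷ bs)  = value-dbl bs
value-dec (false ∷ bs) = refl

length-inc : ∀ bs → length (inc bs) ≤ suc (length bs)
length-inc []           = ≤-refl
length-inc (true ∷ bs)  = n≤1+n _
length-inc (false ∷ bs) = s≤s (length-inc bs)

length-dbl : ∀ bs → length (dbl bs) ≤ suc (length bs)
length-dbl []           = z≤n
length-dbl (true ∷ bs)  = s≤s (length-dbl bs)
length-dbl (false ∷ bs) = ≤-refl

inc′ dbl′ dec′ : PT (𝕃 𝔹) (𝕃 𝔹) _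
inc′ = rec′ {E = 𝟙} {X = 𝔹} (λ _ → inc) (λ _ → refl) (λ _ → λ { true _ → refl ; false _ → refl })
    (const′ (true ∷ [])) (if′ (fst ∘′ snd) (cons′ (const′ false) (fst ∘′ snd ∘′ snd)) (cons′ (const′ true) π-acc))
    (bd-Bools (λ (_ , bs) → inc bs) (bd-≤ (λ (_ , bs) → length-inc bs) (bd-+ (bd-const 1) (bd-length {X = 𝔹} {f = proj₂} (bd-out (snd {𝟙}))))))
  ∘′ (const′ tt & id′)
dbl′ = rec′ {E = 𝟙} {X = 𝔹} (λ _ → dbl) (λ _ → refl) (λ _ → λ { true _ → refl ; false _ → refl })
    []′ (if′ (fst ∘′ snd) (cons′ (const′ false) π-acc) (cons′ (const′ false) (cons′ (const′ true) (fst ∘′ snd ∘′ snd))))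
    (bd-Bools (λ (_ , bs) → dbl bs) (bd-≤ (λ (_ , bs) → length-dbl bs) (bd-+ (bd-const 1) (bd-length {X = 𝔹} {f = proj₂} (bd-out (snd {𝟙}))))))
  ∘′ (const′ tt & id′)
dec′ = PT-cong {g = dec} (case′ {E = 𝟙} {X = 𝔹} []′
    (if′ (fst ∘′ snd) (dbl′ ∘′ snd ∘′ snd) (cons′ (const′ true) (snd ∘′ snd))) ∘′ (const′ tt & id′))
  λ { [] → refl ; (true ∷ bs) → refl ; (false ∷ bs) → refl }

module _ {Γ : Data} {f : ∣ Γ ∣ → ℕ} (p : PT Γ ℕ̂ f) where

  suc′ : PT Γ ℕ̂ (λ γ → suc (f γ))
  suc′ = PT-cong (value′ ∘′ inc′ ∘′ digits′) (λ n → trans (value-inc (digits n)) (cong suc (value-digits n))) ∘′ p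

  pred′ : PT Γ ℕ̂ (λ γ → pred (f γ))
  pred′ = PT-cong (value′ ∘′ dec′ ∘′ digits′) (λ n → trans (value-dec (digits n)) (cong pred (value-digits n))) ∘′ p

  double′ : PT Γ ℕ̂ (λ γ → 2 * f γ)
  double′ = PT-cong (value′ ∘′ dbl′ ∘′ digits′) (λ n → trans (value-dbl (digits n)) (cong (2 *_) (value-digits n))) ∘′ p

-- Binary arithmetic

-- A digit 0, 1 or 2 is given by the answers to "is it positive?" and "is it 2?".
Digit : Set
Digit = Bool × Bool

𝔻 : Data
𝔻 = 𝔹 ⊗ 𝔹

lowest : List Bool → Digit
lowest []       = false , false
lowest (b ∷ bs) = true , not b

bit : Bool → ℕ
bit b = cond b 1 0

digitValue : Digit → ℕ
digitValue (p , q) = bit p + bit q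

paddedValue : List Digit → ℕ
paddedValue []       = 0
paddedValue (d ∷ ds) = digitValue d + 2 * paddedValue ds

-- The clock bounds the number of digits; zeros are appended to the shorter number.
align : List Bool × List Bool → List Bool → (List Bool × List Bool) × List (Digit × Digit)
align xy []      = xy , []
align xy (_ ∷ c) = let ((xs , ys) , o) = align xy c in
  (drop 1 xs , drop 1 ys) , o ++ (lowest xs , lowest ys) ∷ []

sz-lowest : ∀ bs → sz 𝔻 (lowest bs) ≤ 7
sz-lowest []          = s≤s (s≤s (s≤s z≤n))
sz-lowest (true ∷ _)  = s≤s (s≤s (s≤s (s≤s (s≤s z≤n))))
sz-lowest (false ∷ _) = ≤-refl

sz-drop1 : ∀ (bs : List Bool) → sz (𝕃 𝔹) (drop 1 bs) ≤ sz (𝕃 𝔹) bs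
sz-drop1 []       = ≤-refl
sz-drop1 (b ∷ bs) = sz-∷ 𝔹 b bs

lowest′ : PT (𝕃 𝔹) 𝔻 lowest
lowest′ = PT-cong {g = lowest} (case′ {E = 𝟙} {X = 𝔹} (const′ (false , false)) (const′ true & not′ (fst ∘′ snd)) ∘′ (const′ tt & id′))
  λ { [] → refl ; (_ ∷ _) → refl }

align′ : PT ((𝕃 𝔹 ⊗ 𝕃 𝔹) ⊗ 𝕃 𝔹) ((𝕃 𝔹 ⊗ 𝕃 𝔹) ⊗ 𝕃 (𝔻 ⊗ 𝔻)) (λ (xy , c) → align xy c)
align′ = rec′ align (λ _ → refl) (λ _ _ _ → refl) (id′ & []′)
  (((drop1 ∘′ xs) & (drop1 ∘′ ys)) & ((snd ∘′ acc) ++′ cons′ ((lowest′ ∘′ xs) & (lowest′ ∘′ ys)) []′))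
  (bd-≤ (λ (xy , c) → le xy c) (bd-+ (bd-const 2) (bd-+ (bd-out (fst {_} {𝕃 𝔹})) (bd-* (bd-const 16) (bd-length {X = 𝔹} {f = proj₂} (bd-out (snd {𝕃 𝔹 ⊗ 𝕃 𝔹})))))))
  where
  acc = π-acc {𝕃 𝔹 ⊗ 𝕃 𝔹} {𝔹} {𝕃 𝔹} {(𝕃 𝔹 ⊗ 𝕃 𝔹) ⊗ 𝕃 (𝔻 ⊗ 𝔻)}
  xs = fst ∘′ fst ∘′ acc
  ys = snd ∘′ fst ∘′ acc
  o≤ : ∀ xy c → sz (𝕃 (𝔻 ⊗ 𝔻)) (proj₂ (align xy c)) ≤ 1 + 16 * length c
  o≤ xy []      = ≤-refl
  o≤ xy (_ ∷ c) = let ((us , vs) , o) = align xy c in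
    ≤-trans (sz-snoc o (lowest us , lowest vs)) (≤-trans (+-mono-≤ (s≤s (s≤s (+-mono-≤ (sz-lowest us) (sz-lowest vs)))) (o≤ xy c))
      (≤-reflexive (shuffle′ (length c))))
    where
    shuffle′ : ∀ l → 16 + (1 + 16 * l) ≡ 1 + 16 * (1 + l)
    shuffle′ = solve-∀
    sz-snoc : ∀ o d → sz (𝕃 (𝔻 ⊗ 𝔻)) (o ++ d ∷ []) ≤ suc (sz (𝔻 ⊗ 𝔻) d) + sz (𝕃 (𝔻 ⊗ 𝔻)) o
    sz-snoc []      d = ≤-refl
    sz-snoc (x ∷ o) d = s≤s (≤-trans (+-monoʳ-≤ (sz (𝔻 ⊗ 𝔻) x) (sz-snoc o d))
      (≤-reflexive (x+sy (sz (𝔻 ⊗ 𝔻) x) (sz (𝔻 ⊗ 𝔻) d) (sz (𝕃 (𝔻 ⊗ 𝔻)) o))))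
      where x+sy : ∀ x d o → x + (suc d + o) ≡ d + suc (x + o)
            x+sy = solve-∀
  rest≤ : ∀ xy c → sz (𝕃 𝔹 ⊗ 𝕃 𝔹) (proj₁ (align xy c)) ≤ sz (𝕃 𝔹 ⊗ 𝕃 𝔹) xy
  rest≤ xy []      = ≤-refl
  rest≤ xy (_ ∷ c) = let ((us , vs) , o) = align xy c in
    ≤-trans (s≤s (+-mono-≤ (sz-drop1 us) (sz-drop1 vs))) (rest≤ xy c)
  le : ∀ xy c → sz ((𝕃 𝔹 ⊗ 𝕃 𝔹) ⊗ 𝕃 (𝔻 ⊗ 𝔻)) (align xy c) ≤ 2 + (sz (𝕃 𝔹 ⊗ 𝕃 𝔹) xy + 16 * length c)
  le xy c = ≤-trans (s≤s (+-mono-≤ (rest≤ xy c) (o≤ xy c))) (≤-reflexive (cong suc (+-suc (sz (𝕃 𝔹 ⊗ 𝕃 𝔹) xy) (16 * length c))))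

zipDigits : List Bool → List Bool → List (Digit × Digit)
zipDigits xs ys = proj₂ (align (xs , ys) (xs ++ ys))

paddedValue-snoc : ∀ ds d → paddedValue (ds ++ d ∷ []) ≡ paddedValue ds + 2 ^ length ds * digitValue d
paddedValue-snoc []       d = trans (+-identityʳ _) (sym (+-identityʳ _))
paddedValue-snoc (e ∷ ds) d = trans (cong (λ v → digitValue e + 2 * v) (paddedValue-snoc ds d)) (shuffle (digitValue e) (paddedValue ds) (2 ^ length ds) (digitValue d))
  where shuffle : ∀ e p t d → e + 2 * (p + t * d) ≡ e + 2 * p + 2 * t * d
        shuffle = solve-∀

value-split : ∀ bs → value bs ≡ digitValue (lowest bs) + 2 * value (drop 1 bs)
value-split []           = refl
value-split (true ∷ bs)  = refl
value-split (false ∷ bs) = refl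

-- `side` stands for `proj₁` or `proj₂`. With its naturality as a hypothesis, both components of the
-- aligned list are treated by one proof.
module _ (side : ∀ {A : Set} → A × A → A)
         (side-× : ∀ {A B : Set} (f : A → B) (p : A × A) → side (f (proj₁ p) , f (proj₂ p)) ≡ f (side p)) where

  align-value : ∀ xy c → let (rest , o) = align xy c in
    value (side xy) ≡ paddedValue (map side o) + 2 ^ length (map side o) * value (side rest)
  align-value xy []      = sym (*-identityˡ _)
  align-value xy (_ ∷ c) with align xy c | align-value xy c
  ... | rest , o | ih =
    trans ih (trans (cong (λ v → paddedValue os + 2 ^ length os * v) (value-split (side rest)))
     (trans (shuffle (paddedValue os) (2 ^ length os) (digitValue (lowest (side rest))) (value (drop 1 (side rest))))
       (trans (cong₂ (λ u v → u + 2 ^ v * value (drop 1 (side rest)))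
         (sym (paddedValue-snoc os (lowest (side rest)))) (sym (trans (length-++ os) (+-comm _ 1))))
       (cong₂ (λ u v → paddedValue u + 2 ^ length u * value v) (sym (trans (map-++ side o _) (cong (λ d → os ++ d ∷ []) (side-× lowest rest))))
         (sym (side-× (drop 1) rest))))))
    where
    os = map side o
    shuffle : ∀ p t d v → p + t * (d + 2 * v) ≡ p + t * d + 2 * t * v
    shuffle = solve-∀

  align-rest : ∀ xy c → length (side (proj₁ (align xy c))) ≡ length (side xy) ∸ length c
  align-rest xy []      = refl
  align-rest xy (_ ∷ c) with align xy c | align-rest xy c
  ... | rest , o | ih = trans (cong length (side-× (drop 1) rest))
    (trans (h (side rest)) (trans (cong pred ih) (pred[m∸n]≡m∸[1+n] _ (length c))))
    where h : (bs : List Bool) → length (drop 1 bs) ≡ pred (length bs)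
          h []      = refl
          h (_ ∷ _) = refl

  zipDigits-value : ∀ xs ys → length (side (xs , ys)) ≤ length (xs ++ ys) →
    paddedValue (map side (zipDigits xs ys)) ≡ value (side (xs , ys))
  zipDigits-value xs ys le = sym (trans (align-value (xs , ys) (xs ++ ys))
    (trans (cong (λ bs → paddedValue os + 2 ^ length os * value bs)
             (empty (side (proj₁ (align (xs , ys) (xs ++ ys)))) (trans (align-rest (xs , ys) (xs ++ ys)) (m≤n⇒m∸n≡0 le))))
           (trans (cong (paddedValue os +_) (*-zeroʳ (2 ^ length os))) (+-identityʳ _))))
    where
    os = map side (zipDigits xs ys)
    empty : (bs : List Bool) → length bs ≡ 0 → bs ≡ []
    empty [] _ = refl

zipDigits-value₁ : ∀ xs ys → paddedValue (map proj₁ (zipDigits xs ys)) ≡ value xs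
zipDigits-value₁ xs ys = zipDigits-value proj₁ (λ _ _ → refl) xs ys (≤-trans (m≤m+n _ _) (≤-reflexive (sym (length-++ xs))))

zipDigits-value₂ : ∀ xs ys → paddedValue (map proj₂ (zipDigits xs ys)) ≡ value ys
zipDigits-value₂ xs ys = zipDigits-value proj₂ (λ _ _ → refl) xs ys (≤-trans (m≤n+m _ (length xs)) (≤-reflexive (sym (length-++ xs))))

zipDigits′ : PT (ℕ̂ ⊗ ℕ̂) (𝕃 (𝔻 ⊗ 𝔻)) (λ (a , b) → zipDigits (digits a) (digits b))
zipDigits′ = snd ∘′ align′ ∘′ (((digits′ ∘′ fst) & (digits′ ∘′ snd)) & ((digits′ ∘′ fst) ++′ (digits′ ∘′ snd)))

times : ∀ {A : Set} → (A → A) → Digit → A → A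
times f (p , q) x = let y = cond p (f x) x in cond q (f y) y

times′ : ∀ {Γ B g d} {f : ∣ B ∣ → ∣ B ∣} → PT B B f → PT Γ 𝔻 d → PT Γ B g → PT Γ B (λ γ → times f (d γ) (g γ))
times′ {Γ} {B} {g} {d} {f} pf pd pg = second ∘′ ((snd ∘′ pd) & first)
  where
  first : PT Γ B (λ γ → cond (proj₁ (d γ)) (f (g γ)) (g γ))
  first = if′ (fst ∘′ pd) (pf ∘′ pg) pg
  second : PT (𝔹 ⊗ B) B (λ (q , y) → cond q (f y) y)
  second = if′ fst (pf ∘′ snd) snd

times-inv : ∀ {A : Set} (h : ℕ → A) f → (∀ n → f (h n) ≡ h (suc n)) → ∀ d n → times f d (h n) ≡ h (digitValue d + n)
times-inv h f eq (false , false) n = refl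
times-inv h f eq (true , false)  n = eq n
times-inv h f eq (false , true)  n = eq n
times-inv h f eq (true , true)   n = trans (cong f (eq n)) (eq (suc n))

digitValue≤2 : ∀ d → digitValue d ≤ 2
digitValue≤2 (false , false) = z≤n
digitValue≤2 (true , false)  = s≤s z≤n
digitValue≤2 (false , true)  = s≤s z≤n
digitValue≤2 (true , true)   = ≤-refl

paddedValue≤ : ∀ ds → 2 + paddedValue ds ≤ 2 ^ suc (length ds)
paddedValue≤ []       = ≤-refl
paddedValue≤ (d ∷ ds) = ≤-trans (≤-trans (+-monoʳ-≤ 2 (+-monoˡ-≤ _ (digitValue≤2 d))) (≤-reflexive (sym (*-distribˡ-+ 2 2 (paddedValue ds)))))
  (*-monoʳ-≤ 2 (paddedValue≤ ds))

-- Addition by Horner's rule: the sum of the higher digits is doubled and then incremented at most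
-- four times. This way no carry is threaded through the recursion.
sumDigits : List (Digit × Digit) → ℕ
sumDigits []             = 0
sumDigits ((d , e) ∷ ds) = times suc d (times suc e (2 * sumDigits ds))

sumDigits-value : ∀ ds → sumDigits ds ≡ paddedValue (map proj₁ ds) + paddedValue (map proj₂ ds)
sumDigits-value []             = refl
sumDigits-value ((d , e) ∷ ds) = trans (cong (times suc d) (times-inv (λ n → n) suc (λ _ → refl) e _))
  (trans (times-inv (λ n → n) suc (λ _ → refl) d _) (trans (cong (λ s → digitValue d + (digitValue e + 2 * s)) (sumDigits-value ds))
    (shuffle (digitValue d) (digitValue e) (paddedValue (map proj₁ ds)) (paddedValue (map proj₂ ds)))))
  where shuffle : ∀ d e p q → d + (e + 2 * (p + q)) ≡ d + 2 * p + (e + 2 * q)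
        shuffle = solve-∀

bd-paddedValue : ∀ {A} (f : ∣ A ∣ → List (Digit × Digit)) (side : Digit × Digit → Digit) → PolyBounded A (λ x → length (f x)) →
  ∃[ p ] (∀ x → paddedValue (map side (f x)) ≤ 2 ^ p x) × PolyBounded A p
bd-paddedValue f side b = (λ x → suc (length (f x))) ,
  (λ x → ≤-trans (≤-trans (m≤n+m _ 2) (paddedValue≤ (map side (f x)))) (≤-reflexive (cong (λ l → 2 ^ suc l) (length-map side (f x))))) ,
  bd-+ (bd-const 1) b

2^+2^≤ : ∀ {m n} p q → m ≤ 2 ^ p → n ≤ 2 ^ q → m + n ≤ 2 ^ suc (p + q)
2^+2^≤ p q m≤ n≤ = +-mono-≤ (≤-trans m≤ (^-monoʳ-≤ 2 (m≤m+n p q))) (≤-trans n≤ (≤-trans (^-monoʳ-≤ 2 (m≤n+m q p)) (m≤m+n _ 0)))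

2^*2^≤ : ∀ {m n} p q → m ≤ 2 ^ p → n ≤ 2 ^ q → m * n ≤ 2 ^ (p + q)
2^*2^≤ p q m≤ n≤ = ≤-trans (*-mono-≤ m≤ n≤) (≤-reflexive (sym (^-distribˡ-+-* 2 p q)))

sumDigits′ : PT (𝕃 (𝔻 ⊗ 𝔻)) ℕ̂ sumDigits
sumDigits′ = rec′ {E = 𝟙} {X = 𝔻 ⊗ 𝔻} (λ _ → sumDigits) (λ _ → refl) (λ _ _ _ → refl) (const′ 0)
    (times′ (suc′ id′) (fst ∘′ fst ∘′ snd) (times′ (suc′ id′) (snd ∘′ fst ∘′ snd) (double′ (snd ∘′ snd ∘′ snd))))
    (let len = bd-length {X = 𝔻 ⊗ 𝔻} {f = proj₂} (bd-out (snd {𝟙}))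
         (p , p≤ , bp) = bd-paddedValue proj₂ proj₁ len
         (q , q≤ , bq) = bd-paddedValue proj₂ proj₂ len in
     bd-ℕ (λ x → ≤-trans (≤-reflexive (sumDigits-value (proj₂ x))) (2^+2^≤ (p x) (q x) (p≤ x) (q≤ x)))
       (bd-+ (bd-const 1) (bd-+ bp bq)))
  ∘′ (const′ tt & id′)

infixl 6 _+′_
infixl 7 _*′_
infix 4 _≡ᵇ′_

_+′_ : ∀ {Γ f g} → PT Γ ℕ̂ f → PT Γ ℕ̂ g → PT Γ ℕ̂ (λ γ → f γ + g γ)
_+′_ {f = f} {g} p q = PT-cong (sumDigits′ ∘′ zipDigits′ ∘′ (p & q)) λ γ →
  trans (sumDigits-value (zipDigits (digits (f γ)) (digits (g γ))))
    (cong₂ _+_ (trans (zipDigits-value₁ (digits (f γ)) (digits (g γ))) (value-digits (f γ)))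
               (trans (zipDigits-value₂ (digits (f γ)) (digits (g γ))) (value-digits (g γ))))

-- The integer a - b is represented by (a ∸ b , b ∸ a).
incℤ decℤ : ℕ × ℕ → ℕ × ℕ
incℤ   (p , q) = cond (q ≡ᵇ 0) (suc p , 0) (p , pred q)
decℤ (p , q) = let (q′ , p′) = incℤ (q , p) in p′ , q′

diff : ℕ → ℕ → ℕ × ℕ
diff a b = a ∸ b , b ∸ a

incℤ-diff : ∀ a b → incℤ (diff a b) ≡ diff (suc a) b
incℤ-diff zero    zero    = refl
incℤ-diff zero    (suc b) = cong (_, b) (sym (0∸n≡0 b))
incℤ-diff (suc a) zero    = refl
incℤ-diff (suc a) (suc b) = incℤ-diff a b

decℤ-diff : ∀ a b → decℤ (diff a b) ≡ diff a (suc b)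
decℤ-diff a b = cong (λ (q , p) → p , q) (incℤ-diff b a)

-- Horner's rule for the signed difference. The truncated difference of the higher digits would not
-- be enough: once it is 0, it no longer tells how much the lower digits have to make up for.
diffDigits : List (Digit × Digit) → ℕ × ℕ
diffDigits []             = 0 , 0
diffDigits ((d , e) ∷ ds) = let (p , q) = diffDigits ds in times decℤ e (times incℤ d (2 * p , 2 * q))

diffDigits-value : ∀ ds → diffDigits ds ≡ diff (paddedValue (map proj₁ ds)) (paddedValue (map proj₂ ds))
diffDigits-value []             = refl
diffDigits-value ((d , e) ∷ ds) rewrite diffDigits-value ds =
  trans (cong (λ pq → times decℤ e (times incℤ d pq)) (cong₂ _,_ (*-distribˡ-∸ 2 P Q) (*-distribˡ-∸ 2 Q P)))
  (trans (cong (times decℤ e) (times-inv (λ n → diff n (2 * Q)) incℤ (λ n → incℤ-diff n _) d (2 * P)))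
    (times-inv (λ n → diff (digitValue d + 2 * P) n) decℤ (decℤ-diff _) e (2 * Q)))
  where P = paddedValue (map proj₁ ds)
        Q = paddedValue (map proj₂ ds)

isZero′ : PT ℕ̂ 𝔹 (λ n → n ≡ᵇ 0)
isZero′ = PT-cong {f = λ n → isNil (digits n)}
  (PT-cong {g = isNil} (case′ {E = 𝟙} {X = 𝔹} (const′ true) (const′ false) ∘′ (const′ tt & id′)) (λ { [] → refl ; (_ ∷ _) → refl }) ∘′ digits′)
  λ n → trans (h (digits n)) (cong (_≡ᵇ 0) (value-digits n))
  where
  isNil : List Bool → Bool
  isNil []      = true
  isNil (_ ∷ _) = false
  h : ∀ bs → isNil bs ≡ (value bs ≡ᵇ 0)
  h []          = refl
  h (true ∷ _)  = refl
  h (false ∷ _) = refl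

incℤ′ decℤ′ : PT (ℕ̂ ⊗ ℕ̂) (ℕ̂ ⊗ ℕ̂) _
incℤ′ = PT-cong {g = incℤ} (if′ (isZero′ ∘′ snd) (suc′ fst & const′ 0) (fst & pred′ snd)) λ _ → refl
decℤ′ = PT-cong {g = decℤ} ((snd & fst) ∘′ incℤ′ ∘′ (snd & fst)) λ _ → refl

diffDigits′ : PT (𝕃 (𝔻 ⊗ 𝔻)) (ℕ̂ ⊗ ℕ̂) diffDigits
diffDigits′ = rec′ {E = 𝟙} {X = 𝔻 ⊗ 𝔻} (λ _ → diffDigits) (λ _ → refl) (λ _ _ _ → refl) (const′ (0 , 0))
    (times′ decℤ′ (snd ∘′ fst ∘′ snd) (times′ incℤ′ (fst ∘′ fst ∘′ snd) (double′ (fst ∘′ acc) & double′ (snd ∘′ acc))))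
    (let len = bd-length {X = 𝔻 ⊗ 𝔻} {f = proj₂} (bd-out (snd {𝟙}))
         (p , p≤ , bp) = bd-paddedValue proj₂ proj₁ len
         (q , q≤ , bq) = bd-paddedValue proj₂ proj₂ len in
     bd-+ (bd-const 1) (bd-+
       (bd-ℕ (λ x → ≤-trans (≤-trans (≤-reflexive (cong proj₁ (diffDigits-value (proj₂ x)))) (m∸n≤m _ (paddedValue (map proj₂ (proj₂ x))))) (p≤ x)) bp)
       (bd-ℕ (λ x → ≤-trans (≤-trans (≤-reflexive (cong proj₂ (diffDigits-value (proj₂ x)))) (m∸n≤m _ (paddedValue (map proj₁ (proj₂ x))))) (q≤ x)) bq)))
  ∘′ (const′ tt & id′)
  where acc = π-acc {𝟙} {𝔻 ⊗ 𝔻} {𝕃 (𝔻 ⊗ 𝔻)} {ℕ̂ ⊗ ℕ̂}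

module _ {Γ : Data} {f g : ∣ Γ ∣ → ℕ} (p : PT Γ ℕ̂ f) (q : PT Γ ℕ̂ g) where

  infixl 6 _∸′_
  infix 4 _≤ᵇ′_

  _∸′_ : PT Γ ℕ̂ (λ γ → f γ ∸ g γ)
  _∸′_ = PT-cong (fst ∘′ diffDigits′ ∘′ zipDigits′ ∘′ (p & q)) λ γ →
    trans (cong proj₁ (diffDigits-value (zipDigits (digits (f γ)) (digits (g γ)))))
      (cong₂ _∸_ (trans (zipDigits-value₁ (digits (f γ)) (digits (g γ))) (value-digits (f γ)))
                 (trans (zipDigits-value₂ (digits (f γ)) (digits (g γ))) (value-digits (g γ))))

  _≤ᵇ′_ : PT Γ 𝔹 (λ γ → f γ ≤ᵇ g γ)
  _≤ᵇ′_ = PT-cong (isZero′ ∘′ _∸′_) λ γ → h (f γ) (g γ)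
    where
    h : ∀ m n → (m ∸ n ≡ᵇ 0) ≡ (m ≤ᵇ n)
    h zero          zero    = refl
    h zero          (suc n) = refl
    h (suc m)       zero    = refl
    h (suc zero)    (suc n) = h zero n
    h (suc (suc m)) (suc n) = h (suc m) n

_≡ᵇ′_ : ∀ {Γ f g} → PT Γ ℕ̂ f → PT Γ ℕ̂ g → PT Γ 𝔹 (λ γ → f γ ≡ᵇ g γ)
_≡ᵇ′_ {f = f} {g} p q = PT-cong ((p ≤ᵇ′ q) ∧′ (q ≤ᵇ′ p)) λ γ → h (f γ) (g γ)
  where
  h : ∀ m n → ((m ≤ᵇ n) ∧ (n ≤ᵇ m)) ≡ (m ≡ᵇ n)
  h zero          zero          = refl
  h zero          (suc n)       = refl
  h (suc m)       zero          = refl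
  h (suc zero)    (suc zero)    = refl
  h (suc zero)    (suc (suc n)) = refl
  h (suc (suc m)) (suc zero)    = refl
  h (suc (suc m)) (suc (suc n)) = h (suc m) (suc n)

_⊔′_ : ∀ {Γ f g} → PT Γ ℕ̂ f → PT Γ ℕ̂ g → PT Γ ℕ̂ (λ γ → f γ ⊔ g γ)
_⊔′_ {f = f} {g} p q = PT-cong (p +′ (q ∸′ p)) λ γ → sym (m⊔n≡m+[n∸m] (f γ) (g γ))
  where
  m⊔n≡m+[n∸m] : ∀ m n → m ⊔ n ≡ m + (n ∸ m)
  m⊔n≡m+[n∸m] zero    n       = refl
  m⊔n≡m+[n∸m] (suc m) zero    = sym (+-identityʳ (suc m))
  m⊔n≡m+[n∸m] (suc m) (suc n) = cong suc (m⊔n≡m+[n∸m] m n)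

mulDigits : ℕ → List Bool → ℕ
mulDigits m []       = 0
mulDigits m (b ∷ bs) = m + cond b (2 * mulDigits m bs) (m + 2 * mulDigits m bs)

mulDigits-value : ∀ m bs → mulDigits m bs ≡ m * value bs
mulDigits-value m []           = sym (*-zeroʳ m)
mulDigits-value m (true ∷ bs)  = trans (cong (λ v → m + 2 * v) (mulDigits-value m bs)) (shuffle m (value bs))
  where shuffle : ∀ m v → m + 2 * (m * v) ≡ m * (1 + 2 * v)
        shuffle = solve-∀
mulDigits-value m (false ∷ bs) = trans (cong (λ v → m + (m + 2 * v)) (mulDigits-value m bs)) (shuffle m (value bs))
  where shuffle : ∀ m v → m + (m + 2 * (m * v)) ≡ m * (2 + 2 * v)
        shuffle = solve-∀

_*′_ : ∀ {Γ f g} → PT Γ ℕ̂ f → PT Γ ℕ̂ g → PT Γ ℕ̂ (λ γ → f γ * g γ)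
_*′_ {f = f} {g} p q = PT-cong (mulDigits′ ∘′ (p & (digits′ ∘′ q))) λ γ →
    trans (mulDigits-value (f γ) (digits (g γ))) (cong (f γ *_) (value-digits (g γ)))
  where
  acc = π-acc {ℕ̂} {𝔹} {𝕃 𝔹} {ℕ̂}
  mulDigits′ : PT (ℕ̂ ⊗ 𝕃 𝔹) ℕ̂ (λ (m , bs) → mulDigits m bs)
  mulDigits′ = rec′ mulDigits (λ _ → refl) (λ _ _ _ → refl) (const′ 0)
    (fst +′ if′ (fst ∘′ snd) (double′ acc) (fst +′ double′ acc))
    (bd-ℕ (λ (m , bs) → ≤-trans (≤-reflexive (mulDigits-value m bs))
        (2^*2^≤ (sz ℕ̂ m) (suc (length bs)) (n≤2^sz m) (≤-trans (m≤n+m _ 2) (value≤ bs))))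
      (bd-+ (bd-out (fst {ℕ̂} {𝕃 𝔹})) (bd-+ (bd-const 1) (bd-length {X = 𝔹} {f = proj₂} (bd-out (snd {ℕ̂}))))))

sum≤ : ∀ {A : Set} (e : A) (ns : List ℕ) → sum ns ≤ 2 ^ sumOver (λ (_ , n) → suc (sz ℕ̂ n)) e ns
sum≤ e []       = z≤n
sum≤ e (n ∷ ns) = 2^+2^≤ (sz ℕ̂ n) (sumOver _ e ns) (n≤2^sz n) (sum≤ e ns)

product≤ : ∀ {A : Set} (e : A) (ns : List ℕ) → product ns ≤ 2 ^ sumOver (λ (_ , n) → sz ℕ̂ n) e ns
product≤ e []       = ≤-refl
product≤ e (n ∷ ns) = 2^*2^≤ (sz ℕ̂ n) (sumOver _ e ns) (n≤2^sz n) (product≤ e ns)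

sum′ : PT (𝕃 ℕ̂) ℕ̂ sum
sum′ = rec′ {E = 𝟙} {X = ℕ̂} (λ _ → sum) (λ _ → refl) (λ _ _ _ → refl) (const′ 0) ((fst ∘′ snd) +′ (snd ∘′ snd ∘′ snd))
    (bd-ℕ (λ (e , ns) → sum≤ e ns) (bd-sumOver {E = 𝟙} {X = ℕ̂} (bd-+ (bd-const 1) (bd-out (snd {𝟙})))))
  ∘′ (const′ tt & id′)

product′ : PT (𝕃 ℕ̂) ℕ̂ product
product′ = rec′ {E = 𝟙} {X = ℕ̂} (λ _ → product) (λ _ → refl) (λ _ _ _ → refl) (const′ 1) ((fst ∘′ snd) *′ (snd ∘′ snd ∘′ snd))
    (bd-ℕ (λ (e , ns) → product≤ e ns) (bd-sumOver {E = 𝟙} {X = ℕ̂} (bd-out (snd {𝟙}))))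
  ∘′ (const′ tt & id′)

n≤2^n : ∀ n → n ≤ 2 ^ n
n≤2^n zero    = z≤n
n≤2^n (suc n) = +-mono-≤ (m^n>0 2 n) (≤-trans (n≤2^n n) (m≤m+n _ 0))

length′ : ∀ {X} → PT (𝕃 X) ℕ̂ length
length′ {X} = rec′ {E = 𝟙} {X = X} (λ _ → length) (λ _ → refl) (λ _ _ _ → refl) (const′ 0) (suc′ (snd ∘′ snd ∘′ snd))
    (bd-ℕ (λ (_ , xs) → n≤2^n (length xs)) (bd-length {X = X} {f = proj₂} (bd-out (snd {𝟙}))))
  ∘′ (const′ tt & id′)

-- The algorithm

module _ {A : Set} where

  lookupKey : A → ℕ → List (ℕ × A) → A
  lookupKey d k []             = d
  lookupKey d k ((l , a) ∷ xs) = cond (k ≡ᵇ l) a (lookupKey d k xs)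

  index : List A → List (ℕ × A)
  index []       = []
  index (a ∷ as) = (0 , a) ∷ map (λ (k , b) → suc k , b) (index as)

  -- `shiftTo` cuts a cyclic list open just before the first element satisfying `p`; if there is
  -- none, the list stays as it is.
  takeUntil dropUntil shiftTo : (A → Bool) → List A → List A
  takeUntil p []       = []
  takeUntil p (x ∷ xs) = cond (p x) [] (x ∷ takeUntil p xs)
  dropUntil p []       = []
  dropUntil p (x ∷ xs) = cond (p x) (x ∷ xs) (dropUntil p xs)
  shiftTo p xs = dropUntil p xs ++ takeUntil p xs

sz-cond : ∀ A c x y → sz A (cond c x y) ≤ sz A x + sz A y
sz-cond A true  x y = m≤m+n _ _
sz-cond A false x y = m≤n+m _ (sz A x)

sz-All : ∀ X {m} {xs} → All (λ x → sz X x ≤ m) xs → sz (𝕃 X) xs ≤ 1 + length xs * suc m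
sz-All X []        = ≤-refl
sz-All X {m} (p ∷ ps) = s≤s (≤-trans (+-mono-≤ p (sz-All X ps)) (≤-reflexive (+-suc m _)))

bd-All : ∀ {A X} (f : ∣ A ∣ → List ∣ X ∣) (m : ∣ A ∣ → ℕ) → (∀ a → All (λ x → sz X x ≤ m a) (f a)) →
  PolyBounded A (λ a → length (f a)) → PolyBounded A m → PolyBounded A (λ a → sz (𝕃 X) (f a))
bd-All {X = X} f m h bl bm = bd-≤ (λ a → sz-All X (h a)) (bd-+ (bd-const 1) (bd-* bl (bd-+ (bd-const 1) bm)))

lookup′ : ∀ {Γ A k xs} (d : ∣ A ∣) → PT Γ ℕ̂ k → PT Γ (𝕃 (ℕ̂ ⊗ A)) xs → PT Γ A (λ γ → lookupKey d (k γ) (xs γ))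
lookup′ {A = A} d pk pxs = additive {E = ℕ̂} {X = ℕ̂ ⊗ A} (lookupKey d) (λ _ → refl) (λ _ _ _ → refl)
    (const′ d) (if′ (fst ≡ᵇ′ (fst ∘′ fst ∘′ snd)) (snd ∘′ fst ∘′ snd) π-acc) (bd-out (snd ∘′ snd {ℕ̂} {ℕ̂ ⊗ A}))
    (λ k (l , a) _ b → sz-cond A (k ≡ᵇ l) a b)
  ∘′ (pk & pxs)

index-keys : ∀ {X : Data} (as : List ∣ X ∣) → All (λ (k , a) → k ≤ length as × sz X a ≤ sz (𝕃 X) as) (index as)
index-keys []           = []
index-keys {X} (a ∷ as) = (z≤n , ≤-trans (m≤m+n _ _) (n≤1+n _)) ∷
  map⁺ (All.map (λ (k≤ , b≤) → s≤s k≤ , ≤-trans b≤ (sz-∷ X a as)) (index-keys as))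

length-index : ∀ {A : Set} (as : List A) → length (index as) ≡ length as
length-index []       = refl
length-index (a ∷ as) = cong suc (trans (length-map _ (index as)) (length-index as))

index′ : ∀ {X} → PT (𝕃 X) (𝕃 (ℕ̂ ⊗ X)) index
index′ {X} = rec′ {E = 𝟙} {X = X} (λ _ → index) (λ _ → refl) (λ _ _ _ → refl) []′
    (cons′ (const′ 0 & (fst ∘′ snd)) (map′ (suc′ (fst ∘′ snd) & (snd ∘′ snd)) (snd ∘′ snd ∘′ snd)))
    (bd-All {X = ℕ̂ ⊗ X} (λ (_ , as) → index as) (λ (_ , as) → 1 + ((5 + 4 * length as) + sz (𝕃 X) as))
      (λ (_ , as) → All.map (λ (k≤ , a≤) → s≤s (+-mono-≤ (sz-ℕ≤ (length as) (≤-trans k≤ (n≤2^n _))) a≤)) (index-keys as))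
      (bd-≤ (λ (_ , as) → ≤-reflexive (length-index as)) len)
      (bd-+ (bd-const 1) (bd-+ (bd-+ (bd-const 5) (bd-* (bd-const 4) len)) (bd-out (snd {𝟙})))))
  ∘′ (const′ tt & id′)
  where len = bd-length {X = X} {f = proj₂} (bd-out (snd {𝟙}))

module _ {Γ X : Data} {P : ∣ Γ ⊗ X ∣ → Bool} {xs : ∣ Γ ∣ → List ∣ X ∣} (p : PT (Γ ⊗ X) 𝔹 P) (q : PT Γ (𝕃 X) xs) where

  takeUntil′ : PT Γ (𝕃 X) (λ γ → takeUntil (λ x → P (γ , x)) (xs γ))
  takeUntil′ = additive (λ γ → takeUntil (λ x → P (γ , x))) (λ _ → refl) (λ _ _ _ → refl) []′
      (if′ (p ∘′ π-elem) []′ (cons′ (fst ∘′ snd) π-acc)) (bd-+ (bd-const 2) (bd-out (snd {Γ} {X})))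
      (λ γ x _ b → sz-cond (𝕃 X) (P (γ , x)) [] (x ∷ b))
    ∘′ (id′ & q)

  dropUntil′ : PT Γ (𝕃 X) (λ γ → dropUntil (λ x → P (γ , x)) (xs γ))
  dropUntil′ = rec′ (λ γ → dropUntil (λ x → P (γ , x))) (λ _ → refl) (λ _ _ _ → refl) []′
      (if′ (p ∘′ π-elem) (cons′ (fst ∘′ snd) (fst ∘′ snd ∘′ snd)) π-acc)
      (bd-≤ (λ (γ , xs) → le (λ x → P (γ , x)) xs) (bd-out (snd {Γ} {𝕃 X})))
    ∘′ (id′ & q)
    where
    le : ∀ P xs → sz (𝕃 X) (dropUntil P xs) ≤ sz (𝕃 X) xs
    le P []       = ≤-refl
    le P (x ∷ xs) with P x
    ... | true  = ≤-refl
    ... | false = ≤-trans (le P xs) (sz-∷ X x xs)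

  shiftTo′ : PT Γ (𝕃 X) (λ γ → shiftTo (λ x → P (γ , x)) (xs γ))
  shiftTo′ = dropUntil′ ++′ takeUntil′

-- Does the half-edge point away from its vertex, and what are its target and its face?
HE : Set
HE = Bool × ℕ × ℕ

ℍ : Data
ℍ = 𝔹 ⊗ ℕ̂ ⊗ ℕ̂

isOut : HE → Bool
isOut = proj₁

tgt fc : HE → ℕ
tgt d = proj₁ (proj₂ d)
fc d  = proj₂ (proj₂ d)

isOut′ : ∀ {Γ d} → PT Γ ℍ d → PT Γ 𝔹 (λ γ → isOut (d γ))
isOut′ p = fst ∘′ p
tgt′ fc′ : ∀ {Γ d} → PT Γ ℍ d → PT Γ ℕ̂ _
tgt′ p = PT-cong {g = tgt} (fst ∘′ snd) (λ _ → refl) ∘′ p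
fc′ p = PT-cong {g = fc} (snd ∘′ snd) (λ _ → refl) ∘′ p

-- The outer face, and for every box its width and height, scaled to
-- integers, and its rotation.
Env : Data
Env = ℕ̂ ⊗ 𝕃 (ℕ̂ ⊗ ((ℕ̂ ⊗ ℕ̂) ⊗ 𝕃 ℍ))

outerOf : ∣ Env ∣ → ℕ
outerOf = proj₁

verts : ∣ Env ∣ → List ℕ
verts e = map proj₁ (proj₂ e)

box : ∣ Env ∣ → ℕ → (ℕ × ℕ) × List HE
box e i = lookupKey ((0 , 0) , []) i (proj₂ e)

W H : ∣ Env ∣ → ℕ → ℕ
W e i = proj₁ (proj₁ (box e i))
H e i = proj₂ (proj₁ (box e i))

rot : ∣ Env ∣ → ℕ → List HE
rot e i = proj₂ (box e i)

verts′ : ∀ {Γ e} → PT Γ Env e → PT Γ (𝕃 ℕ̂) (λ γ → verts (e γ))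
verts′ p = map′ (fst ∘′ snd) (snd ∘′ p)

module _ {Γ : Data} {e : ∣ Γ ∣ → ∣ Env ∣} {i : ∣ Γ ∣ → ℕ} (pe : PT Γ Env e) (pi : PT Γ ℕ̂ i) where

  box′ : PT Γ ((ℕ̂ ⊗ ℕ̂) ⊗ 𝕃 ℍ) (λ γ → box (e γ) (i γ))
  box′ = lookup′ ((0 , 0) , []) pi (snd ∘′ pe)

  W′ : PT Γ ℕ̂ (λ γ → W (e γ) (i γ))
  W′ = fst ∘′ fst ∘′ box′

  H′ : PT Γ ℕ̂ (λ γ → H (e γ) (i γ))
  H′ = snd ∘′ fst ∘′ box′

  rot′ : PT Γ (𝕃 ℍ) (λ γ → rot (e γ) (i γ))
  rot′ = snd ∘′ box′

isSink : ∣ Env ∣ → ℕ → Bool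
isSink e i = all (λ d → not (isOut d)) (rot e i)

firstOut : ℕ → List HE → ℕ
firstOut i []       = i
firstOut i (d ∷ ds) = cond (isOut d) (tgt d) (firstOut i ds)

parent : ∣ Env ∣ → ℕ → ℕ
parent e i = firstOut i (rot e i)

arc : ∣ Env ∣ → ℕ → ℕ → Bool
arc e i j = any (λ d → isOut d ∧ (tgt d ≡ᵇ j)) (rot e i)

push : ∣ Env ∣ → List ℕ → List ℕ
push e []      = []
push e (h ∷ q) = cond (isSink e h) (h ∷ q) (parent e h ∷ h ∷ q)

-- Only the length of the list matters. It is a clock, and one tick per vertex is enough to reach
-- the sink, where `push` stops extending the path.
climb : ∣ Env ∣ × ℕ → List ℕ → List ℕ
climb (e , i) []      = i ∷ []
climb (e , i) (_ ∷ c) = push e (climb (e , i) c)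

-- The path from the sink to i that follows first outgoing arcs backwards.
path : ∣ Env ∣ → ℕ → List ℕ
path e i = climb (e , i) (verts e)

-- The depth of the bottom side of i below the top side of the sink; box i
-- is placed at height - S e i.
S : ∣ Env ∣ → ℕ → ℕ
S e i = sum (map (H e) (path e i))

firstOut′ : PT (ℕ̂ ⊗ 𝕃 ℍ) ℕ̂ (λ (i , ds) → firstOut i ds)
firstOut′ = additive firstOut (λ _ → refl) (λ _ _ _ → refl) id′
  (if′ (isOut′ (fst ∘′ snd)) (tgt′ (fst ∘′ snd)) π-acc) (bd-out (tgt′ (snd {ℕ̂} {ℍ})))
  (λ i d _ b → sz-cond ℕ̂ (isOut d) (tgt d) b)

-- A vertex on a path is either its starting point or written down in some rotation. So the entries
-- of a path are no larger than the input, which bounds the result of `climb`.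
sz-firstOut : ∀ i ds m → sz ℕ̂ i ≤ m → sz (𝕃 ℍ) ds ≤ m → sz ℕ̂ (firstOut i ds) ≤ m
sz-firstOut i []       m i≤ ds≤ = i≤
sz-firstOut i ((true , t , f) ∷ ds) m i≤ ds≤ = ≤-trans (≤-trans (m≤m+n (sz ℕ̂ t) _) (≤-trans (n≤1+n _) (≤-trans (m≤n+m _ 4)
   (≤-trans (m≤m+n _ (sz (𝕃 ℍ) ds)) (n≤1+n _))))) ds≤
sz-firstOut i ((false , d) ∷ ds) m i≤ ds≤ = sz-firstOut i ds m i≤ (≤-trans (sz-∷ ℍ (false , d) ds) ds≤)

sz-rot : ∀ e i → sz (𝕃 ℍ) (rot e i) ≤ sz Env e
sz-rot (o , bs) i = ≤-trans (le bs) (m≤n+m _ (suc (sz ℕ̂ o)))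
  where
  Box : Data
  Box = ℕ̂ ⊗ ((ℕ̂ ⊗ ℕ̂) ⊗ 𝕃 ℍ)
  le : ∀ bs → sz (𝕃 ℍ) (proj₂ (lookupKey ((0 , 0) , []) i bs)) ≤ sz (𝕃 Box) bs
  le []             = ≤-refl
  le ((k , b) ∷ bs) with i ≡ᵇ k
  ... | false = ≤-trans (le bs) (sz-∷ Box (k , b) bs)
  ... | true  = ≤-trans (m≤n+m (sz (𝕃 ℍ) (proj₂ b)) (suc (suc (suc (sz ℕ̂ k + sz (ℕ̂ ⊗ ℕ̂) (proj₁ b))))))
     (≤-trans (≤-reflexive (shuffle (sz ℕ̂ k) (sz (ℕ̂ ⊗ ℕ̂) (proj₁ b)) (sz (𝕃 ℍ) (proj₂ b)))) (+-monoʳ-≤ 1 (m≤m+n _ (sz (𝕃 Box) bs))))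
     where shuffle : ∀ k w r → 3 + (k + w) + r ≡ 1 + (1 + (k + (1 + (w + r))))
           shuffle = solve-∀

module _ {Γ : Data} {e : ∣ Γ ∣ → ∣ Env ∣} {i : ∣ Γ ∣ → ℕ} (pe : PT Γ Env e) (pi : PT Γ ℕ̂ i) where

  isSink′ : PT Γ 𝔹 (λ γ → isSink (e γ) (i γ))
  isSink′ = all′ (not′ (isOut′ snd)) (rot′ pe pi)

  parent′ : PT Γ ℕ̂ (λ γ → parent (e γ) (i γ))
  parent′ = firstOut′ ∘′ (pi & rot′ pe pi)

  arc′ : ∀ {j} → PT Γ ℕ̂ j → PT Γ 𝔹 (λ γ → arc (e γ) (i γ) (j γ))
  arc′ pj = any′ (isOut′ snd ∧′ (tgt′ snd ≡ᵇ′ (pj ∘′ fst))) (rot′ pe pi)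

push′ : PT (Env ⊗ 𝕃 ℕ̂) (𝕃 ℕ̂) (λ (e , q) → push e q)
push′ = PT-cong {g = λ (e , q) → push e q} (case′ {E = Env} {X = ℕ̂} []′
    (if′ (isSink′ fst (fst ∘′ snd)) (cons′ (fst ∘′ snd) (snd ∘′ snd))
      (cons′ (parent′ fst (fst ∘′ snd)) (cons′ (fst ∘′ snd) (snd ∘′ snd)))))
  λ { (e , []) → refl ; (e , h ∷ q) → refl }

climb′ : PT ((Env ⊗ ℕ̂) ⊗ 𝕃 ℕ̂) (𝕃 ℕ̂) (λ (ei , c) → climb ei c)
climb′ = rec′ climb (λ _ → refl) (λ _ _ _ → refl) (cons′ snd []′) (push′ ∘′ ((fst ∘′ fst) & π-acc))
  (bd-All {X = ℕ̂} (λ (ei , c) → climb ei c) (λ (ei , c) → sz (Env ⊗ ℕ̂) ei) (λ (ei , c) → proj₁ (small ei c))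
    (bd-≤ (λ (ei , c) → proj₂ (small ei c)) (bd-+ (bd-const 1) (bd-length {X = ℕ̂} {f = proj₂} (bd-out (snd {Env ⊗ ℕ̂})))))
    (bd-out (fst {Env ⊗ ℕ̂} {𝕃 ℕ̂})))
  where
  small : ∀ ei c → All (λ v → sz ℕ̂ v ≤ sz (Env ⊗ ℕ̂) ei) (climb ei c) × length (climb ei c) ≤ suc (length c)
  small (e , i) [] = (≤-trans (m≤n+m _ (sz Env e)) (n≤1+n _)) ∷ [] , ≤-refl
  small (e , i) (_ ∷ c) with climb (e , i) c | small (e , i) c
  ... | []    | [] , l       = [] , z≤n
  ... | h ∷ q | (p ∷ ps) , l with isSink e h
  ...   | true  = p ∷ ps , ≤-trans l (n≤1+n _)
  ...   | false = sz-firstOut h (rot e h) _ p (≤-trans (sz-rot e h) (≤-trans (m≤m+n _ _) (n≤1+n _))) ∷ p ∷ ps , s≤s l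

module _ {Γ : Data} {e : ∣ Γ ∣ → ∣ Env ∣} {i : ∣ Γ ∣ → ℕ} (pe : PT Γ Env e) (pi : PT Γ ℕ̂ i) where

  path′ : PT Γ (𝕃 ℕ̂) (λ γ → path (e γ) (i γ))
  path′ = climb′ ∘′ ((pe & pi) & verts′ pe)

  S′ : PT Γ ℕ̂ (λ γ → S (e γ) (i γ))
  S′ = sum′ ∘′ map′ (H′ (pe ∘′ fst) snd) path′

-- The in-neighbours of m from left to right; t is the leftmost in-neighbour of the sink.
insOrder : ∣ Env ∣ → ℕ → ℕ → List ℕ
-- The outer shift starts at an outgoing half-edge, after which the incoming ones follow from left
-- to right whatever the inner shift did. The sink has no outgoing half-edge, so there the outer
-- shift changes nothing and the cut at `t` decides.
insOrder e t m = map tgt (filterᵇ (λ d → not (isOut d)) (shiftTo isOut (shiftTo (λ d → tgt d ≡ᵇ t) (rot e m))))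

first : ℕ → ℕ → List ℕ → Bool
first a b []       = false
first a b (x ∷ xs) = cond (x ≡ᵇ a) true (cond (x ≡ᵇ b) false (first a b xs))

siblings : ∣ Env ∣ → ℕ → ℕ → ℕ → Bool
siblings e t a b = not (isSink e a) ∧ not (isSink e b) ∧ (parent e a ≡ᵇ parent e b) ∧
                   not (a ≡ᵇ b) ∧ first a b (insOrder e t (parent e a))

before : ∣ Env ∣ → ℕ → ℕ → ℕ → Bool
before e t i j = any (λ a → any (λ b → siblings e t a b) (path e j)) (path e i)

-- Box `i` occupies the depths from `S e i - H e i` to `S e i`. The first two tests ask whether the
-- closed, respectively the open, intervals of depths intersect. Nonadjacent boxes have to be kept
-- apart even if only the closed intervals intersect, since otherwise they would have a horizontal
-- contact that is no edge.
meets strictlyMeets separated : ∣ Env ∣ → ℕ → ℕ → Bool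
meets e i j         = (S e j ≤ᵇ S e i + H e j) ∧ (S e i ≤ᵇ S e j + H e i)
strictlyMeets e i j = (suc (S e j) ≤ᵇ S e i + H e j) ∧ (suc (S e i) ≤ᵇ S e j + H e i)
separated e i j     = not (i ≡ᵇ j) ∧ not (arc e i j) ∧ not (arc e j i) ∧ meets e i j

-- ((i , a) , (j , b)) stands for x i + a ≤ x j + b.
Constraint : Set
Constraint = (ℕ × ℕ) × (ℕ × ℕ)

ℂ : Data
ℂ = (ℕ̂ ⊗ ℕ̂) ⊗ (ℕ̂ ⊗ ℕ̂)

-- The unit gap makes the contact of an arc have positive length, and it prevents contact along
-- vertical sides when the heights overlap properly. If the heights merely touch, the gap is 0
-- because the boxes may share a corner.
constraintsAt : ∣ Env ∣ → ℕ → ℕ → ℕ → List Constraint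
constraintsAt e t i j =
  cond (arc e i j) (((i , 1) , (j , W e j)) ∷ ((j , 1) , (i , W e i)) ∷ [])
  (cond (separated e i j ∧ before e t i j)
    (((i , W e i + bit (strictlyMeets e i j)) , (j , 0)) ∷ []) [])

constraints : ∣ Env ∣ → ℕ → List Constraint
constraints e t = concatMap (λ i → concatMap (λ j → constraintsAt e t i j) (verts e)) (verts e)

at : List (ℕ × ℕ) → ℕ → ℕ
at x i = lookupKey 0 i x

-- Labels start at 0 and only grow, so the truncated subtraction does no harm: a negative demand
-- loses against the old label anyway.
relax : List (ℕ × ℕ) × ℕ → List Constraint → ℕ
relax (x , j) []                         = at x j
relax (x , j) (((i , a) , (k , b)) ∷ cs) =
  cond (k ≡ᵇ j) (relax (x , j) cs ⊔ (at x i + a ∸ b)) (relax (x , j) cs)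

rounds : List Constraint × List ℕ → List ℕ → List (ℕ × ℕ)
rounds (cs , vs) []      = map (λ j → j , 0) vs
rounds (cs , vs) (_ ∷ c) = map (λ j → j , relax (rounds (cs , vs) c , j) cs) vs

solution : ∣ Env ∣ → ℕ → List (ℕ × ℕ)
solution e t = rounds (constraints e t , verts e) (verts e)

satisfied : List (ℕ × ℕ) → List Constraint → Bool
satisfied x = all (λ c → at x (proj₁ (proj₁ c)) + proj₂ (proj₁ c) ≤ᵇ at x (proj₁ (proj₂ c)) + proj₂ (proj₂ c))

levelled : ∣ Env ∣ → Bool
levelled e = all (λ i → all (λ j → not (arc e i j) ∨ (S e i ≡ᵇ S e j + H e i)) (verts e)) (verts e)

-- May d precede d′ counterclockwise, starting at the right end of the top side?
precedes : List (ℕ × ℕ) → HE → HE → Bool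
precedes x d d′ = cond (isOut d)
  (cond (isOut d′) (suc (at x (tgt d′)) ≤ᵇ at x (tgt d)) true)
  (cond (isOut d′) false (suc (at x (tgt d)) ≤ᵇ at x (tgt d′)))

sorted : List (ℕ × ℕ) → List HE → Bool
sorted x []       = true
sorted x (d ∷ ds) = all (precedes x d) ds ∧ sorted x ds

-- The cuts are tried at every half-edge. The uncut list is tested as well because an empty rotation
-- has no half-edge at which it could be cut.
rotationOK outerOK : ∣ Env ∣ → List (ℕ × ℕ) → ℕ → Bool
rotationOK e x i = sorted x (rot e i) ∨ any (λ d → sorted x (shiftTo (λ d′ → tgt d′ ≡ᵇ tgt d) (rot e i))) (rot e i)
outerOK e x i = not (isSink e i) ∨
  all (λ d → not (all (λ d′ → at x (tgt d′) ≤ᵇ at x (tgt d)) (rot e i)) ∨ (fc d ≡ᵇ outerOf e)) (rot e i)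

verified : ∣ Env ∣ → ℕ → List (ℕ × ℕ) → Bool
verified e t x = satisfied x (constraints e t) ∧ levelled e ∧
                 all (rotationOK e x) (verts e) ∧ all (outerOK e x) (verts e)

successes : ∣ Env ∣ → List ℕ
successes e = filterᵇ (λ t → verified e t (solution e t)) (verts e)

-- Polynomial time for the parts of the algorithm

first′ : PT ((ℕ̂ ⊗ ℕ̂) ⊗ 𝕃 ℕ̂) 𝔹 (λ (ab , xs) → first (proj₁ ab) (proj₂ ab) xs)
first′ = rec′ (λ ab → first (proj₁ ab) (proj₂ ab)) (λ _ → refl) (λ _ _ _ → refl) (const′ false)
  (if′ ((fst ∘′ snd) ≡ᵇ′ (fst ∘′ fst)) (const′ true) (if′ ((fst ∘′ snd) ≡ᵇ′ (snd ∘′ fst)) (const′ false) π-acc))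
  (bd-≤ (λ _ → sz-Bool _) (bd-const 3))

module _ {Γ : Data} {e : ∣ Γ ∣ → ∣ Env ∣} {t : ∣ Γ ∣ → ℕ} (pe : PT Γ Env e) (pt : PT Γ ℕ̂ t) where

  insOrder′ : ∀ {m} → PT Γ ℕ̂ m → PT Γ (𝕃 ℕ̂) (λ γ → insOrder (e γ) (t γ) (m γ))
  insOrder′ pm = map′ (tgt′ snd) (filter′ (not′ (isOut′ snd)) (shiftTo′ (isOut′ snd)
    (shiftTo′ (tgt′ snd ≡ᵇ′ (pt ∘′ fst)) (rot′ pe pm))))

  siblings′ : ∀ {a b} → PT Γ ℕ̂ a → PT Γ ℕ̂ b → PT Γ 𝔹 (λ γ → siblings (e γ) (t γ) (a γ) (b γ))
  siblings′ pa pb = not′ (isSink′ pe pa) ∧′ not′ (isSink′ pe pb) ∧′ (parent′ pe pa ≡ᵇ′ parent′ pe pb) ∧′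
    not′ (pa ≡ᵇ′ pb) ∧′ (first′ ∘′ ((pa & pb) & insOrder′ (parent′ pe pa)))

before′ : ∀ {Γ e t i j} → PT Γ Env e → PT Γ ℕ̂ t → PT Γ ℕ̂ i → PT Γ ℕ̂ j → PT Γ 𝔹 (λ γ → before (e γ) (t γ) (i γ) (j γ))
before′ pe pt pi pj = any′ (any′ (siblings′ (pe ∘′ fst ∘′ fst) (pt ∘′ fst ∘′ fst) (snd ∘′ fst) snd) (path′ (pe ∘′ fst) (pj ∘′ fst))) (path′ pe pi)

module _ {Γ : Data} {e : ∣ Γ ∣ → ∣ Env ∣} {i j : ∣ Γ ∣ → ℕ} (pe : PT Γ Env e) (pi : PT Γ ℕ̂ i) (pj : PT Γ ℕ̂ j) where

  meets′ : PT Γ 𝔹 (λ γ → meets (e γ) (i γ) (j γ))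
  meets′ = (S′ pe pj ≤ᵇ′ (S′ pe pi +′ H′ pe pj)) ∧′ (S′ pe pi ≤ᵇ′ (S′ pe pj +′ H′ pe pi))

  strictlyMeets′ : PT Γ 𝔹 (λ γ → strictlyMeets (e γ) (i γ) (j γ))
  strictlyMeets′ = (suc′ (S′ pe pj) ≤ᵇ′ (S′ pe pi +′ H′ pe pj)) ∧′ (suc′ (S′ pe pi) ≤ᵇ′ (S′ pe pj +′ H′ pe pi))

  separated′ : PT Γ 𝔹 (λ γ → separated (e γ) (i γ) (j γ))
  separated′ = not′ (pi ≡ᵇ′ pj) ∧′ not′ (arc′ pe pi pj) ∧′ not′ (arc′ pe pj pi) ∧′ meets′

  constraintsAt′ : ∀ {t} → PT Γ ℕ̂ t → PT Γ (𝕃 ℂ) (λ γ → constraintsAt (e γ) (t γ) (i γ) (j γ))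
  constraintsAt′ pt = if′ (arc′ pe pi pj)
    (cons′ ((pi & const′ 1) & (pj & W′ pe pj)) (cons′ ((pj & const′ 1) & (pi & W′ pe pi)) []′))
    (if′ (separated′ ∧′ before′ pe pt pi pj)
      (cons′ ((pi & (W′ pe pi +′ if′ strictlyMeets′ (const′ 1) (const′ 0))) & (pj & const′ 0)) []′) []′)

constraints′ : ∀ {Γ e t} → PT Γ Env e → PT Γ ℕ̂ t → PT Γ (𝕃 ℂ) (λ γ → constraints (e γ) (t γ))
constraints′ pe pt = concatMap′ (concatMap′ (constraintsAt′ (pe ∘′ fst ∘′ fst) (snd ∘′ fst) snd (pt ∘′ fst ∘′ fst))
  (verts′ (pe ∘′ fst))) (verts′ pe)

Vector : Data
Vector = 𝕃 (ℕ̂ ⊗ ℕ̂)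

at′ : ∀ {Γ x i} → PT Γ Vector x → PT Γ ℕ̂ i → PT Γ ℕ̂ (λ γ → at (x γ) (i γ))
at′ px pi = lookup′ 0 pi px

demand : List Constraint → ℕ
demand cs = sum (map (λ c → proj₂ (proj₁ c)) cs)

relax≤ : ∀ x j cs m → (∀ i → at x i ≤ m) → relax (x , j) cs ≤ m + demand cs
relax≤ x j []                         m h = ≤-trans (h j) (m≤m+n m 0)
relax≤ x j (((i , a) , (k , b)) ∷ cs) m h with k ≡ᵇ j
... | false = ≤-trans (relax≤ x j cs m h) (+-monoʳ-≤ m (m≤n+m _ a))
... | true  = ⊔-lub (≤-trans (relax≤ x j cs m h) (+-monoʳ-≤ m (m≤n+m _ a)))
  (≤-trans (m∸n≤m _ b) (+-mono-≤ (h i) (m≤m+n a _)))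

at-map≤ : ∀ (f : ℕ → ℕ) vs m → (∀ j → f j ≤ m) → ∀ i → at (map (λ j → j , f j) vs) i ≤ m
at-map≤ f []       m h i = z≤n
at-map≤ f (v ∷ vs) m h i with i ≡ᵇ v
... | true  = h v
... | false = at-map≤ f vs m h i

-- One round raises the largest label by at most the sum of all left-hand offsets. Growth over the
-- rounds is therefore linear, and the labels keep polynomially many digits.
rounds≤ : ∀ cs vs c i → at (rounds (cs , vs) c) i ≤ length c * demand cs
rounds≤ cs vs []      = at-map≤ (λ _ → 0) vs 0 (λ _ → z≤n)
rounds≤ cs vs (_ ∷ c) = at-map≤ _ vs _ λ j → ≤-trans (relax≤ (rounds (cs , vs) c) j cs (length c * demand cs) (rounds≤ cs vs c))
  (≤-reflexive (+-comm (length c * demand cs) _))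

relax′ : PT ((Vector ⊗ ℕ̂) ⊗ 𝕃 ℂ) ℕ̂ (λ (xj , cs) → relax xj cs)
relax′ = rec′ relax (λ _ → refl) (λ _ _ _ → refl) (at′ fst snd)
  (if′ ((fst ∘′ snd ∘′ fst ∘′ snd) ≡ᵇ′ (snd ∘′ fst))
     (acc ⊔′ ((at′ (fst ∘′ fst) (fst ∘′ fst ∘′ fst ∘′ snd) +′ (snd ∘′ fst ∘′ fst ∘′ snd)) ∸′ (snd ∘′ snd ∘′ fst ∘′ snd))) acc)
  (bd-ℕ (λ ((x , j) , cs) → ≤-trans (relax≤ x j cs (2 ^ sz Vector x) (at≤ x)) 
      (2^+2^≤ (sz Vector x) _ ≤-refl (sum≤ tt (map (λ c → proj₂ (proj₁ c)) cs))))
    (bd-+ (bd-const 1) (bd-+ (bd-out (fst ∘′ fst {Vector ⊗ ℕ̂} {𝕃 ℂ})) 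
      (bd-∘ {B = 𝟙 ⊗ 𝕃 ℕ̂} {f = λ (_ , cs) → tt , map (λ c → proj₂ (proj₁ c)) cs}
        (bd-sumOver {E = 𝟙} {X = ℕ̂} (bd-+ (bd-const 1) (bd-out (snd {𝟙}))))
        (bd-out (const′ {B = 𝟙} tt & map′ (snd ∘′ fst ∘′ snd) (snd {Vector ⊗ ℕ̂} {𝕃 ℂ})))))))
  where
  acc = π-acc {Vector ⊗ ℕ̂} {ℂ} {𝕃 ℂ} {ℕ̂}
  at≤ : ∀ x i → at x i ≤ 2 ^ sz Vector x
  at≤ []            i = z≤n
  at≤ ((k , a) ∷ x) i with i ≡ᵇ k
  ... | true  = ≤-trans (n≤2^sz a) (^-monoʳ-≤ 2 (≤-trans (m≤n+m _ (sz ℕ̂ k)) (≤-trans (n≤1+n _) (≤-trans (m≤m+n _ _) (n≤1+n _)))))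
  ... | false = ≤-trans (at≤ x i) (^-monoʳ-≤ 2 (sz-∷ (ℕ̂ ⊗ ℕ̂) (k , a) x))

rounds′ : PT ((𝕃 ℂ ⊗ 𝕃 ℕ̂) ⊗ 𝕃 ℕ̂) Vector (λ (p , c) → rounds p c)
rounds′ = rec′ rounds (λ _ → refl) (λ _ _ _ → refl) (map′ (snd & const′ 0) snd)
  (map′ (snd & (relax′ ∘′ (((π-acc ∘′ fst) & snd) & (fst ∘′ fst ∘′ fst)))) (snd ∘′ fst))
  (bd-All {X = ℕ̂ ⊗ ℕ̂} (λ (p , c) → rounds p c)
    (λ ((cs , vs) , c) → 1 + (sz (𝕃 ℕ̂) vs + (5 + 4 * (length c + sumOver (λ (_ , n) → suc (sz ℕ̂ n)) tt (map (λ c → proj₂ (proj₁ c)) cs)))))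
    (λ ((cs , vs) , c) → entries cs vs c)
    (bd-≤ (λ ((cs , vs) , c) → len cs vs c) (bd-length {X = ℕ̂} {f = λ p → proj₂ (proj₁ p)} (bd-out pvs)))
    (bd-+ (bd-const 1) (bd-+ (bd-out pvs) (bd-+ (bd-const 5) (bd-* (bd-const 4) (bd-+ (bd-length {X = ℕ̂} {f = proj₂} (bd-out (snd {𝕃 ℂ ⊗ 𝕃 ℕ̂})))
      (bd-∘ {B = 𝟙 ⊗ 𝕃 ℕ̂} {f = λ ((cs , _) , _) → tt , map (λ c → proj₂ (proj₁ c)) cs}
        (bd-sumOver {E = 𝟙} {X = ℕ̂} (bd-+ (bd-const 1) (bd-out (snd {𝟙}))))
        (bd-out (const′ {B = 𝟙} tt & map′ (snd ∘′ fst ∘′ snd) (fst ∘′ fst {𝕃 ℂ ⊗ 𝕃 ℕ̂} {𝕃 ℕ̂}))))))))))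
  where
  pvs : PT ((𝕃 ℂ ⊗ 𝕃 ℕ̂) ⊗ 𝕃 ℕ̂) (𝕃 ℕ̂) (λ p → proj₂ (proj₁ p))
  pvs = snd ∘′ fst
  len : ∀ cs vs c → length (rounds (cs , vs) c) ≤ length vs
  len cs vs []      = ≤-reflexive (length-map _ vs)
  len cs vs (_ ∷ c) = ≤-reflexive (length-map _ vs)
  All-vec : ∀ f vs m → (∀ j → sz ℕ̂ (f j) ≤ m) → All (λ p → sz (ℕ̂ ⊗ ℕ̂) p ≤ 1 + (sz (𝕃 ℕ̂) vs + m)) (map (λ j → j , f j) vs)
  All-vec f []       m h = []
  All-vec f (v ∷ vs) m h = s≤s (+-mono-≤ (≤-trans (m≤m+n _ _) (n≤1+n _)) (h v)) ∷
    All.map (λ p → ≤-trans p (s≤s (+-monoˡ-≤ m (sz-∷ ℕ̂ v vs)))) (All-vec f vs m h)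
  entries : ∀ cs vs c → All (λ p → sz (ℕ̂ ⊗ ℕ̂) p ≤ _) (rounds (cs , vs) c)
  entries cs vs [] = All-vec (λ _ → 0) vs _ (λ _ → s≤s z≤n)
  entries cs vs (v ∷ c) = All-vec (λ j → relax (rounds (cs , vs) c , j) cs) vs _ λ j →
    sz-ℕ≤ (length (v ∷ c) + d) (≤-trans (relax≤ (rounds (cs , vs) c) j cs (length c * demand cs) (rounds≤ cs vs c))
      (≤-trans (≤-reflexive (+-comm (length c * demand cs) _))
       (2^*2^≤ (length (v ∷ c)) d (n≤2^n (length (v ∷ c))) (sum≤ tt (map (λ c → proj₂ (proj₁ c)) cs)))))
    where d = sumOver (λ (_ , n) → suc (sz ℕ̂ n)) tt (map (λ c → proj₂ (proj₁ c)) cs)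

solution′ : ∀ {Γ e t} → PT Γ Env e → PT Γ ℕ̂ t → PT Γ Vector (λ γ → solution (e γ) (t γ))
solution′ pe pt = rounds′ ∘′ ((constraints′ pe pt & verts′ pe) & verts′ pe)

satisfied′ : ∀ {Γ x cs} → PT Γ Vector x → PT Γ (𝕃 ℂ) cs → PT Γ 𝔹 (λ γ → satisfied (x γ) (cs γ))
satisfied′ px pcs = all′ ((at′ (px ∘′ fst) (fst ∘′ fst ∘′ snd) +′ (snd ∘′ fst ∘′ snd)) ≤ᵇ′
                          (at′ (px ∘′ fst) (fst ∘′ snd ∘′ snd) +′ (snd ∘′ snd ∘′ snd))) pcs

levelled′ : ∀ {Γ e} → PT Γ Env e → PT Γ 𝔹 (λ γ → levelled (e γ))
levelled′ pe = all′ (all′ (not′ (arc′ pe₂ (snd ∘′ fst) snd) ∨′ (S′ pe₂ (snd ∘′ fst) ≡ᵇ′ (S′ pe₂ snd +′ H′ pe₂ (snd ∘′ fst)))) (verts′ (pe ∘′ fst))) (verts′ pe)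
  where pe₂ = pe ∘′ fst {_} {ℕ̂} ∘′ fst {_} {ℕ̂}

precedes′ : ∀ {Γ x d d′} → PT Γ Vector x → PT Γ ℍ d → PT Γ ℍ d′ → PT Γ 𝔹 (λ γ → precedes (x γ) (d γ) (d′ γ))
precedes′ px pd pd′ = if′ (isOut′ pd)
  (if′ (isOut′ pd′) (suc′ (at′ px (tgt′ pd′)) ≤ᵇ′ at′ px (tgt′ pd)) (const′ true))
  (if′ (isOut′ pd′) (const′ false) (suc′ (at′ px (tgt′ pd)) ≤ᵇ′ at′ px (tgt′ pd′)))

sorted′ : ∀ {Γ x ds} → PT Γ Vector x → PT Γ (𝕃 ℍ) ds → PT Γ 𝔹 (λ γ → sorted (x γ) (ds γ))
sorted′ px pds = rec′ sorted (λ _ → refl) (λ _ _ _ → refl) (const′ true)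
    (all′ (precedes′ (fst ∘′ fst) (fst ∘′ snd ∘′ fst) snd) (fst ∘′ snd ∘′ snd) ∧′ π-acc)
    (bd-≤ (λ _ → sz-Bool _) (bd-const 3))
  ∘′ (px & pds)

module _ {Γ : Data} {e : ∣ Γ ∣ → ∣ Env ∣} {x : ∣ Γ ∣ → List (ℕ × ℕ)} {i : ∣ Γ ∣ → ℕ}
         (pe : PT Γ Env e) (px : PT Γ Vector x) (pi : PT Γ ℕ̂ i) where

  rotationOK′ : PT Γ 𝔹 (λ γ → rotationOK (e γ) (x γ) (i γ))
  rotationOK′ = sorted′ px (rot′ pe pi) ∨′ any′ (sorted′ (px ∘′ fst)
    (shiftTo′ (tgt′ snd ≡ᵇ′ tgt′ (snd ∘′ fst)) (rot′ (pe ∘′ fst) (pi ∘′ fst)))) (rot′ pe pi)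

  outerOK′ : PT Γ 𝔹 (λ γ → outerOK (e γ) (x γ) (i γ))
  outerOK′ = not′ (isSink′ pe pi) ∨′ all′
    (not′ (all′ (at′ (px ∘′ fst ∘′ fst) (tgt′ snd) ≤ᵇ′ at′ (px ∘′ fst ∘′ fst) (tgt′ (snd ∘′ fst))) (rot′ (pe ∘′ fst) (pi ∘′ fst)))
      ∨′ (fc′ snd ≡ᵇ′ (fst ∘′ pe ∘′ fst))) (rot′ pe pi)

verified′ : ∀ {Γ e t x} → PT Γ Env e → PT Γ ℕ̂ t → PT Γ Vector x → PT Γ 𝔹 (λ γ → verified (e γ) (t γ) (x γ))
verified′ pe pt px = satisfied′ px (constraints′ pe pt) ∧′ levelled′ pe ∧′
  all′ (rotationOK′ (pe ∘′ fst) (px ∘′ fst) snd) (verts′ pe) ∧′ all′ (outerOK′ (pe ∘′ fst) (px ∘′ fst) snd) (verts′ pe)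

successes′ : ∀ {Γ e} → PT Γ Env e → PT Γ (𝕃 ℕ̂) (λ γ → successes (e γ))
successes′ pe = filter′ (verified′ (pe ∘′ fst) snd (solution′ (pe ∘′ fst) snd)) (verts′ pe)

-- Scaling to integers and assembling the answer

polynomialTime : (Π : Problem) → let open Problem Π in
  ∀ {B f} → PT (data′ Input encodeInput) B f → (O : ∀ I → Output I) →
  (∀ I → enc B (f I) ≡ encodeOutput (O I)) → (∀ I → Correct I (O I)) → PolynomialTime Π
polynomialTime Π {B} {f} p O eq correct =
  record { extra = 1 ; body = code p } , coeff , expo , λ I →
    let (t , r , t≤) = runs p I nil in
    O I , t , (_ , r , eq I) ,
    ≤-trans (+-mono-≤ t≤ (≤-reflexive (cong size (sym (eq I))))) (bounded I) , correct I
  where open PolyBounded (bd-+ (bd-time p) (bd-out p))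

-- A rational is given by the sign and the absolute value of its numerator and by its denominator.
ℚ̂ : Data
ℚ̂ = (𝔹 ⊗ ℕ̂) ⊗ ℕ̂

𝕄 : Data → Data
𝕄 A = data′ (Maybe ∣ A ∣) λ { nothing → nil ; (just a) → cons nil (enc A a) }

RawBox Raw : Data
RawBox = (ℚ̂ ⊗ ℚ̂) ⊗ 𝕃 ℍ
Raw    = (ℕ̂ ⊗ ℕ̂) ⊗ 𝕃 RawBox

num den : ∣ ℚ̂ ∣ → ℕ
num q = proj₂ (proj₁ q)
den q = proj₂ q

dens wScaled hScaled : ∣ RawBox ∣ → ℕ
dens    ((w , h) , _) = den w * den h
wScaled ((w , h) , _) = num w * den h
hScaled ((w , h) , _) = num h * den w

-- The common denominator.  The factor 1 + n makes room for n strict inequalities.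
unit : List ∣ RawBox ∣ → ℕ
unit bs = suc (length bs) * product (map dens bs)

-- With s = wScaled this is the width of box i times the unit, since the
-- denominators of box i are replaced by s in the product.
scaled : (∣ RawBox ∣ → ℕ) → List ∣ RawBox ∣ → ℕ → ℕ
scaled s bs i = suc (length bs) * product (map (λ (k , b) → cond (k ≡ᵇ i) (s b) (dens b)) (index bs))

environment : ∣ Raw ∣ → ∣ Env ∣
environment ((_ , o) , bs) =
  o , map (λ (i , b) → i , (scaled wScaled bs i , scaled hScaled bs i) , proj₂ b) (index bs)

-- The vertical coordinate is a negated depth. Its sign flag is the test for 0 because 0 is encoded
-- as a nonnegative integer.
coordinates : ℕ → ∣ Env ∣ → ℕ → ℕ → ∣ ℚ̂ ∣ × ∣ ℚ̂ ∣
coordinates m e t i = ((true , at (solution e t) i) , m) , (((S e i ≡ᵇ 0) , S e i) , m)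

outcome : ℕ → ∣ Env ∣ → List ℕ → Maybe (List (∣ ℚ̂ ∣ × ∣ ℚ̂ ∣))
outcome m e []      = nothing
outcome m e (t ∷ _) = just (map (coordinates m e t) (verts e))

answer : ∣ Raw ∣ → Maybe (List (∣ ℚ̂ ∣ × ∣ ℚ̂ ∣))
answer r = outcome (unit (proj₂ r)) (environment r) (successes (environment r))

dens′ wScaled′ hScaled′ : PT RawBox ℕ̂ _
dens′ = PT-cong {g = dens} ((snd ∘′ fst ∘′ fst) *′ (snd ∘′ snd ∘′ fst)) λ _ → refl
wScaled′ = PT-cong {g = wScaled} ((snd ∘′ fst ∘′ fst ∘′ fst) *′ (snd ∘′ snd ∘′ fst)) λ _ → refl
hScaled′ = PT-cong {g = hScaled} ((snd ∘′ fst ∘′ snd ∘′ fst) *′ (snd ∘′ fst ∘′ fst)) λ _ → refl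

unit′ : ∀ {Γ bs} → PT Γ (𝕃 RawBox) bs → PT Γ ℕ̂ (λ γ → unit (bs γ))
unit′ p = suc′ (length′ ∘′ p) *′ (product′ ∘′ map′ (dens′ ∘′ snd) p)

scaled′ : ∀ {Γ s bs i} → PT RawBox ℕ̂ s → PT Γ (𝕃 RawBox) bs → PT Γ ℕ̂ i → PT Γ ℕ̂ (λ γ → scaled s (bs γ) (i γ))
scaled′ ps p pi = suc′ (length′ ∘′ p) *′ (product′ ∘′ map′
  (if′ ((fst ∘′ snd) ≡ᵇ′ (pi ∘′ fst)) (ps ∘′ snd ∘′ snd) (dens′ ∘′ snd ∘′ snd)) (index′ ∘′ p))

environment′ : PT Raw Env environment
environment′ = (snd ∘′ fst) & map′ ((fst ∘′ snd) &
  ((scaled′ wScaled′ (snd ∘′ fst) (fst ∘′ snd) & scaled′ hScaled′ (snd ∘′ fst) (fst ∘′ snd)) & (snd ∘′ snd ∘′ snd))) (index′ ∘′ snd)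

coordinates′ : ∀ {Γ m e t i} → PT Γ ℕ̂ m → PT Γ Env e → PT Γ ℕ̂ t → PT Γ ℕ̂ i →
               PT Γ (ℚ̂ ⊗ ℚ̂) (λ γ → coordinates (m γ) (e γ) (t γ) (i γ))
coordinates′ pm pe pt pi = ((const′ true & at′ (solution′ pe pt) pi) & pm) & (((S′ pe pi ≡ᵇ′ const′ 0) & S′ pe pi) & pm)

just′ : ∀ {Γ A f} → PT Γ A f → PT Γ (𝕄 A) (λ γ → just (f γ))
just′ p = assign-PT (cons nil val) (λ _ _ → refl) (bd-+ (bd-const 2) bd-sz) ∘′ p

answer′ : PT Raw (𝕄 (𝕃 (ℚ̂ ⊗ ℚ̂))) answer
answer′ = PT-cong (case′ {E = Raw} {X = ℕ̂} {B = 𝕄 (𝕃 (ℚ̂ ⊗ ℚ̂))} (const′ nothing)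
    (just′ (map′ (coordinates′ (unit′ (snd ∘′ fst ∘′ fst)) (environment′ ∘′ fst ∘′ fst) (fst ∘′ snd ∘′ fst) snd) (verts′ (environment′ ∘′ fst))))
    ∘′ (id′ & successes′ environment′))
  λ r → eq r (successes (environment r))
  where
  eq : ∀ r ts → case-list {Raw} {ℕ̂} (λ _ → nothing) _ (r , ts) ≡ outcome (unit (proj₂ r)) (environment r) ts
  eq r []      = refl
  eq r (t ∷ _) = refl

-- Paths to the sink

T-∧⁺ : ∀ {a b} → T a → T b → T (a ∧ b)
T-∧⁺ {true} _ q = q

T-∧⁻ : ∀ {a b} → T (a ∧ b) → T a × T b
T-∧⁻ {true} q = tt , q

T-∨⁺ˡ : ∀ {a b} → T a → T (a ∨ b)
T-∨⁺ˡ {true} _ = tt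

T-∨⁺ʳ : ∀ {a b} → T b → T (a ∨ b)
T-∨⁺ʳ {true}  _ = tt
T-∨⁺ʳ {false} q = q

T-∨⁻ : ∀ {a b} → T (a ∨ b) → T a ⊎ T b
T-∨⁻ {true}  _ = inj₁ tt
T-∨⁻ {false} q = inj₂ q

T-not⁺ : ∀ {a} → ¬ T a → T (not a)
T-not⁺ {true}  h = h tt
T-not⁺ {false} _ = tt

T-not⁻ : ∀ {a} → T (not a) → ¬ T a
T-not⁻ {false} _ ()

T-cases : ∀ a → T a ⊎ T (not a)
T-cases true  = inj₁ tt
T-cases false = inj₂ tt

cond-true : ∀ {A : Set} {b} {x y : A} → T b → cond b x y ≡ x
cond-true {b = true} _ = refl

cond-false : ∀ {A : Set} {b} {x y : A} → T (not b) → cond b x y ≡ y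
cond-false {b = false} _ = refl

module _ {A : Set} {p : A → Bool} where

  any⁺ : ∀ {xs x} → x ∈ xs → T (p x) → T (any p xs)
  any⁺ (here refl) px = T-∨⁺ˡ px
  any⁺ (there x∈)  px = T-∨⁺ʳ (any⁺ x∈ px)

  any⁻ : ∀ xs → T (any p xs) → ∃[ x ] x ∈ xs × T (p x)
  any⁻ (x ∷ xs) h with T-∨⁻ {p x} h
  ... | inj₁ px = x , here refl , px
  ... | inj₂ q  = let (y , y∈ , py) = any⁻ xs q in y , there y∈ , py

  all⁺ : ∀ xs → (∀ x → x ∈ xs → T (p x)) → T (all p xs)
  all⁺ []       h = tt
  all⁺ (x ∷ xs) h = T-∧⁺ (h x (here refl)) (all⁺ xs (λ y y∈ → h y (there y∈)))

  all⁻ : ∀ {xs x} → T (all p xs) → x ∈ xs → T (p x)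
  all⁻ h (here refl) = proj₁ (T-∧⁻ h)
  all⁻ {y ∷ _} h (there x∈) = all⁻ (proj₂ (T-∧⁻ {p y} h)) x∈

  ∈-filterᵇ⁺ : ∀ {xs x} → x ∈ xs → T (p x) → x ∈ filterᵇ p xs
  ∈-filterᵇ⁺ = ∈-filter⁺ (λ x → T? (p x))

  ∈-shiftTo⁺ : ∀ {xs x} → x ∈ xs → x ∈ shiftTo p xs
  ∈-shiftTo⁺ {xs} x∈ with side xs x∈
    where
    side : ∀ xs {x} → x ∈ xs → x ∈ dropUntil p xs ⊎ x ∈ takeUntil p xs
    side (y ∷ xs) x∈ with p y
    side (y ∷ xs) x∈          | true  = inj₁ x∈
    side (y ∷ xs) (here refl) | false = inj₂ (here refl)
    side (y ∷ xs) (there x∈)  | false with side xs x∈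
    ... | inj₁ h = inj₁ h
    ... | inj₂ h = inj₂ (there h)
  ... | inj₁ h = ∈-++⁺ˡ h
  ... | inj₂ h = ∈-++⁺ʳ (dropUntil p xs) h

first-total : ∀ {a b xs} → a ∈ xs → a ≢ b → T (first a b xs) ⊎ T (first b a xs)
first-total {a} {b} {x ∷ xs} a∈ a≢b with T-cases (x ≡ᵇ a) | T-cases (x ≡ᵇ b)
... | inj₁ x≡a | _ = inj₁ (subst T (sym (cond-true x≡a)) tt)
... | inj₂ x≢a | inj₁ x≡b = inj₂ (subst T (sym (cond-true x≡b)) tt)
first-total {a} {b} {x ∷ xs} (here refl) a≢b | inj₂ x≢a | inj₂ x≢b = ⊥-elim (T-not⁻ x≢a (≡⇒≡ᵇ x x refl))
first-total {a} {b} {x ∷ xs} (there a∈)  a≢b | inj₂ x≢a | inj₂ x≢b with first-total a∈ a≢b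
... | inj₁ h = inj₁ (subst T (sym (trans (cond-false x≢a) (cond-false x≢b))) h)
... | inj₂ h = inj₂ (subst T (sym (trans (cond-false x≢b) (cond-false x≢a))) h)

Arcᵉ : ∣ Env ∣ → ℕ → ℕ → Set
Arcᵉ e i j = T (arc e i j)

Sink : ∣ Env ∣ → ℕ → Set
Sink e i = T (isSink e i)

-- This states what correctness uses of an instance in terms of the environment, with naturals as
-- vertices. Several fields range over all naturals: a number that is no vertex looks up the default
-- box, which has width 0 and no half-edges.
record Valid (n : ℕ) (e : ∣ Env ∣) : Set where
  field
    ∈-verts    : ∀ {i} → i < n → i ∈ verts e
    verts-<    : ∀ {i} → i ∈ verts e → i < n
    #verts     : length (verts e) ≡ n
    source-<   : ∀ {i d} → d ∈ rot e i → i < n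
    target-<   : ∀ {i d} → d ∈ rot e i → tgt d < n
    simpleᵉ    : ∀ i → Unique (map tgt (rot e i))
    in-twin    : ∀ {i j} → Arcᵉ e i j → ∃[ d ] d ∈ rot e j × ¬ T (isOut d) × tgt d ≡ i
    out-twin   : ∀ {j d} → d ∈ rot e j → ¬ T (isOut d) → Arcᵉ e (tgt d) j
    acyclicᵉ   : ∀ i → ¬ TransClosure (Arcᵉ e) i i
    root       : ℕ
    root-<     : root < n
    root-sink  : Sink e root
    sink-root  : ∀ {i} → i < n → Sink e i → i ≡ root
    W-pos      : ∀ {i} → i < n → 0 < W e i
    H-pos      : ∀ {i} → i < n → 0 < H e i
    W-multiple : ∀ i → suc n ∣ W e i

module Combinatorics {n : ℕ} {e : ∣ Env ∣} (valid : Valid n e) where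
  open Valid valid public

  arc-intro : ∀ {i d} → d ∈ rot e i → T (isOut d) → Arcᵉ e i (tgt d)
  arc-intro {d = d} d∈ o = any⁺ d∈ (T-∧⁺ o (≡⇒≡ᵇ (tgt d) (tgt d) refl))

  arc-elim : ∀ {i j} → Arcᵉ e i j → ∃[ d ] d ∈ rot e i × T (isOut d) × tgt d ≡ j
  arc-elim {i} {j} h = let (d , d∈ , q) = any⁻ (rot e i) h ; (o , eq) = T-∧⁻ {isOut d} q in d , d∈ , o , ≡ᵇ⇒≡ _ _ eq

  arc-<ˡ : ∀ {i j} → Arcᵉ e i j → i < n
  arc-<ˡ a = source-< (proj₁ (proj₂ (arc-elim a)))

  arc-<ʳ : ∀ {i j} → Arcᵉ e i j → j < n
  arc-<ʳ a = let (d , d∈ , _ , eq) = arc-elim a in subst (_< n) eq (target-< d∈)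

  parent-arc : ∀ {i} → ¬ Sink e i → Arcᵉ e i (parent e i)
  parent-arc {i} ¬s = let (d , d∈ , o , eq) = go (rot e i) ¬s in subst (Arcᵉ e i) eq (arc-intro d∈ o)
    where
    go : ∀ ds → ¬ T (all (λ d → not (isOut d)) ds) → ∃[ d ] d ∈ ds × T (isOut d) × tgt d ≡ firstOut i ds
    go []       h = ⊥-elim (h tt)
    go ((true , tf) ∷ ds)  h = _ , here refl , tt , refl
    go ((false , tf) ∷ ds) h = let (d , d∈ , q) = go ds h in d , there d∈ , q

  data Depth : ℕ → ℕ → Set where
    sink : ∀ {k i} → Sink e i → Depth k i
    step : ∀ {k i} → ¬ Sink e i → Depth k (parent e i) → Depth (suc k) i

  ancestor : ℕ → ℕ → ℕ
  ancestor zero    i = i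
  ancestor (suc m) i = ancestor m (parent e i)

  depth? : ∀ k i → Depth k i ⊎ (∀ m → m ≤ k → ¬ Sink e (ancestor m i))
  depth? k i with T-cases (isSink e i)
  depth? k       i | inj₁ s = inj₁ (sink s)
  depth? zero    i | inj₂ s = inj₂ λ { .0 z≤n → T-not⁻ s }
  depth? (suc k) i | inj₂ s with depth? k (parent e i)
  ... | inj₁ d = inj₁ (step (T-not⁻ s) d)
  ... | inj₂ h = inj₂ λ { zero _ → T-not⁻ s ; (suc m) (s≤s m≤) → h m m≤ }

  ancestor-< : ∀ {i} → i < n → ∀ m → (∀ l → l < m → ¬ Sink e (ancestor l i)) → ancestor m i < n
  ancestor-< i< zero    h = i<
  ancestor-< i< (suc m) h = ancestor-< (arc-<ʳ (parent-arc (h 0 (s≤s z≤n)))) m (λ l l< → h (suc l) (s≤s l<))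

  ancestor-reach : ∀ {i} a d → (∀ l → l ≤ a + d → ¬ Sink e (ancestor l i)) → TransClosure (Arcᵉ e) (ancestor a i) (ancestor (suc (a + d)) i)
  ancestor-reach (suc a) d h = ancestor-reach a d (λ l l≤ → h (suc l) (s≤s l≤))
  ancestor-reach zero    zero    h = [ parent-arc (h 0 z≤n) ]
  ancestor-reach zero    (suc d) h = parent-arc (h 0 z≤n) ∷ ancestor-reach zero d (λ l l≤ → h (suc l) (s≤s l≤))

  -- Otherwise `i` and its next `n` ancestors are all vertices other than the sink. Two of these
  -- `n + 1` vertices coincide, and the arcs between them form a cycle.
  depth : ∀ {i} → i < n → Depth n i
  depth {i} i< with depth? n i
  ... | inj₁ d = d
  ... | inj₂ h = ⊥-elim (collide (pigeonhole (n<1+n n) f))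
    where
    anc< : ∀ (k : Fin (suc n)) → ancestor (toℕ k) i < n
    anc< k = ancestor-< i< (toℕ k) (λ l l< → h l (≤-trans (<⇒≤ l<) (≤-pred (toℕ<n k))))
    f : Fin (suc n) → Fin n
    f k = fromℕ< (anc< k)
    collide : ¬ (∃[ a ] ∃[ b ] toℕ a < toℕ b × f a ≡ f b)
    collide (a , b , a<b , eq) = acyclicᵉ (ancestor (toℕ a) i)
      (subst (TransClosure (Arcᵉ e) (ancestor (toℕ a) i)) (trans (cong (λ k → ancestor k i) b≡) (sym (fromℕ<-injective _ _ (anc< a) (anc< b) eq)))
        (ancestor-reach (toℕ a) (toℕ b ∸ suc (toℕ a)) (λ l l≤ → h l (≤-trans l≤ (≤-trans (n≤1+n _) (≤-trans (≤-reflexive b≡) (≤-pred (toℕ<n b))))))))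
      where b≡ : suc (toℕ a + (toℕ b ∸ suc (toℕ a))) ≡ toℕ b
            b≡ = m+[n∸m]≡n a<b

  push-sink : ∀ {h q} → Sink e h → push e (h ∷ q) ≡ h ∷ q
  push-sink = cond-true

  climb-sink : ∀ {i} c → Sink e i → climb (e , i) c ≡ i ∷ []
  climb-sink []      s = refl
  climb-sink (_ ∷ c) s rewrite climb-sink c s = push-sink s

  climb-nonempty : ∀ ei c → ∃[ h ] ∃[ q ] climb ei c ≡ h ∷ q
  climb-nonempty ei []      = _ , _ , refl
  climb-nonempty (e′ , i) (_ ∷ c) with climb (e′ , i) c | climb-nonempty (e′ , i) c
  ... | h ∷ q | _ with isSink e′ h
  ...   | true  = _ , _ , refl
  ...   | false = _ , _ , refl

  -- The program extends a path at its upper end. This rereads it as a recursion at the lower end,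
  -- the form in which depths and ancestors are computed.
  climb-step : ∀ {i} x c → ¬ Sink e i → climb (e , i) (x ∷ c) ≡ climb (e , parent e i) c ++ i ∷ []
  climb-step x [] ¬s = cond-false (T-not⁺ ¬s)
  climb-step {i} x (y ∷ c) ¬s rewrite climb-step y c ¬s with climb (e , parent e i) c | climb-nonempty (e , parent e i) c
  ... | h ∷ q | _ with isSink e h
  ...   | true  = refl
  ...   | false = refl

  -- `climb-step` uses up a tick, while `path` always starts with `n` of them. The missing tick is
  -- made up for here: once the sink has been reached, further ticks change nothing.
  climb-stable : ∀ {k i} x c → length c ≡ k → Depth k i → climb (e , i) (x ∷ c) ≡ climb (e , i) c
  climb-stable x c       eq   (sink s)    = trans (climb-sink (x ∷ c) s) (sym (climb-sink c s))
  climb-stable x (y ∷ c) refl (step ¬s d) = trans (climb-step x (y ∷ c) ¬s)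
    (trans (cong (_++ _) (climb-stable y c refl d)) (sym (climb-step y c ¬s)))

  path-sink : ∀ {i} → Sink e i → path e i ≡ i ∷ []
  path-sink = climb-sink (verts e)

  path-step : ∀ {i} → i < n → ¬ Sink e i → path e i ≡ path e (parent e i) ++ i ∷ []
  path-step {i} i< ¬s = trans (sym (climb-stable 0 (verts e) #verts (depth i<)))
    (climb-step 0 (verts e) ¬s)

  S-step : ∀ {i} → i < n → ¬ Sink e i → S e i ≡ S e (parent e i) + H e i
  S-step {i} i< ¬s = trans (cong (λ p → sum (map (H e) p)) (path-step i< ¬s))
    (trans (cong sum (map-++ (H e) (path e (parent e i)) (i ∷ [])))
      (trans (sum-++ (map (H e) (path e (parent e i))) _) (cong (S e (parent e i) +_) (+-identityʳ _))))

  data Anc : ℕ → ℕ → Set where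
    self : ∀ {i} → Anc i i
    up   : ∀ {i a} → ¬ Sink e i → Anc (parent e i) a → Anc i a

  parent-< : ∀ {i} → ¬ Sink e i → parent e i < n
  parent-< ¬s = arc-<ʳ (parent-arc ¬s)

  self-∈-path : ∀ {i} → i < n → i ∈ path e i
  self-∈-path {i} i< with T-cases (isSink e i)
  ... | inj₁ s = subst (i ∈_) (sym (path-sink s)) (here refl)
  ... | inj₂ s = subst (i ∈_) (sym (path-step i< (T-not⁻ s))) (∈-++⁺ʳ (path e (parent e i)) (here refl))

  anc-∈-path : ∀ {i a} → i < n → Anc i a → a ∈ path e i
  anc-∈-path i< self = self-∈-path i<
  anc-∈-path {i} {a} i< (up ¬s p) = subst (a ∈_) (sym (path-step i< ¬s)) (∈-++⁺ˡ (anc-∈-path (parent-< ¬s) p))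

  ∈-climb : ∀ {a} i c → a ∈ climb (e , i) c → Anc i a
  ∈-climb i []      (here refl) = self
  ∈-climb i (x ∷ c) a∈ with T-cases (isSink e i)
  ... | inj₁ s with subst (_ ∈_) (climb-sink (x ∷ c) s) a∈
  ...   | here refl = self
  ∈-climb i (x ∷ c) a∈ | inj₂ s with ∈-++⁻ (climb (e , parent e i) c) (subst (_ ∈_) (climb-step x c (T-not⁻ s)) a∈)
  ... | inj₁ h           = up (T-not⁻ s) (∈-climb (parent e i) c h)
  ... | inj₂ (here refl) = self

  ∈-path : ∀ {i a} → a ∈ path e i → Anc i a
  ∈-path {i} = ∈-climb i (verts e)

  record Siblings (a b : ℕ) : Set where
    field
      ¬sinkˡ  : ¬ Sink e a
      ¬sinkʳ  : ¬ Sink e b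
      parents : parent e a ≡ parent e b
      differ  : a ≢ b

  record Before (t i j : ℕ) : Set where
    field
      {a b} : ℕ
      anc-a : Anc i a
      anc-b : Anc j b
      sibs  : Siblings a b
      order : T (first a b (insOrder e t (parent e a)))

  before⁻ : ∀ t i j → T (before e t i j) → Before t i j
  before⁻ t i j h =
    let (a , a∈ , h₁) = any⁻ (path e i) h
        (b , b∈ , h₂) = any⁻ (path e j) h₁
        (¬sa , h₃) = T-∧⁻ {not (isSink e a)} h₂
        (¬sb , h₄) = T-∧⁻ {not (isSink e b)} h₃
        (p≡ , h₅)  = T-∧⁻ {parent e a ≡ᵇ parent e b} h₄
        (a≢ , f)   = T-∧⁻ {not (a ≡ᵇ b)} h₅ in
    record { anc-a = ∈-path a∈ ; anc-b = ∈-path b∈ ; order = f ; sibs = record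
      { ¬sinkˡ = T-not⁻ ¬sa ; ¬sinkʳ = T-not⁻ ¬sb ; parents = ≡ᵇ⇒≡ _ _ p≡
      ; differ = λ a≡b → T-not⁻ a≢ (≡⇒≡ᵇ a b a≡b) } }

  before⁺ : ∀ {t i j} → i < n → j < n → Before t i j → T (before e t i j)
  before⁺ {t} {i} {j} i< j< b = any⁺ (anc-∈-path i< anc-a) (any⁺ (anc-∈-path j< anc-b)
    (T-∧⁺ (T-not⁺ ¬sinkˡ) (T-∧⁺ (T-not⁺ ¬sinkʳ) (T-∧⁺ (≡⇒≡ᵇ _ _ parents)
      (T-∧⁺ (T-not⁺ (λ h → differ (≡ᵇ⇒≡ _ _ h))) order)))))
    where open Before b
          open Siblings sibs

  ∈-insOrder : ∀ {a} t m → Arcᵉ e a m → a ∈ insOrder e t m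
  ∈-insOrder {a} t m arc with in-twin arc
  ... | d , d∈ , ¬o , refl = ∈-map⁺ tgt (∈-filterᵇ⁺ (∈-shiftTo⁺ {p = isOut} (∈-shiftTo⁺ {p = λ d → tgt d ≡ᵇ t} d∈)) (T-not⁺ ¬o))

  anc-snoc : ∀ {j m} → Anc j m → j ≡ m ⊎ ∃[ b ] Anc j b × ¬ Sink e b × parent e b ≡ m
  anc-snoc self = inj₁ refl
  anc-snoc {j} (up ¬s p) with anc-snoc p
  ... | inj₁ refl                 = inj₂ (j , self , ¬s , refl)
  ... | inj₂ (b , q , ¬sb , refl) = inj₂ (b , up ¬s q , ¬sb , refl)

  anc-root : ∀ {k j} → j < n → Depth k j → Anc j root
  anc-root j< (sink s)    = subst (Anc _) (sink-root j< s) self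
  anc-root j< (step ¬s d) = up ¬s (anc-root (parent-< ¬s) d)

  -- The parents form a tree rooted at the sink, so two paths to the root merge somewhere. If the
  -- parent of `i` lies on the path of `j`, then `anc-snoc` yields the child of that parent through
  -- which the path of `j` runs, and this child is either `i` itself or its sibling.
  coverage : ∀ {k i j} → i < n → j < n → Depth k i →
    Anc i j ⊎ Anc j i ⊎ ∃[ a ] ∃[ b ] Anc i a × Anc j b × Siblings a b
  coverage i< j< (sink s) rewrite sink-root i< s = inj₂ (inj₁ (anc-root j< (depth j<)))
  coverage {i = i} i< j< (step ¬s d) with coverage (parent-< ¬s) j< d
  ... | inj₁ p = inj₁ (up ¬s p)
  ... | inj₂ (inj₂ (a , b , p , q , sib)) = inj₂ (inj₂ (a , b , up ¬s p , q , sib))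
  ... | inj₂ (inj₁ p) with anc-snoc p
  ...   | inj₁ refl = inj₁ (up ¬s self)
  ...   | inj₂ (b , q , ¬sb , eq) with i ≟ b
  ...     | yes refl = inj₂ (inj₁ q)
  ...     | no i≢b   = inj₂ (inj₂ (i , b , self , q , record { ¬sinkˡ = ¬s ; ¬sinkʳ = ¬sb ; parents = sym eq ; differ = i≢b }))

  before-total : ∀ t {i j} → i < n → j < n → Anc i j ⊎ Anc j i ⊎ Before t i j ⊎ Before t j i
  before-total t {i} {j} i< j< with coverage i< j< (depth i<)
  ... | inj₁ p        = inj₁ p
  ... | inj₂ (inj₁ p) = inj₂ (inj₁ p)
  ... | inj₂ (inj₂ (a , b , p , q , sib)) with first-total (∈-insOrder t (parent e a) (parent-arc (Siblings.¬sinkˡ sib))) (Siblings.differ sib)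
  ...   | inj₁ f = inj₂ (inj₂ (inj₁ (record { anc-a = p ; anc-b = q ; sibs = sib ; order = f })))
  ...   | inj₂ f = inj₂ (inj₂ (inj₂ (record { anc-a = q ; anc-b = p
    ; sibs = record { ¬sinkˡ = ¬sinkʳ ; ¬sinkʳ = ¬sinkˡ ; parents = sym parents ; differ = λ eq → differ (sym eq) }
    ; order = subst (λ m → T (first b a (insOrder e t m))) parents f })))
    where open Siblings sib

-- Boxes that have to be kept apart

∈-cond⁻ : ∀ {A : Set} b {xs ys : List A} {x} → x ∈ cond b xs ys → (T b × x ∈ xs) ⊎ (T (not b) × x ∈ ys)
∈-cond⁻ true  h = inj₁ (tt , h)
∈-cond⁻ false h = inj₂ (tt , h)

Levelled : ∣ Env ∣ → Set
Levelled e = ∀ {i j} → Arcᵉ e i j → S e i ≡ S e j + H e i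

module Separation {n : ℕ} {e : ∣ Env ∣} (valid : Valid n e) where
  open Combinatorics valid public

  Meets StrictlyMeets : ℕ → ℕ → Set
  Meets i j         = S e j ≤ S e i + H e j × S e i ≤ S e j + H e i
  StrictlyMeets i j = S e j < S e i + H e j × S e i < S e j + H e i

  record Sep (i j : ℕ) : Set where
    constructor sep
    field
      i<n : i < n
      j<n : j < n
      i≢j : i ≢ j
      ¬ij : ¬ Arcᵉ e i j
      ¬ji : ¬ Arcᵉ e j i
      mts : Meets i j

  sep-sym : ∀ {i j} → Sep i j → Sep j i
  sep-sym (sep i< j< i≢j ¬ij ¬ji (p , q)) = sep j< i< (λ eq → i≢j (sym eq)) ¬ji ¬ij (q , p)

  separated⁺ : ∀ {i j} → Sep i j → T (separated e i j)
  separated⁺ (sep _ _ i≢j ¬ij ¬ji (p , q)) =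
    T-∧⁺ (T-not⁺ (λ h → i≢j (≡ᵇ⇒≡ _ _ h))) (T-∧⁺ (T-not⁺ ¬ij) (T-∧⁺ (T-not⁺ ¬ji) (T-∧⁺ (≤⇒≤ᵇ p) (≤⇒≤ᵇ q))))

  separated⁻ : ∀ {i j} → i < n → j < n → T (separated e i j) → Sep i j
  separated⁻ {i} {j} i< j< h =
    let (p , h₁) = T-∧⁻ {not (i ≡ᵇ j)} h ; (q , h₂) = T-∧⁻ {not (arc e i j)} h₁ ; (r , h₃) = T-∧⁻ {not (arc e j i)} h₂
        (u , v) = T-∧⁻ {S e j ≤ᵇ S e i + H e j} h₃ in
    sep i< j< (λ eq → T-not⁻ p (≡⇒≡ᵇ i j eq)) (T-not⁻ q) (T-not⁻ r) (≤ᵇ⇒≤ _ _ u , ≤ᵇ⇒≤ _ _ v)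

  strictlyMeets⁻ : ∀ {i j} → T (strictlyMeets e i j) → StrictlyMeets i j
  strictlyMeets⁻ {i} {j} h = let (u , v) = T-∧⁻ {suc (S e j) ≤ᵇ S e i + H e j} h in ≤ᵇ⇒≤ _ _ u , ≤ᵇ⇒≤ _ _ v

  strictlyMeets⁺ : ∀ {i j} → StrictlyMeets i j → T (strictlyMeets e i j)
  strictlyMeets⁺ (p , q) = T-∧⁺ (≤⇒≤ᵇ p) (≤⇒≤ᵇ q)

  sep-≤parent : ∀ {i j} → ¬ Sink e i → Sep i j → S e (parent e i) ≤ S e j
  sep-≤parent {i} {j} ¬s s = +-cancelʳ-≤ (H e i) _ _ (subst (_≤ S e j + H e i) (S-step (Sep.i<n s) ¬s) (proj₂ (Sep.mts s)))

  anc-S : ∀ {i a} → i < n → Anc i a → S e a ≤ S e i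
  anc-S i< self      = ≤-refl
  anc-S i< (up ¬s p) = ≤-trans (anc-S (parent-< ¬s) p) (≤-trans (m≤m+n _ _) (≤-reflexive (sym (S-step i< ¬s))))

  S-parent< : ∀ {i} → i < n → ¬ Sink e i → S e (parent e i) < S e i
  S-parent< {i} i< ¬s = subst (S e (parent e i) <_) (sym (S-step i< ¬s)) (m<m+n _ (H-pos i<))

  -- The parent of `i` is adjacent to `i`, and every higher ancestor ends strictly above the top
  -- side of `i`.
  sep-¬anc : ∀ {i j} → Sep i j → ¬ Anc i j
  sep-¬anc s self = Sep.i≢j s refl
  sep-¬anc s (up ¬s self) = Sep.¬ij s (parent-arc ¬s)
  sep-¬anc s (up ¬s (up ¬s′ p)) = <-irrefl refl (≤-trans (s≤s (≤-trans (sep-≤parent ¬s s) (anc-S (parent-< ¬s′) p)))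
    (S-parent< (parent-< ¬s) ¬s′))

  sep-before : ∀ t {i j} → Sep i j → Before t i j ⊎ Before t j i
  sep-before t s with before-total t (Sep.i<n s) (Sep.j<n s)
  ... | inj₁ p        = ⊥-elim (sep-¬anc s p)
  ... | inj₂ (inj₁ p) = ⊥-elim (sep-¬anc (sep-sym s) p)
  ... | inj₂ (inj₂ b) = b

  constraintsAt-∈ : ∀ {t i j c} → i < n → j < n → c ∈ constraintsAt e t i j → c ∈ constraints e t
  constraintsAt-∈ {t} {i} {j} i< j< c∈ = ∈-concatMap⁺ (λ i → concatMap (λ j → constraintsAt e t i j) (verts e))
    (lose (∈-verts i<) (∈-concatMap⁺ (λ j → constraintsAt e t i j) (lose (∈-verts j<) c∈)))

  constraints-∈⁻ : ∀ {t c} → c ∈ constraints e t → ∃[ i ] ∃[ j ] i < n × j < n × c ∈ constraintsAt e t i j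
  constraints-∈⁻ {t} c∈ =
    let (i , i∈ , h) = find (∈-concatMap⁻ (λ i → concatMap (λ j → constraintsAt e t i j) (verts e)) c∈)
        (j , j∈ , k) = find (∈-concatMap⁻ (λ j → constraintsAt e t i j) h) in i , j , verts-< i∈ , verts-< j∈ , k

  module Satisfied {x : List (ℕ × ℕ)} (t : ℕ) (sat : T (satisfied x (constraints e t))) where

    satisfies : ∀ {i a j b} → ((i , a) , (j , b)) ∈ constraints e t → at x i + a ≤ at x j + b
    satisfies c∈ = ≤ᵇ⇒≤ _ _ (all⁻ sat c∈)

    arc-overlap : ∀ {i j} → Arcᵉ e i j → at x i < at x j + W e j × at x j < at x i + W e i
    arc-overlap {i} {j} a = le (satisfies (member (here refl))) , le (satisfies (member (there (here refl))))
      where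
      member : ∀ {c} → c ∈ (((i , 1) , (j , W e j)) ∷ ((j , 1) , (i , W e i)) ∷ []) → c ∈ constraints e t
      member c∈ = constraintsAt-∈ (arc-<ˡ a) (arc-<ʳ a) (subst (_ ∈_) (sym (cond-true a)) c∈)
      le : ∀ {m k} → m + 1 ≤ k → m < k
      le {m} {k} = subst (_≤ k) (+-comm m 1)

    before-separates : ∀ {i j} → Sep i j → Before t i j → at x i + (W e i + bit (strictlyMeets e i j)) ≤ at x j
    before-separates {i} {j} s b = subst (at x i + (W e i + bit (strictlyMeets e i j)) ≤_) (+-identityʳ _) (satisfies (constraintsAt-∈ (Sep.i<n s) (Sep.j<n s)
      (subst (_ ∈_) (sym (trans (cond-false (T-not⁺ (Sep.¬ij s))) (cond-true (T-∧⁺ (separated⁺ s) (before⁺ (Sep.i<n s) (Sep.j<n s) b))))) (here refl))))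

    sep-separates : ∀ {i j} → Sep i j →
      at x i + (W e i + bit (strictlyMeets e i j)) ≤ at x j ⊎ at x j + (W e j + bit (strictlyMeets e j i)) ≤ at x i
    sep-separates s with sep-before t s
    ... | inj₁ b = inj₁ (before-separates s b)
    ... | inj₂ b = inj₂ (before-separates (sep-sym s) b)

  module _ (lev : Levelled e) where

    -- Boxes standing on the same top side have their bottoms at one level. So their heights overlap
    -- properly, whereas an arc between them would lift one bottom by a positive height.
    outs-sep : ∀ {i u v} → Arcᵉ e i u → Arcᵉ e i v → u ≢ v → Sep u v × StrictlyMeets u v
    outs-sep {i} {u} {v} a b u≢v =
      sep u< v< u≢v (¬arc u< Su≡Sv) (¬arc v< (sym Su≡Sv)) (<⇒≤ (proj₁ sm) , <⇒≤ (proj₂ sm)) , sm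
      where
      u< = arc-<ʳ a
      v< = arc-<ʳ b
      Su≡Sv : S e u ≡ S e v
      Su≡Sv = +-cancelʳ-≡ (H e i) _ _ (trans (sym (lev a)) (lev b))
      ¬arc : ∀ {u v} → u < n → S e u ≡ S e v → ¬ Arcᵉ e u v
      ¬arc {u} {v} u< eq c = <-irrefl (trans (sym eq) (lev c)) (m<m+n (S e v) (H-pos u<))
      sm : StrictlyMeets u v
      sm = subst (λ s → s < S e u + H e v) Su≡Sv (m<m+n (S e u) (H-pos v<)) ,
           subst (_< S e v + H e u) (sym Su≡Sv) (m<m+n (S e v) (H-pos u<))

    ins-sep : ∀ {i u v} → Arcᵉ e u i → Arcᵉ e v i → u ≢ v → Sep u v × StrictlyMeets u v
    ins-sep {i} {u} {v} a b u≢v =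
      sep u< v< u≢v (¬arc a b) (¬arc b a) (<⇒≤ (proj₁ sm) , <⇒≤ (proj₂ sm)) , sm
      where
      u< = arc-<ˡ a
      v< = arc-<ˡ b
      ¬arc : ∀ {u v} → Arcᵉ e u i → Arcᵉ e v i → ¬ Arcᵉ e u v
      ¬arc {u} {v} a b c = <-irrefl (+-cancelʳ-≡ (H e u) _ _ (trans (sym (lev a)) (lev c)))
        (subst (S e i <_) (sym (lev b)) (m<m+n (S e i) (H-pos (arc-<ˡ b))))
      half : ∀ {u v} → Arcᵉ e u i → Arcᵉ e v i → S e v < S e u + H e v
      half {u} {v} a b = subst (_< S e u + H e v) (sym (lev b)) (+-monoˡ-< (H e v) (subst (S e i <_) (sym (lev a)) (m<m+n (S e i) (H-pos (arc-<ˡ a)))))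
      sm : StrictlyMeets u v
      sm = half a b , half b a

-- The pair (i , a) stands for the coordinate a units to the right of the left
-- side of box i.  Only their order matters, so no real numbers occur here.
record Realized (n : ℕ) (e : ∣ Env ∣) (valid : Valid n e) : Set₁ where
  open Separation valid
  infix 4 _≼_
  field
    _≼_     : ℕ × ℕ → ℕ × ℕ → Set
    ≼-trans : ∀ {p q r} → p ≼ q → q ≼ r → p ≼ r
    ≼-total : ∀ {p q} → ¬ p ≼ q → q ≼ p
    ≼-stable : ∀ {p q} → ¬ ¬ p ≼ q → p ≼ q
    ≼-shift : ∀ {i a j b} c → (i , a) ≼ (j , b) → (i , a + c) ≼ (j , b + c)
    ≼-unshift : ∀ {i a j b} c → (i , a + c) ≼ (j , b + c) → (i , a) ≼ (j , b)
    ≼-mono  : ∀ {i a b} → a ≤ b → (i , a) ≼ (i , b)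
    ≼-anti  : ∀ {i a b} → (i , a) ≼ (i , b) → a ≤ b
  Left : ℕ → ℕ → Set
  Left i j = (i , W e i) ≼ (j , 0)
  field
    level      : Levelled e
    overlapʳ   : ∀ {i j} → Arcᵉ e i j → ¬ Left i j × ¬ Left j i
    -- A disjunction would ask for a decision between two inequalities of reals; its double negation
    -- can be proved.
    disjointʳ  : ∀ {i j} → Sep i j → ¬ (¬ Left i j × ¬ Left j i)
    apartʳ     : ∀ {i j} → Sep i j → StrictlyMeets i j → Left i j → ¬ (j , 0) ≼ (i , W e i)
    rotationʳ  : ∀ {m} → m < n → ∃[ ts ] ∃[ bs ] CyclicShift (rot e m) (ts ++ bs) ×
                 All (λ d → T (isOut d)) ts × AllPairs (λ d d′ → ¬ (tgt d , 0) ≼ (tgt d′ , 0)) ts ×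
                 All (λ d → ¬ T (isOut d)) bs × AllPairs (λ d d′ → ¬ (tgt d′ , 0) ≼ (tgt d , 0)) bs
    outerʳ     : ∀ {d} → d ∈ rot e root → (∀ d′ → d′ ∈ rot e root → (tgt d′ , 0) ≼ (tgt d , 0)) → fc d ≡ outerOf e

multiples-gap : ∀ {k a b} → k ∣ a → k ∣ b → a < b → a + k ≤ b
multiples-gap {k} (divides p refl) (divides q refl) a<b =
  subst (_≤ q * k) (+-comm k (p * k)) (*-monoˡ-≤ k (*-cancelʳ-< k p q a<b))

first⇒related : ∀ {R : ℕ → ℕ → Set} {a b xs} → AllPairs R xs → b ∈ xs → a ≢ b → T (first a b xs) → R a b
first⇒related {R} {a} {b} {x ∷ xs} (r ∷ rs) b∈ a≢b f with T-cases (x ≡ᵇ a) | T-cases (x ≡ᵇ b)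
first⇒related {R} {a} {b} {x ∷ xs} (r ∷ rs) (here refl) a≢b f | inj₁ x≡a | _ = ⊥-elim (a≢b (sym (≡ᵇ⇒≡ _ _ x≡a)))
first⇒related {R} {a} {b} {x ∷ xs} (r ∷ rs) (there b∈) a≢b f | inj₁ x≡a | _ = subst (λ y → R y b) (≡ᵇ⇒≡ x a x≡a) (All.lookup r b∈)
first⇒related {R} {a} {b} {x ∷ xs} (r ∷ rs) b∈ a≢b f | inj₂ x≢a | inj₁ x≡b = ⊥-elim (subst T (trans (cond-false x≢a) (cond-true x≡b)) f)
first⇒related {R} {a} {b} {x ∷ xs} (r ∷ rs) (here refl) a≢b f | inj₂ x≢a | inj₂ x≢b = ⊥-elim (T-not⁻ x≢b (≡⇒≡ᵇ x x refl))
first⇒related {R} {a} {b} {x ∷ xs} (r ∷ rs) (there b∈) a≢b f | inj₂ x≢a | inj₂ x≢b =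
  first⇒related rs b∈ a≢b (subst T (trans (cond-false x≢a) (cond-false x≢b)) f)

-- Cutting cyclic lists

module _ {A : Set} {p : A → Bool} where

  takeUntil-++ : ∀ {us vs} → All (λ x → ¬ T (p x)) us → takeUntil p (us ++ vs) ≡ us ++ takeUntil p vs
  takeUntil-++ []       = refl
  takeUntil-++ (h ∷ hs) = trans (cond-false (T-not⁺ h)) (cong (_ ∷_) (takeUntil-++ hs))

  dropUntil-++ : ∀ {us vs} → All (λ x → ¬ T (p x)) us → dropUntil p (us ++ vs) ≡ dropUntil p vs
  dropUntil-++ []       = refl
  dropUntil-++ (h ∷ hs) = trans (cond-false (T-not⁺ h)) (dropUntil-++ hs)

  shiftTo-split : ∀ {us v vs} → All (λ x → ¬ T (p x)) us → T (p v) → shiftTo p (us ++ v ∷ vs) ≡ v ∷ vs ++ us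
  shiftTo-split {us} {v} {vs} h pv = cong₂ _++_ (trans (dropUntil-++ h) (cond-true pv))
    (trans (takeUntil-++ h) (trans (cong (us ++_) (cond-true pv)) (++-identityʳ us)))

  shiftTo-none : ∀ {us} → All (λ x → ¬ T (p x)) us → shiftTo p us ≡ us
  shiftTo-none {us} h = trans (cong (shiftTo p) (sym (++-identityʳ us)))
    (trans (cong₂ _++_ (dropUntil-++ h) (takeUntil-++ h)) (++-identityʳ us))

  filterᵇ-all : ∀ {xs} → All (λ x → T (p x)) xs → filterᵇ p xs ≡ xs
  filterᵇ-all = filter-all (λ x → T? (p x))

  filterᵇ-none : ∀ {xs} → All (λ x → ¬ T (p x)) xs → filterᵇ p xs ≡ []
  filterᵇ-none = filter-none (λ x → T? (p x))

  filterᵇ-++ : ∀ xs {ys} → filterᵇ p (xs ++ ys) ≡ filterᵇ p xs ++ filterᵇ p ys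
  filterᵇ-++ xs {ys} = filter-++ (λ x → T? (p x)) xs ys

++-split : ∀ {A : Set} (vs {us} ts {bs} : List A) → vs ++ us ≡ ts ++ bs →
  (∃[ w ] vs ≡ ts ++ w × bs ≡ w ++ us) ⊎ (∃[ w ] ts ≡ vs ++ w × us ≡ w ++ bs)
++-split vs       []       eq = inj₁ (vs , refl , sym eq)
++-split []       (t ∷ ts) eq = inj₂ (t ∷ ts , refl , eq)
++-split (v ∷ vs) (t ∷ ts) eq with ∷-injective eq
... | refl , eq′ with ++-split vs ts eq′
...   | inj₁ (w , refl , q) = inj₁ (w , refl , q)
...   | inj₂ (w , refl , q) = inj₂ (w , refl , q)

takeUntil-dropUntil : ∀ {A : Set} (p : A → Bool) xs → takeUntil p xs ++ dropUntil p xs ≡ xs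
takeUntil-dropUntil p []       = refl
takeUntil-dropUntil p (x ∷ xs) with p x
... | true  = refl
... | false = cong (x ∷_) (takeUntil-dropUntil p xs)

shift-++ : ∀ {A : Set} {xs zs : List A} (p : A → Bool) → CyclicShift xs zs → CyclicShift (shiftTo p xs) zs
shift-++ p (us , vs , refl , refl) with ++-split (takeUntil p (us ++ vs)) us (takeUntil-dropUntil p (us ++ vs))
... | inj₁ (w , t≡ , vs≡) = dropUntil p (us ++ vs) ++ us , w ,
          trans (cong (dropUntil p (us ++ vs) ++_) t≡) (sym (++-assoc (dropUntil p (us ++ vs)) us w)) ,
          trans (cong (_++ us) vs≡) (++-assoc w _ us)
... | inj₂ (w , us≡ , d≡) = w , vs ++ takeUntil p (us ++ vs) ,
          trans (cong (_++ takeUntil p (us ++ vs)) d≡) (++-assoc w vs _) ,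
          trans (cong (vs ++_) us≡) (sym (++-assoc vs _ w))

module _ {A : Set} (p : A → Bool) where

  private
    q : A → Bool
    q x = not (p x)

  -- The list `xs` is cut open somewhere. If this happens inside the block satisfying `p`, then `xs`
  -- already starts with such an element and `bs` is intact in its middle. Otherwise `shiftTo` moves
  -- the beginning of `xs` to its end, which joins the two pieces of `bs`.
  filter-shiftTo : ∀ {xs : List A} t ts bs → CyclicShift xs ((t ∷ ts) ++ bs) →
    All (λ d → T (p d)) (t ∷ ts) → All (λ d → ¬ T (p d)) bs →
    filterᵇ q (shiftTo p xs) ≡ bs
  filter-shiftTo t ts bs (us , vs , refl , eq) pts pbs with ++-split vs (t ∷ ts) (sym eq)
  ... | inj₁ (w , refl , refl) = let (pw , pu) = Allₚ.++⁻ w pbs in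
    trans (cong (filterᵇ q) (shiftTo-split pu (All.head pts)))
    (trans (filterᵇ-++ {p = q} (t ∷ ts ++ w))
    (trans (cong (_++ filterᵇ q us) (filterᵇ-++ {p = q} (t ∷ ts)))
      (cong₂ _++_ (cong₂ _++_ (filterᵇ-none {p = q} (All.map (λ h g → T-not⁻ g h) pts)) (filterᵇ-all {p = q} (All.map T-not⁺ pw)))
        (filterᵇ-all {p = q} (All.map T-not⁺ pu)))))
  ... | inj₂ (y ∷ w , teq , refl) = 
    let (pv , pyw) = Allₚ.++⁻ vs (subst (All _) teq pts)
        py = All.head pyw in
    trans (cong (λ z → filterᵇ q (z ++ takeUntil p (y ∷ (w ++ bs) ++ vs))) (cond-true py))
    (trans (cong (λ z → filterᵇ q ((y ∷ (w ++ bs) ++ vs) ++ z)) (cond-true py))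
    (trans (cong (filterᵇ q) (++-identityʳ (y ∷ (w ++ bs) ++ vs)))
    (trans (filterᵇ-++ {p = q} (y ∷ (w ++ bs)))
    (trans (cong (_++ filterᵇ q vs) (filterᵇ-++ {p = q} (y ∷ w)))
    (trans (cong₂ _++_ (cong₂ _++_ (filterᵇ-none {p = q} (All.map (λ h g → T-not⁻ g h) pyw)) (filterᵇ-all {p = q} (All.map T-not⁺ pbs)))
      (filterᵇ-none {p = q} (All.map (λ h g → T-not⁻ g h) pv))) (++-identityʳ bs))))))
  filter-shiftTo t ts bs (us , vs , refl , eq) pts pbs | inj₂ ([] , teq , refl) with trans teq (++-identityʳ vs)
  ... | refl = trans (cong (filterᵇ q) (shiftTo-split pbs (All.head pts)))
    (trans (filterᵇ-++ {p = q} (t ∷ ts)) (cong₂ _++_ (filterᵇ-none {p = q} (All.map (λ h g → T-not⁻ g h) pts)) (filterᵇ-all {p = q} (All.map T-not⁺ pbs))))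

-- Completeness

at-map : ∀ (f : ℕ → ℕ) {vs i} → i ∈ vs → at (map (λ j → j , f j) vs) i ≡ f i
at-map f {v ∷ vs} {i} i∈ with T-cases (i ≡ᵇ v)
at-map f {v ∷ vs} {i} i∈ | inj₁ eq = trans (cond-true eq) (cong f (sym (≡ᵇ⇒≡ i v eq)))
at-map f {v ∷ vs} {i} (here refl) | inj₂ ne = ⊥-elim (T-not⁻ ne (≡⇒≡ᵇ i i refl))
at-map f {v ∷ vs} {i} (there i∈)  | inj₂ ne = trans (cond-false ne) (at-map f i∈)

relax-≥ : ∀ x j cs → at x j ≤ relax (x , j) cs
relax-≥ x j []                         = ≤-refl
relax-≥ x j (((i , a) , (k , b)) ∷ cs) with k ≡ᵇ j
... | true  = ≤-trans (relax-≥ x j cs) (m≤m⊔n _ _)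
... | false = relax-≥ x j cs

relax-enforces : ∀ x {cs i a j b} → ((i , a) , (j , b)) ∈ cs → at x i + a ∸ b ≤ relax (x , j) cs
relax-enforces x {((i , a) , (j , b)) ∷ cs} (here refl) = subst (at x i + a ∸ b ≤_) (sym (cond-true (≡⇒≡ᵇ j j refl))) (m≤n⊔m _ _)
relax-enforces x {((i′ , a′) , (k , b′)) ∷ cs} {j = j} (there c∈) with k ≡ᵇ j
... | true  = ≤-trans (relax-enforces x c∈) (m≤m⊔n _ _)
... | false = relax-enforces x c∈

relax-attained : ∀ x j cs → relax (x , j) cs ≡ at x j ⊎
  ∃[ i ] ∃[ a ] ∃[ b ] ((i , a) , (j , b)) ∈ cs × relax (x , j) cs ≡ at x i + a ∸ b
relax-attained x j [] = inj₁ refl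
relax-attained x j (((i , a) , (k , b)) ∷ cs) with T-cases (k ≡ᵇ j) | relax-attained x j cs
... | inj₂ ne | inj₁ eq = inj₁ (trans (cond-false ne) eq)
... | inj₂ ne | inj₂ (i′ , a′ , b′ , c∈ , eq) = inj₂ (i′ , a′ , b′ , there c∈ , trans (cond-false ne) eq)
... | inj₁ k≡ | ih with ≡ᵇ⇒≡ k j k≡ | ⊔-sel (relax (x , j) cs) (at x i + a ∸ b)
...   | refl | inj₂ new = inj₂ (i , a , b , here refl , trans (cond-true k≡) new)
...   | refl | inj₁ old with ih
...     | inj₁ eq = inj₁ (trans (cond-true k≡) (trans old eq))
...     | inj₂ (i′ , a′ , b′ , c∈ , eq) = inj₂ (i′ , a′ , b′ , there c∈ , trans (cond-true k≡) (trans old eq))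

module Completeness {n : ℕ} {e : ∣ Env ∣} {valid : Valid n e} (realized : Realized n e valid) where
  open Separation valid
  open Realized realized

  anc-parent-S : ∀ {j b} → ¬ Sink e b → Anc j b → S e (parent e b) ≤ S e (parent e j)
  anc-parent-S< : ∀ {j b} → ¬ Sink e b → ¬ Sink e j → Anc (parent e j) b → S e (parent e b) < S e (parent e j)
  anc-parent-S ¬sb self      = ≤-refl
  anc-parent-S ¬sb (up ¬s p) = <⇒≤ (anc-parent-S< ¬sb ¬s p)
  anc-parent-S< ¬sb ¬sj p = ≤-<-trans (anc-parent-S ¬sb p) (S-parent< (parent-< ¬sj) (¬sink p))
    where
    ¬sink : ∀ {j} → Anc j _ → ¬ Sink e j
    ¬sink self      = ¬sb
    ¬sink (up ¬s _) = ¬s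

  -- Along a path the level of the parent changes strictly, so each level belongs to at most one
  -- ancestor.
  anc-unique : ∀ {p a b} → Anc p a → Anc p b → ¬ Sink e a → ¬ Sink e b → S e (parent e a) ≡ S e (parent e b) → a ≡ b
  anc-unique self      self      ¬sa ¬sb eq = refl
  anc-unique self      (up ¬s q) ¬sa ¬sb eq = ⊥-elim (<-irrefl (sym eq) (anc-parent-S< ¬sb ¬s q))
  anc-unique (up ¬s p) self      ¬sa ¬sb eq = ⊥-elim (<-irrefl eq (anc-parent-S< ¬sa ¬s p))
  anc-unique (up ¬s p) (up _ q)  ¬sa ¬sb eq = anc-unique p q ¬sa ¬sb eq

  -- Here the top of `i` is lower than that of `j`, so `j` spans the level where the parent of `i`
  -- begins. An arc from that parent to `j` would put `j` wholly above the top of `i`; an arc from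
  -- `j` to it would make the two tops level.
  sep-parentˡ : ∀ {i j} → ¬ Sink e i → ¬ Sink e j → S e (parent e j) < S e (parent e i) → Sep i j → Sep (parent e i) j
  sep-parentˡ {i} {j} ¬si ¬sj lt s = sep (parent-< ¬si) (Sep.j<n s)
    (λ { refl → Sep.¬ij s (parent-arc ¬si) })
    (λ a → <⇒≱ (subst (S e j <_) (sym (level a)) (m<m+n _ (H-pos (parent-< ¬si)))) (sep-≤parent ¬si s))
    (λ a → <-irrefl (+-cancelʳ-≡ (H e j) _ _ (trans (sym (level (parent-arc ¬sj))) (level a))) lt)
    (subst (_≤ S e (parent e i) + H e j) (sym (S-step (Sep.j<n s) ¬sj)) (+-monoˡ-≤ (H e j) (<⇒≤ lt)) ,
     ≤-trans (sep-≤parent ¬si s) (m≤m+n _ _))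

  -- If `j` were to the left of `i`, then the parent of `i` would end before `j` and hence before
  -- `i` begins, although a box and its parent overlap. The next two lemmas are variants of this.
  left-lower : ∀ {i j} → ¬ Sink e i → Sep i j → Left (parent e i) j → Left i j
  left-lower ¬si s l = ≼-stable λ nl → disjointʳ s (nl , λ ji →
    proj₂ (overlapʳ (parent-arc ¬si)) (≼-trans l (≼-trans (≼-mono z≤n) ji)))

  left-upper : ∀ {i j} → ¬ Sink e j → Sep i j → Left i (parent e j) → Left i j
  left-upper ¬sj s l = ≼-stable λ nl → disjointʳ s (nl , λ ji →
    proj₁ (overlapʳ (parent-arc ¬sj)) (≼-trans ji (≼-trans (≼-mono z≤n) l)))

  left-both : ∀ {i j} → ¬ Sink e i → ¬ Sink e j → Sep i j → Left (parent e i) (parent e j) → Left i j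
  left-both ¬si ¬sj s l = ≼-stable λ nl → disjointʳ s (nl , λ ji →
    proj₁ (overlapʳ (parent-arc ¬sj)) (≼-trans ji (≼-trans (≼-total (proj₂ (overlapʳ (parent-arc ¬si)))) l)))

  steps : ∀ {i a} → Anc i a → ℕ
  steps self     = 0
  steps (up _ p) = suc (steps p)

  -- The lower of the two boxes is replaced by its parent, which stays on the
  -- same side of the other box, until two siblings are reached.
  left-of : ∀ k {i j a b} (p : Anc i a) (q : Anc j b) → steps p + steps q ≤ k → Siblings a b →
    ¬ (b , 0) ≼ (a , 0) → Sep i j → Left i j
  left-of k self self _ sib base s = ≼-stable λ nl → disjointʳ s (nl , λ ji → base (≼-trans (≼-mono z≤n) ji))
  -- Here `i` is the sibling `a`. Its parent is also that of `b` and lies above the parent of `j`,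
  -- so `j` is the box to be moved.
  left-of (suc k) {i} {j} self (up ¬sj q) (s≤s h) sib base s =
    left-upper ¬sj s (left-of k self q h sib base (sep-sym (sep-parentˡ ¬sj (Siblings.¬sinkˡ sib)
      (subst (_< S e (parent e j)) (cong (S e) (sym (Siblings.parents sib))) (anc-parent-S< (Siblings.¬sinkʳ sib) ¬sj q)) (sep-sym s))))
  left-of (suc k) {i} {j} (up ¬si p) self (s≤s h) sib base s =
    left-lower ¬si s (left-of k p self h sib base (sep-parentˡ ¬si (Siblings.¬sinkʳ sib)
      (subst (_< S e (parent e i)) (cong (S e) (Siblings.parents sib)) (anc-parent-S< (Siblings.¬sinkˡ sib) ¬si p)) s))
  left-of (suc k) {i} {j} {a} {b} (up ¬si p) (up ¬sj q) h sib base s with <-cmp (S e (parent e i)) (S e (parent e j))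
  ... | tri< lt _ _ = left-upper ¬sj s (left-of k (up ¬si p) q (≤-pred (subst (_≤ suc k) (+-suc (suc (steps p)) (steps q)) h))
                        sib base (sep-sym (sep-parentˡ ¬sj ¬si lt (sep-sym s))))
  ... | tri> _ _ gt = left-lower ¬si s (left-of k p (up ¬sj q) (≤-pred h) sib base (sep-parentˡ ¬si ¬sj gt s))
  -- With tops at equal height, `j` may touch the parent of `i`, so moving a single box could
  -- produce an adjacent pair; both are moved. Their parents are distinct, for by `anc-unique` a
  -- common parent would force the siblings `a` and `b` to be equal.
  ... | tri≈ _ eq _ with parent e i ≟ parent e j
  ...   | yes same = ⊥-elim (Siblings.differ sib (anc-unique p (subst (λ k → Anc k b) (sym same) q)
            (Siblings.¬sinkˡ sib) (Siblings.¬sinkʳ sib) (cong (S e) (Siblings.parents sib))))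
  ...   | no differ = left-both ¬si ¬sj s (left-of k p q (≤-trans (+-monoʳ-≤ (steps p) (n≤1+n (steps q))) (≤-pred h)) sib base
            (sep (parent-< ¬si) (parent-< ¬sj) differ (¬arc eq (parent-< ¬si)) (¬arc (sym eq) (parent-< ¬sj))
            (subst (_≤ S e (parent e i) + H e (parent e j)) eq (m≤m+n _ _) , subst (_≤ S e (parent e j) + H e (parent e i)) (sym eq) (m≤m+n _ _))))
    where
    ¬arc : ∀ {u v} → S e u ≡ S e v → u < n → ¬ Arcᵉ e u v
    ¬arc {u} {v} eq u< c = <-irrefl (trans (sym eq) (level c)) (m<m+n (S e v) (H-pos u<))

  -- A realization satisfies the constraint with `base` in place of `base + slack`, and strictly so
  -- if the slack is 1. The slack is the unit gap by which the integer system replaces strictness.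
  record Justified (c : Constraint) : Set where
    field
      source-<n : proj₁ (proj₁ c) < n
      base slack : ℕ
      splits     : proj₂ (proj₁ c) ≡ base + slack
      slack≤1    : slack ≤ 1
      base-mult  : suc n ∣ base
      bound-mult : suc n ∣ proj₂ (proj₂ c)
      holds      : (proj₁ (proj₁ c) , base) ≼ proj₂ c
      strict     : 1 ≤ slack → ¬ proj₂ c ≼ (proj₁ (proj₁ c) , base)

  -- A chain of relaxations that leads from the label start of i to the label
  -- end of j.  Each strict constraint in it contributes one unit of slack.
  record Walk (i start j end steps : ℕ) : Set where
    field
      sumˡ sumʳ slacks : ℕ
      multˡ   : suc n ∣ sumˡ
      multʳ   : suc n ∣ sumʳ
      slacks≤ : slacks ≤ steps
      labels  : end + sumʳ ≡ start + sumˡ + slacks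
      bound   : (i , sumˡ) ≼ (j , sumʳ)
      sharp   : 1 ≤ slacks → ¬ (j , sumʳ) ≼ (i , sumˡ)

  ≼-refl : ∀ {p} → p ≼ p
  ≼-refl = ≼-mono ≤-refl

  stay : ∀ {i l} → Walk i l i l 0
  stay {i} {l} = record { sumˡ = 0 ; sumʳ = 0 ; slacks = 0 ; multˡ = _ ∣0 ; multʳ = _ ∣0 ; slacks≤ = z≤n
    ; labels = sym (+-identityʳ _) ; bound = ≼-refl ; sharp = λ () }

  extend : ∀ {i l j m k r s} c → Walk i l j m s → Justified c → proj₁ (proj₁ c) ≡ j → proj₁ (proj₂ c) ≡ k →
    r + proj₂ (proj₂ c) ≡ m + proj₂ (proj₁ c) → Walk i l k r (suc s)
  extend {i} {l} {j} {m} {k} {r} {s} ((.j , .(base + slack)) , (.k , b)) w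
    record { base = base ; slack = slack ; splits = refl ; slack≤1 = slack≤1 ; base-mult = bm ; bound-mult = bdm ; holds = h ; strict = st } refl refl eq = record
    { sumˡ = sumˡ + base ; sumʳ = b + sumʳ ; slacks = slacks + slack
    ; multˡ = ∣m∣n⇒∣m+n multˡ bm ; multʳ = ∣m∣n⇒∣m+n bdm multʳ
    ; slacks≤ = ≤-trans (+-mono-≤ slacks≤ slack≤1) (≤-reflexive (+-comm s 1))
    ; labels = trans (sym (+-assoc r b sumʳ)) (trans (cong (_+ sumʳ) eq)
        (trans (shuffle m (base + slack) sumʳ) (trans (cong (_+ (base + slack)) labels) (shuffle′ l sumˡ slacks base slack))))
    ; bound = ≼-trans first-half second-half
    ; sharp = sharp′ }
    where
    open Walk w
    shuffle : ∀ m a t → m + a + t ≡ m + t + a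
    shuffle = solve-∀
    shuffle′ : ∀ l u s a t → l + u + s + (a + t) ≡ l + (u + a) + (s + t)
    shuffle′ = solve-∀
    first-half : (i , sumˡ + base) ≼ (j , sumʳ + base)
    first-half = ≼-shift base bound
    second-half : (j , sumʳ + base) ≼ (k , b + sumʳ)
    second-half = subst (λ z → (j , z) ≼ (k , b + sumʳ)) (+-comm base sumʳ) (≼-shift sumʳ h)
    sharp′ : 1 ≤ slacks + slack → ¬ (k , b + sumʳ) ≼ (i , sumˡ + base)
    -- Positive total slack comes from the earlier walk or from the new constraint. A reversed
    -- inequality, combined with the weak bound of the other part and shifted back, contradicts the
    -- strictness of that part.
    sharp′ p>0 back with slacks ≟ 0
    ... | no ≢0 = sharp (n≢0⇒n>0 ≢0) (≼-unshift base (≼-trans second-half back))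
    ... | yes refl = st p>0 (≼-unshift sumʳ (subst (λ z → (k , b + sumʳ) ≼ (j , z)) (+-comm sumʳ base) (≼-trans back first-half)))

  -- The bound of a closed walk compares two offsets on one box, hence two integers: `sumˡ ≤ sumʳ`.
  -- With positive slack the inequality is strict, and as both sums are multiples of `1 + n`, the
  -- difference exceeds the at most `n` units of slack. In either case going around gains nothing.
  closed-walk : ∀ {i l m s} → s ≤ n → Walk i l i m s → m ≤ l
  closed-walk {i} {l} {m} {s} s≤n w with slacks ≟ 0 where open Walk w
  ... | yes refl = +-cancelʳ-≤ sumʳ m l (≤-trans (≤-reflexive (trans labels (+-identityʳ _))) (+-monoʳ-≤ l (≼-anti bound)))
    where open Walk w
  ... | no ≢0 = +-cancelʳ-≤ sumʳ m l (≤-trans (≤-reflexive (trans labels (+-assoc l sumˡ slacks)))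
      (+-monoʳ-≤ l (≤-trans (+-monoʳ-≤ sumˡ (≤-trans slacks≤ (≤-trans s≤n (n≤1+n n)))) (multiples-gap multˡ multʳ below))))
    where
    open Walk w
    below : sumˡ < sumʳ
    below = ≰⇒> λ le → sharp (n≢0⇒n>0 ≢0) (≼-mono le)

  module BellmanFord (cs : List Constraint) (justified : ∀ {c} → c ∈ cs → Justified c) where

    labelling : ℕ → List (ℕ × ℕ)
    labelling zero    = map (λ j → j , 0) (verts e)
    labelling (suc k) = map (λ j → j , relax (labelling k , j) cs) (verts e)

    label : ℕ → ℕ → ℕ
    label k = at (labelling k)

    rounds-labelling : ∀ c → rounds (cs , verts e) c ≡ labelling (length c)
    rounds-labelling []      = refl
    rounds-labelling (_ ∷ c) rewrite rounds-labelling c = refl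

    label-suc : ∀ k {j} → j < n → label (suc k) j ≡ relax (labelling k , j) cs
    label-suc k j< = at-map (λ j → relax (labelling k , j) cs) (∈-verts j<)

    record Raised (k : ℕ) : Set where
      constructor raise
      field
        vertex   : ℕ
        vertex-< : vertex < n
        raised   : label k vertex < label (suc k) vertex
    open Raised

    top : ∀ {k} → Raised k → ℕ
    top {k} r = label (suc k) (vertex r)

    label-mono : ∀ {k l v} → v < n → k ≤′ l → label k v ≤ label l v
    label-mono v< ≤′-refl        = ≤-refl
    label-mono v< (≤′-step {l} p) = ≤-trans (label-mono v< p)
      (≤-trans (relax-≥ (labelling l) _ cs) (≤-reflexive (sym (label-suc l v<))))

    -- A label that rises is set by some constraint. Had the source of this constraint not risen in
    -- the round before, that round would already have enforced the new value.
    previous : ∀ {k} (r : Raised (suc k)) → Σ (Raised k) λ r′ →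
      ∀ {i l s} → Walk i l (vertex r′) (top r′) s → Walk i l (vertex r) (top r) (suc s)
    previous {k} (raise v v< lt) with relax-attained (labelling (suc k)) v cs
    ... | inj₁ eq = ⊥-elim (<-irrefl (sym (trans (label-suc (suc k) v<) eq)) lt)
    ... | inj₂ (u , a , b , c∈ , eq) = raise u u< up′ , λ w →
          extend ((u , a) , (v , b)) w (justified c∈) refl refl
            -- The subtraction is not truncated, since the new label exceeds the old one and is
            -- therefore positive.
            (trans (cong (_+ b) new) (m∸n+n≡m {m = label (suc k) u + a} {b} (<⇒≤ (m∸n≢0⇒n<m λ z → n≮0 (subst (label (suc k) v <_) (trans new z) lt)))))
      where
      u< = Justified.source-<n (justified c∈)
      new : label (suc (suc k)) v ≡ label (suc k) u + a ∸ b
      new = trans (label-suc (suc k) v<) eq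
      up′ : label k u < label (suc k) u
      up′ = ≰⇒> λ le → <⇒≱ lt (≤-trans (≤-reflexive new) (≤-trans (∸-monoˡ-≤ b (+-monoˡ-≤ a le))
        (subst (label k u + a ∸ b ≤_) (sym (label-suc k v<)) (relax-enforces (labelling k) c∈))))

    history : ∀ {k m} → m ≤′ k → Raised k → Raised m
    history ≤′-refl     r = r
    history (≤′-step p) r = history p (proj₁ (previous r))

    walk-to-top : ∀ {k m} (p : m ≤′ k) (r : Raised k) →
      ∃[ s ] s + m ≡ k × Walk (vertex (history p r)) (top (history p r)) (vertex r) (top r) s
    walk-to-top ≤′-refl         r = 0 , refl , stay
    walk-to-top (≤′-step p) r =
      let (s , eq , w) = walk-to-top p (proj₁ (previous r)) in suc s , cong suc eq , proj₂ (previous r) w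

    walk-between : ∀ {k m l} (p : m ≤′ k) (q : l ≤′ k) → m < l → (r : Raised k) →
      ∃[ s ] s + m ≡ l × Walk (vertex (history p r)) (top (history p r)) (vertex (history q r)) (top (history q r)) s
    walk-between p           ≤′-refl     m<l r = walk-to-top p r
    walk-between (≤′-step p) (≤′-step q) m<l r = walk-between p q m<l (proj₁ (previous r))
    walk-between ≤′-refl     (≤′-step q) m<l r = ⊥-elim (<⇒≱ m<l (≤-trans (≤′⇒≤ q) (n≤1+n _)))

    -- A rise in round `n + 1` has a history of `n + 1` rises in successive rounds. Two of them
    -- concern the same vertex, and the walk between them is closed, has at most `n` steps and ends
    -- with a larger label, against `closed-walk`.
    stable : ¬ Raised n
    stable r = collide (pigeonhole (n<1+n n) f)
      where
      le : (k : Fin (suc n)) → toℕ k ≤′ n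
      le k = ≤⇒≤′ (≤-pred (toℕ<n k))
      f : Fin (suc n) → Fin n
      f k = fromℕ< (vertex-< (history (le k) r))
      collide : ¬ (∃[ a ] ∃[ b ] toℕ a < toℕ b × f a ≡ f b)
      collide (a , b , a<b , eq) with history (le a) r | history (le b) r | fromℕ<-injective _ _ _ _ eq | walk-between (le a) (le b) a<b r
      ... | raise u u< _ | raise .u v< lt | refl | s , s+a , w =
        <⇒≱ lt (≤-trans (closed-walk (≤-trans (m≤m+n s _) (≤-trans (≤-reflexive s+a) (≤′⇒≤ (le b)))) w)
          (label-mono u< (≤⇒≤′ a<b)))

    final-satisfied : (∀ {c} → c ∈ cs → proj₁ (proj₂ c) < n) → T (satisfied (rounds (cs , verts e) (verts e)) cs)
    final-satisfied target< rewrite rounds-labelling (verts e) | #verts =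
      all⁺ cs λ { ((i , a) , (j , b)) c∈ → ≤⇒≤ᵇ {label n i + a} (≮⇒≥ λ lt → stable (raise j (target< c∈)
        (subst (label n j <_) (sym (label-suc n (target< c∈)))
          (<-≤-trans (m+n≤o⇒m≤o∸n (suc (label n j)) lt) (relax-enforces (labelling n) c∈))))) }

-- The solution passes the verification

Unique-avoid : ∀ {A B : Set} (f : A → B) us {v vs} → Unique (map f (us ++ v ∷ vs)) → All (λ u → f u ≢ f v) us
Unique-avoid f []       _        = []
Unique-avoid f (u ∷ us) (h ∷ hs) = All.lookup h (∈-map⁺ f (∈-++⁺ʳ us (here refl))) ∷ Unique-avoid f us hs

-- Distinct targets make a half-edge recognizable by its target. So any cyclic shift can be
-- recovered from the target of its first element alone.
shiftTo-head : ∀ {xs : List HE} {b bs} → Unique (map tgt xs) → CyclicShift xs (b ∷ bs) →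
  shiftTo (λ d → tgt d ≡ᵇ tgt b) xs ≡ b ∷ bs
shiftTo-head {b = b} {bs} uniq (us , [] , refl , refl) =
  trans (shiftTo-split {p = λ d → tgt d ≡ᵇ tgt b} {us = []} [] (≡⇒≡ᵇ (tgt b) (tgt b) refl))
    (trans (++-identityʳ _) (cong (b ∷_) (++-identityʳ bs)))
shiftTo-head {b = b} uniq (us , .b ∷ vs , refl , refl) =
  shiftTo-split (All.map (λ ne h → ne (≡ᵇ⇒≡ _ _ h)) (Unique-avoid tgt us uniq)) (≡⇒≡ᵇ (tgt b) (tgt b) refl)

shift-∈ : ∀ {A : Set} {xs ys : List A} {x} → CyclicShift xs ys → x ∈ ys → x ∈ xs
shift-∈ (us , vs , refl , refl) x∈ with ∈-++⁻ vs x∈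
... | inj₁ h = ∈-++⁺ʳ us h
... | inj₂ h = ∈-++⁺ˡ h

shift-[] : ∀ {A : Set} {xs : List A} → CyclicShift xs [] → xs ≡ []
shift-[] ([] , [] , refl , refl) = refl

∈⇒≢[] : ∀ {A : Set} {x : A} {xs} → x ∈ xs → xs ≢ []
∈⇒≢[] () refl

shift-sym : ∀ {A : Set} {xs ys : List A} → CyclicShift xs ys → CyclicShift ys xs
shift-sym (us , vs , p , q) = vs , us , q , p

AllPairs-with : ∀ {A : Set} {P : A → Set} {R Q : A → A → Set} {xs} →
  (∀ {x y} → P x → P y → R x y → Q x y) → All P xs → AllPairs R xs → AllPairs Q xs
AllPairs-with f []       []       = []
AllPairs-with f (p ∷ ps) (r ∷ rs) = All.zipWith (λ (q , s) → f p q s) (ps , r) ∷ AllPairs-with f ps rs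

sorted⁺ : ∀ {x ds} → AllPairs (λ d d′ → T (precedes x d d′)) ds → T (sorted x ds)
sorted⁺ []       = tt
sorted⁺ (r ∷ rs) = T-∧⁺ (all⁺ _ (λ d d∈ → All.lookup r d∈)) (sorted⁺ rs)

module Success {n : ℕ} {e : ∣ Env ∣} {valid : Valid n e} (realized : Realized n e valid) where
  open Separation valid
  open Realized realized
  open Completeness realized

  Ordered : ℕ → ℕ → Set
  Ordered t m = AllPairs (λ u v → ¬ (v , 0) ≼ (u , 0)) (insOrder e t m)

  sink-ordered : ∃[ t ] t < n × Ordered t root
  sink-ordered with rotationʳ root-<
  ... | d ∷ ts , bs , shift , o ∷ _ , _ = ⊥-elim (T-not⁻ (all⁻ root-sink (shift-∈ shift (here refl))) o)
  ... | [] , bs , shift , _ , _ , ins , pairs with bs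
  -- The sink has no neighbours, so there is nothing to order and any vertex serves as the cut.
  ...   | [] = root , root-< , subst (AllPairs _) (sym empty) []
    where
    empty : insOrder e root root ≡ []
    empty rewrite shift-[] shift = refl
  ...   | b ∷ bs′ = tgt b , target-< (shift-∈ shift (here refl)) , subst (AllPairs _) (cong (map tgt) (sym
            (trans (cong (λ xs → filterᵇ (λ d → not (isOut d)) (shiftTo isOut xs)) (shiftTo-head (simpleᵉ root) shift))
              (trans (cong (filterᵇ (λ d → not (isOut d))) (shiftTo-none ins)) (filterᵇ-all (All.map T-not⁺ ins))))))
            (AllPairsₚ.map⁺ pairs)

  -- The box has an outgoing half-edge, so its incoming ones are listed in the right order for every
  -- choice of `t`.
  ordered : ∀ {t m} → m < n → ¬ Sink e m → Ordered t m
  ordered {t} {m} m< ¬s with rotationʳ m< | arc-elim (parent-arc ¬s)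
  ... | ts , bs , shift , outs , _ , ins , pairs | d , d∈ , o , _ with ts | outs
  ...   | [] | _ = ⊥-elim (All.lookup ins (shift-∈ (shift-sym shift) d∈) o)
  ...   | b ∷ ts′ | outs′ = subst (AllPairs _) (cong (map tgt) (sym
            (filter-shiftTo isOut b ts′ bs (shift-++ (λ d → tgt d ≡ᵇ t) shift) outs′ ins))) (AllPairsₚ.map⁺ pairs)

  module _ (t : ℕ) (t<n : t < n) (t-ordered : Ordered t root) where

    before-left : ∀ {i j} → Before t i j → Sep i j → Left i j
    before-left b = left-of _ anc-a anc-b ≤-refl sibs
      (first⇒related sorted-ins (∈-insOrder t (parent e a) (subst (Arcᵉ e b′) (sym parents) (parent-arc ¬sinkʳ))) differ order)
      where
      open Before b renaming (b to b′)
      open Siblings sibs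
      sorted-ins : Ordered t (parent e a)
      sorted-ins with T-cases (isSink e (parent e a))
      ... | inj₁ s  = subst (Ordered t) (sym (sink-root (parent-< ¬sinkˡ) s)) t-ordered
      ... | inj₂ ¬s = ordered (parent-< ¬sinkˡ) (T-not⁻ ¬s)

    justified : ∀ {c} → c ∈ constraints e t → Justified c × proj₁ (proj₂ c) < n
    justified c∈ with constraints-∈⁻ {t} c∈
    ... | i , j , i< , j< , c∈′ with ∈-cond⁻ (arc e i j) c∈′
    ...   | inj₁ (a , here refl) = record { source-<n = i< ; base = 0 ; slack = 1 ; splits = refl ; slack≤1 = ≤-refl
              ; base-mult = _ ∣0 ; bound-mult = W-multiple j ; holds = ≼-total (proj₂ (overlapʳ a)) ; strict = λ _ → proj₂ (overlapʳ a) } , j<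
    ...   | inj₁ (a , there (here refl)) = record { source-<n = j< ; base = 0 ; slack = 1 ; splits = refl ; slack≤1 = ≤-refl
              ; base-mult = _ ∣0 ; bound-mult = W-multiple i ; holds = ≼-total (proj₁ (overlapʳ a)) ; strict = λ _ → proj₁ (overlapʳ a) } , i<
    ...   | inj₂ (_ , c∈″) with ∈-cond⁻ (separated e i j ∧ before e t i j) c∈″
    ...     | inj₁ (h , here refl) = record { source-<n = i< ; base = W e i ; slack = bit (strictlyMeets e i j) ; splits = refl ; slack≤1 = bit≤1 (strictlyMeets e i j)
              ; base-mult = W-multiple i ; bound-mult = _ ∣0 ; holds = left ; strict = λ p>0 → apartʳ sp (strictlyMeets⁻ (bit-pos _ p>0)) left } , j<
      where
      sp : Sep i j
      sp = separated⁻ i< j< (proj₁ (T-∧⁻ {separated e i j} h))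
      left : Left i j
      left = before-left (before⁻ t i j (proj₂ (T-∧⁻ {separated e i j} h))) sp
      bit≤1 : ∀ b → bit b ≤ 1
      bit≤1 true  = ≤-refl
      bit≤1 false = z≤n
      bit-pos : ∀ b → 1 ≤ bit b → T b
      bit-pos true _ = tt

    x : List (ℕ × ℕ)
    x = solution e t

    x-satisfied : T (satisfied x (constraints e t))
    x-satisfied = BellmanFord.final-satisfied (constraints e t) (λ c∈ → proj₁ (justified c∈)) (λ c∈ → proj₂ (justified c∈))

    open Satisfied {x} t x-satisfied

    -- The solution orders such a pair as the realization does. This transfers the order around each
    -- box and the choice of the rightmost neighbour of the sink.
    x-reflects : ∀ {u v} → Sep u v → ¬ (v , 0) ≼ (u , 0) → at x u < at x v
    x-reflects {u} {v} s nl with sep-before t s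
    ... | inj₂ b = ⊥-elim (nl (≼-trans (≼-mono z≤n) (before-left b (sep-sym s))))
    ... | inj₁ b = <-≤-trans (m<m+n (at x u) (<-≤-trans (W-pos (Sep.i<n s)) (m≤m+n _ _))) (before-separates s b)

    differ-≼ : ∀ {u v} → ¬ (v , 0) ≼ (u , 0) → u ≢ v
    differ-≼ nl refl = nl ≼-refl

    rotation-ok : ∀ {m} → m < n → T (rotationOK e x m)
    rotation-ok {m} m< with rotationʳ m<
    ... | ts , bs , shift , outs , tpairs , ins , bpairs = finish (ts ++ bs) shift all-sorted
      where
      outs∈ : All (λ d → d ∈ rot e m × T (isOut d)) ts
      outs∈ = All.tabulate λ d∈ → shift-∈ shift (∈-++⁺ˡ d∈) , All.lookup outs d∈
      ins∈ : All (λ d → d ∈ rot e m × ¬ T (isOut d)) bs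
      ins∈ = All.tabulate λ d∈ → shift-∈ shift (∈-++⁺ʳ ts d∈) , All.lookup ins d∈
      all-sorted : AllPairs (λ d d′ → T (precedes x d d′)) (ts ++ bs)
      all-sorted = AllPairsₚ.++⁺
        (AllPairs-with (λ (d∈ , o) (d′∈ , o′) nl → subst T (sym (trans (cond-true o) (cond-true o′)))
           (≤⇒≤ᵇ (x-reflects (proj₁ (outs-sep level (arc-intro d′∈ o′) (arc-intro d∈ o) (differ-≼ nl))) nl))) outs∈ tpairs)
        (AllPairs-with (λ (d∈ , i) (d′∈ , i′) nl → subst T (sym (trans (cond-false (T-not⁺ i)) (cond-false (T-not⁺ i′))))
           (≤⇒≤ᵇ (x-reflects (proj₁ (ins-sep level (out-twin d∈ i) (out-twin d′∈ i′) (differ-≼ nl))) nl))) ins∈ bpairs)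
        (All.map (λ o → All.map (λ i → subst T (sym (trans (cond-true o) (cond-false (T-not⁺ i)))) tt) ins) outs)
      finish : ∀ zs → CyclicShift (rot e m) zs → AllPairs (λ d d′ → T (precedes x d d′)) zs → T (rotationOK e x m)
      finish [] sh _ rewrite shift-[] sh = tt
      finish (z ∷ zs) sh srt = T-∨⁺ʳ {sorted x (rot e m)} (any⁺ (shift-∈ sh (here refl))
        (subst (λ ds → T (sorted x ds)) (sym (shiftTo-head (simpleᵉ m) sh)) (sorted⁺ srt)))

    outer-ok : ∀ {m} → m < n → T (outerOK e x m)
    outer-ok {m} m< with T-cases (isSink e m)
    ... | inj₂ ¬s = T-∨⁺ˡ ¬s
    ... | inj₁ s with sink-root m< s
    ...   | refl = T-∨⁺ʳ {not (isSink e root)} (all⁺ (rot e root) λ d d∈ → at-most d d∈ (T-cases (rightmost d)))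
      where
      rightmost : HE → Bool
      rightmost d = all (λ d′ → at x (tgt d′) ≤ᵇ at x (tgt d)) (rot e root)
      is-in : ∀ {d} → d ∈ rot e root → ¬ T (isOut d)
      is-in d∈ = T-not⁻ (all⁻ root-sink d∈)
      at-most : ∀ d → d ∈ rot e root → T (rightmost d) ⊎ T (not (rightmost d)) → T (not (rightmost d) ∨ (fc d ≡ᵇ outerOf e))
      at-most d d∈ (inj₂ ¬m)   = T-∨⁺ˡ ¬m
      at-most d d∈ (inj₁ most) = T-∨⁺ʳ {not (rightmost d)} (≡⇒≡ᵇ _ _ (outerʳ d∈ λ d′ d′∈ → ≼-stable λ nl →
        <⇒≱ (x-reflects (proj₁ (ins-sep level (out-twin d∈ (is-in d∈)) (out-twin d′∈ (is-in d′∈)) (differ-≼ nl))) nl)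
          (≤ᵇ⇒≤ _ _ (all⁻ most d′∈))))

    success : t ∈ verts e × T (verified e t x)
    success = ∈-verts t<n , T-∧⁺ x-satisfied (T-∧⁺
      (all⁺ (verts e) λ i i∈ → all⁺ (verts e) λ j j∈ → arcs i j (T-cases (arc e i j)))
      (T-∧⁺ (all⁺ (verts e) λ i i∈ → rotation-ok (verts-< i∈)) (all⁺ (verts e) λ i i∈ → outer-ok (verts-< i∈))))
      where
      arcs : ∀ i j → T (arc e i j) ⊎ T (not (arc e i j)) → T (not (arc e i j) ∨ (S e i ≡ᵇ S e j + H e i))
      arcs i j (inj₂ ¬a) = T-∨⁺ˡ ¬a
      arcs i j (inj₁ a)  = T-∨⁺ʳ {not (arc e i j)} (≡⇒≡ᵇ _ _ (level a))

  successes-nonempty : successes e ≢ []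
  successes-nonempty = let (t , t<n , ord) = sink-ordered
                           (t∈ , ok) = success t t<n ord in
    ∈⇒≢[] (∈-filterᵇ⁺ {p = λ t → verified e t (solution e t)} t∈ ok)

-- Instances as raw data

module _ {A : Set} where

  index-tabulate : ∀ {n} (g : Fin n → A) → index (tabulate g) ≡ tabulate (λ i → toℕ i , g i)
  index-tabulate {zero}  g = refl
  index-tabulate {suc n} g = cong ((0 , g zero) ∷_)
    (trans (cong (map _) (index-tabulate (λ i → g (suc i)))) (map-tabulate _ _))

  lookupKey-tabulate : ∀ {n} d (k : Fin n → ℕ) (g : Fin n → A) → (∀ {i j} → k i ≡ k j → i ≡ j) →
    ∀ i → lookupKey d (k i) (tabulate (λ i → k i , g i)) ≡ g i
  lookupKey-tabulate d k g inj zero    = cond-true (≡⇒≡ᵇ (k zero) _ refl)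
  lookupKey-tabulate d k g inj (suc i) = trans (cond-false (T-not⁺ λ h → zero≢suc (inj (sym (≡ᵇ⇒≡ _ _ h)))))
    (lookupKey-tabulate d (λ j → k (suc j)) (λ j → g (suc j)) (λ eq → suc-inj (inj eq)) i)
    where
    zero≢suc : ∀ {n} {i : Fin n} → zero ≢ suc i
    zero≢suc ()
    suc-inj : ∀ {n} {i j : Fin n} → Fin.suc i ≡ suc j → i ≡ j
    suc-inj refl = refl

  lookupKey-absent : ∀ {n} d (k : Fin n → ℕ) (g : Fin n → A) l → (∀ i → l ≢ k i) →
    lookupKey d l (tabulate (λ i → k i , g i)) ≡ d
  lookupKey-absent {zero}  d k g l h = refl
  lookupKey-absent {suc n} d k g l h = trans (cond-false (T-not⁺ λ eq → h zero (≡ᵇ⇒≡ _ _ eq)))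
    (lookupKey-absent d (λ j → k (suc j)) (λ j → g (suc j)) l (λ i → h (suc i)))

-- Scaling divides a product by one of its factors. Exchanging that factor and multiplying back by
-- `D i` states this within the naturals.
product-replace : ∀ {n} (s D : Fin n → ℕ) i →
  product (tabulate (λ k → cond (toℕ k ≡ᵇ toℕ i) (s k) (D k))) * D i ≡ s i * product (tabulate D)
product-replace s D zero    = shuffle (s zero) (product (tabulate (λ k → D (suc k)))) (D zero)
  where shuffle : ∀ s p d → s * p * d ≡ s * (d * p)
        shuffle = solve-∀
product-replace s D (suc i) = trans (*-assoc (D zero) _ (D (suc i)))
  (trans (cong (D zero *_) (product-replace (λ k → s (suc k)) (λ k → D (suc k)) i)) (shuffle (D zero) (s (suc i)) (product (tabulate (λ k → D (suc k))))))
  where shuffle : ∀ d s p → d * (s * p) ≡ s * (d * p)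
        shuffle = solve-∀

product-pos : ∀ {n} (D : Fin n → ℕ) → (∀ i → 0 < D i) → 0 < product (tabulate D)
product-pos {zero}  D h = s≤s z≤n
product-pos {suc n} D h = *-mono-≤ (h zero) (product-pos (λ i → D (suc i)) (λ i → h (suc i)))

frac-≃ : ∀ q {a m} → 0ℚᵘ ℚ.< q → a * ↧ₙ q ≡ ℤ.∣ ↥ q ∣ * suc m → q ≃ mkℚᵘ (pos a) m
frac-≃ q {a} {m} (*<* 0<q) eq = *≡* (trans (cong (ℤ._* pos (suc m)) (sym (ℤₚ.0≤i⇒+∣i∣≡i (ℤₚ.<⇒≤ (subst (ℤ.0ℤ ℤ.<_) (ℤₚ.*-identityʳ (↥ q)) 0<q)))))
  (trans (sym (ℤₚ.pos-* ℤ.∣ ↥ q ∣ (suc m))) (trans (cong pos (sym eq)) (ℤₚ.pos-* a (↧ₙ q)))))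

numerator-pos : ∀ q → 0ℚᵘ ℚ.< q → 0 < ℤ.∣ ↥ q ∣
numerator-pos q (*<* 0<q) with ↥ q | subst (ℤ.0ℤ ℤ.<_) (ℤₚ.*-identityʳ (↥ q)) 0<q
... | pos (suc n) | _ = s≤s z≤n
... | pos zero    | ℤ.+<+ ()

isOutᵈ : Direction → Bool
isOutᵈ out = true
isOutᵈ in′ = false

T-isOutᵈ : ∀ {d} → T (isOutᵈ d) → d ≡ out
T-isOutᵈ {out} _ = refl

¬T-isOutᵈ : ∀ {d} → ¬ T (isOutᵈ d) → d ≡ in′
¬T-isOutᵈ {out} h = ⊥-elim (h _)
¬T-isOutᵈ {in′} h = refl

isNonneg : ℤ → Bool
isNonneg (pos _)  = true
isNonneg -[1+ _ ] = false

rawℚ : ℚᵘ → ∣ ℚ̂ ∣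
rawℚ q = (isNonneg (↥ q) , ℤ.∣ ↥ q ∣) , ↧ₙ q

toHE : ∀ {n f} → HalfEdge n f → HE
toHE d = isOutᵈ (direction d) , toℕ (target d) , toℕ (face d)

encodeℤ-raw : ∀ z → encodeℤ z ≡ enc (𝔹 ⊗ ℕ̂) (isNonneg z , ℤ.∣ z ∣)
encodeℤ-raw (pos _)  = refl
encodeℤ-raw -[1+ _ ] = refl

encodeℚ-raw : ∀ q → encodeℚ q ≡ enc ℚ̂ (rawℚ q)
encodeℚ-raw q = cong (λ t → cons t (encodeℕ (↧ₙ q))) (encodeℤ-raw (↥ q))

encodeList-map : ∀ {A : Set} {B : Data} {f : A → Tree} {g : A → ∣ B ∣} → (∀ a → f a ≡ enc B (g a)) →
  ∀ as → encodeList f as ≡ enc (𝕃 B) (map g as)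
encodeList-map eq []       = refl
encodeList-map eq (a ∷ as) = cong₂ cons (eq a) (encodeList-map eq as)

encodeHalfEdge-raw : ∀ {n f} (d : HalfEdge n f) → encodeHalfEdge d ≡ enc ℍ (toHE d)
encodeHalfEdge-raw (halfEdge out t f) = refl
encodeHalfEdge-raw (halfEdge in′ t f) = refl

module FromInstance (I : Instance) where
  open Instance I
  open PlaneDigraph graph

  rawBox : Fin n → ∣ RawBox ∣
  rawBox i = (rawℚ (width i) , rawℚ (height i)) , map toHE (rotation i)

  rawBoxes : List ∣ RawBox ∣
  rawBoxes = map rawBox (allFin n)

  raw : ∣ Raw ∣
  raw = (f , toℕ outerFace) , rawBoxes

  encode-raw : encodeInstance I ≡ enc Raw raw
  encode-raw = cong (cons _) (encodeList-map {B = RawBox} (λ i → cong₂ cons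
    (cong₂ cons (encodeℚ-raw (width i)) (encodeℚ-raw (height i)))
    (encodeList-map {B = ℍ} encodeHalfEdge-raw (rotation i))) (allFin n))

  -- All facts about `env` pass through the equation `env≡`, so the products inside `environment`
  -- are never unfolded.
  abstract
    env : ∣ Env ∣
    env = environment raw

    env≡ : env ≡ environment raw
    env≡ = refl

  rawBoxes≡ : rawBoxes ≡ tabulate rawBox
  rawBoxes≡ = map-tabulate _ rawBox

  entry : Fin n → (ℕ × ℕ) × List HE
  entry i = (scaled wScaled rawBoxes (toℕ i) , scaled hScaled rawBoxes (toℕ i)) , map toHE (rotation i)

  table≡ : proj₂ env ≡ tabulate (λ i → toℕ i , entry i)
  table≡ = trans (cong proj₂ env≡) (trans (cong (λ bs → map F (index bs)) rawBoxes≡)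
    (trans (cong (map F) (index-tabulate rawBox)) (map-tabulate (λ i → toℕ i , rawBox i) F)))
    where
    F : ℕ × ∣ RawBox ∣ → ℕ × (ℕ × ℕ) × List HE
    F (i , b) = i , (scaled wScaled rawBoxes i , scaled hScaled rawBoxes i) , proj₂ b

  outer≡ : outerOf env ≡ toℕ outerFace
  outer≡ = cong outerOf env≡

  box≡ : ∀ i → box env (toℕ i) ≡ entry i
  box≡ i = trans (cong (lookupKey _ (toℕ i)) table≡) (lookupKey-tabulate _ toℕ entry toℕ-injective i)

  rot≡ : ∀ i → rot env (toℕ i) ≡ map toHE (rotation i)
  rot≡ i = cong proj₂ (box≡ i)

  W≡ : ∀ i → W env (toℕ i) ≡ scaled wScaled rawBoxes (toℕ i)
  W≡ i = cong (λ b → proj₁ (proj₁ b)) (box≡ i)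

  H≡ : ∀ i → H env (toℕ i) ≡ scaled hScaled rawBoxes (toℕ i)
  H≡ i = cong (λ b → proj₂ (proj₁ b)) (box≡ i)

  outside : ∀ {k} → ¬ k < n → box env k ≡ ((0 , 0) , [])
  outside {k} k≮n = trans (cong (lookupKey _ k) table≡) (lookupKey-absent _ toℕ entry k λ { i refl → k≮n (toℕ<n i) })

  verts≡ : verts env ≡ tabulate toℕ
  verts≡ = trans (cong (map proj₁) table≡) (map-tabulate (λ i → toℕ i , entry i) proj₁)

  index< : ∀ {k} → k < n → ∃[ i ] toℕ i ≡ k
  index< k<n = fromℕ< k<n , toℕ-fromℕ< k<n

  #boxes : length rawBoxes ≡ n
  #boxes = trans (length-map rawBox (allFin n)) (length-tabulate _)

  unit-1 : ℕ
  unit-1 = pred (unit rawBoxes)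

  unit-pos : 0 < unit rawBoxes
  unit-pos = *-mono-≤ {1} {suc (length rawBoxes)} {1} (s≤s z≤n) (subst (λ ds → 0 < product ds)
    (sym (trans (cong (map dens) rawBoxes≡) (map-tabulate rawBox dens)))
    (product-pos (λ i → dens (rawBox i)) λ i → s≤s z≤n))

  unit≡ : suc unit-1 ≡ unit rawBoxes
  unit≡ = suc-pred (unit rawBoxes) {{>-nonZero unit-pos}}

  scaled-value : ∀ s i → scaled s rawBoxes (toℕ i) * dens (rawBox i) ≡ s (rawBox i) * unit rawBoxes
  scaled-value s i = trans (cong (λ ps → N * product ps * D i) factors)
    (trans (*-assoc N (product (tabulate (λ k → cond (toℕ k ≡ᵇ toℕ i) (s (rawBox k)) (D k)))) (D i)) (trans (cong (N *_) (product-replace (λ k → s (rawBox k)) D i))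
      (trans (cong (λ ps → N * (s (rawBox i) * product ps)) (sym (trans (cong (map dens) rawBoxes≡) (map-tabulate rawBox dens))))
        (shuffle N (s (rawBox i)) (product (map dens rawBoxes))))))
    where
    N : ℕ
    N = suc (length rawBoxes)
    D : Fin n → ℕ
    D k = dens (rawBox k)
    factors : map (λ (k , b) → cond (k ≡ᵇ toℕ i) (s b) (dens b)) (index rawBoxes) ≡
              tabulate (λ k → cond (toℕ k ≡ᵇ toℕ i) (s (rawBox k)) (D k))
    factors = trans (cong (λ bs → map G (index bs)) rawBoxes≡)
      (trans (cong (map G) (index-tabulate rawBox)) (map-tabulate (λ k → toℕ k , rawBox k) G))
      where
      G : ℕ × ∣ RawBox ∣ → ℕ
      G (k , b) = cond (k ≡ᵇ toℕ i) (s b) (dens b)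
    shuffle : ∀ N s p → N * (s * p) ≡ s * (N * p)
    shuffle = solve-∀

  W-value : ∀ i → W env (toℕ i) * ↧ₙ width i ≡ ℤ.∣ ↥ width i ∣ * suc unit-1
  W-value i = *-cancelʳ-≡ _ _ (↧ₙ height i) (trans (*-assoc (W env (toℕ i)) (↧ₙ width i) (↧ₙ height i))
    (trans (cong (_* dens (rawBox i)) (W≡ i)) (trans (scaled-value wScaled i) (trans (cong (wScaled (rawBox i) *_) (sym unit≡))
      (shuffle ℤ.∣ ↥ width i ∣ (↧ₙ height i) (suc unit-1))))))
    where shuffle : ∀ a h m → a * h * m ≡ a * m * h
          shuffle = solve-∀

  H-value : ∀ i → H env (toℕ i) * ↧ₙ height i ≡ ℤ.∣ ↥ height i ∣ * suc unit-1
  H-value i = *-cancelʳ-≡ _ _ (↧ₙ width i) (trans (shuffle′ (H env (toℕ i)) (↧ₙ height i) (↧ₙ width i))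
    (trans (cong (_* dens (rawBox i)) (H≡ i)) (trans (scaled-value hScaled i) (trans (cong (hScaled (rawBox i) *_) (sym unit≡))
      (shuffle ℤ.∣ ↥ height i ∣ (↧ₙ width i) (suc unit-1))))))
    where shuffle : ∀ a h m → a * h * m ≡ a * m * h
          shuffle = solve-∀
          shuffle′ : ∀ a h w → a * h * w ≡ a * (w * h)
          shuffle′ = solve-∀

  width≃ : ∀ i → width i ≃ mkℚᵘ (pos (W env (toℕ i))) unit-1
  width≃ i = frac-≃ (width i) (width>0 i) (W-value i)

  height≃ : ∀ i → height i ≃ mkℚᵘ (pos (H env (toℕ i))) unit-1
  height≃ i = frac-≃ (height i) (height>0 i) (H-value i)

  positive : ∀ {a d m} q → 0ℚᵘ ℚ.< q → a * d ≡ ℤ.∣ ↥ q ∣ * suc m → 0 < a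
  positive {zero} {m = m} q 0<q eq = ⊥-elim (<-irrefl eq (*-mono-≤ (numerator-pos q 0<q) (s≤s {0} {m} z≤n)))
  positive {suc a} q 0<q eq = s≤s z≤n

  ∈-rot⁻ : ∀ {i d} → d ∈ rot env (toℕ i) → ∃[ d′ ] d′ ∈ rotation i × d ≡ toHE d′
  ∈-rot⁻ {i} d∈ = ∈-map⁻ toHE (subst (_ ∈_) (rot≡ i) d∈)

  ∈-rot⁺ : ∀ {i d} → d ∈ rotation i → toHE d ∈ rot env (toℕ i)
  ∈-rot⁺ {i} d∈ = subst (_ ∈_) (sym (rot≡ i)) (∈-map⁺ toHE d∈)

  source< : ∀ {k d} → d ∈ rot env k → k < n
  source< {k} d∈ with k <? n
  ... | yes k<n = k<n
  ... | no  k≮n with subst (_ ∈_) (cong proj₂ (outside k≮n)) d∈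
  ...   | ()

  arc⁺ : ∀ {i j} → Arc i j → Arcᵉ env (toℕ i) (toℕ j)
  arc⁺ (d , d∈ , refl , refl) = any⁺ (∈-rot⁺ d∈) (T-∧⁺ _ (≡⇒≡ᵇ (toℕ (target d)) _ refl))

  arc⁻ : ∀ {i j} → Arcᵉ env (toℕ i) (toℕ j) → Arc i j
  arc⁻ {i} {j} a with any⁻ (rot env (toℕ i)) a
  ... | d , d∈ , h with ∈-rot⁻ {i} d∈
  ...   | d′ , d′∈ , refl = let (o , eq) = T-∧⁻ h in d′ , d′∈ , T-isOutᵈ o , toℕ-injective (≡ᵇ⇒≡ _ _ eq)

  arc-source : ∀ {k l} → Arcᵉ env k l → k < n
  arc-source {k} a = source< (proj₁ (proj₂ (any⁻ (rot env k) a)))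

  arc-target : ∀ {k l} → Arcᵉ env k l → l < n
  arc-target {k} {l} a with index< (arc-source a)
  ... | i , refl with any⁻ (rot env (toℕ i)) a
  ...   | d , d∈ , h with ∈-rot⁻ {i} d∈
  ...     | d′ , _ , refl = subst (_< n) (≡ᵇ⇒≡ _ _ (proj₂ (T-∧⁻ {isOutᵈ (direction d′)} h))) (toℕ<n (target d′))

  closure⁻ : ∀ {k l i j} → toℕ i ≡ k → toℕ j ≡ l → TransClosure (Arcᵉ env) k l → TransClosure Arc i j
  closure⁻ refl refl [ a ]   = [ arc⁻ a ]
  closure⁻ refl refl (a ∷ p) with index< (arc-target a)
  ... | m , refl = arc⁻ a ∷ closure⁻ refl refl p

  sink⁺ : ∀ {i} → IsSink i → Sink env (toℕ i)
  sink⁺ {i} s = all⁺ (rot env (toℕ i)) λ d d∈ → let (d′ , d′∈ , eq) = ∈-rot⁻ {i} d∈ in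
    subst (λ d → T (not (isOut d))) (sym eq) (T-not⁺ λ o → s (target d′) (d′ , d′∈ , T-isOutᵈ o , refl))

  sink⁻ : ∀ {i} → Sink env (toℕ i) → IsSink i
  sink⁻ s j (d , d∈ , refl , refl) = T-not⁻ (all⁻ s (∈-rot⁺ d∈)) _

  valid : Valid n env
  valid = record
    { ∈-verts    = λ i<n → let (j , eq) = index< i<n in subst₂ _∈_ eq (sym verts≡) (∈-tabulate⁺ {f = toℕ} j)
    ; verts-<    = λ i∈ → let (j , eq) = ∈-tabulate⁻ {f = toℕ} (subst (_ ∈_) verts≡ i∈) in subst (_< n) (sym eq) (toℕ<n j)
    ; #verts     = trans (cong length verts≡) (length-tabulate toℕ)
    ; source-<   = source<
    ; target-<   = target<
    ; simpleᵉ    = simple′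
    ; in-twin    = in-twin′
    ; out-twin   = out-twin′
    ; acyclicᵉ   = λ k p → let (i , eq) = index< (start< p) in acyclic i (closure⁻ eq eq p)
    ; root       = toℕ (proj₁ oneSink)
    ; root-<     = toℕ<n _
    ; root-sink  = sink⁺ (proj₁ (proj₂ oneSink))
    ; sink-root  = sink-root′
    ; W-pos      = λ i<n → let (j , eq) = index< i<n in subst (λ k → 0 < W env k) eq (positive {d = ↧ₙ width j} (width j) (width>0 j) (W-value j))
    ; H-pos      = λ i<n → let (j , eq) = index< i<n in subst (λ k → 0 < H env k) eq (positive {d = ↧ₙ height j} (height j) (height>0 j) (H-value j))
    ; W-multiple = W-multiple′
    }
    where
    target< : ∀ {k d} → d ∈ rot env k → tgt d < n
    target< d∈ with index< (source< d∈)
    ... | i , refl with ∈-rot⁻ {i} d∈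
    ...   | d′ , _ , refl = toℕ<n (target d′)
    simple′ : ∀ k → Unique (map tgt (rot env k))
    simple′ k with k <? n
    ... | no k≮n = subst (λ b → Unique (map tgt (proj₂ b))) (sym (outside k≮n)) []
    ... | yes k<n with index< k<n
    ...   | i , refl = subst Unique (sym (trans (cong (map tgt) (rot≡ i)) (trans (sym (map-∘ (rotation i))) (map-∘ (rotation i)))))
            (Uniqueₚ.map⁺ toℕ-injective (simple i))
    in-twin′ : ∀ {k l} → Arcᵉ env k l → ∃[ d ] d ∈ rot env l × ¬ T (isOut d) × tgt d ≡ k
    in-twin′ a with index< (arc-source a) | index< (arc-target a)
    ... | i , refl | j , refl with to (twins i j) (arc⁻ a)
    ...   | d , d∈ , refl , refl = toHE d , ∈-rot⁺ d∈ , (λ ()) , refl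
    out-twin′ : ∀ {l d} → d ∈ rot env l → ¬ T (isOut d) → Arcᵉ env (tgt d) l
    out-twin′ d∈ ¬o with index< (source< d∈)
    ... | j , refl with ∈-rot⁻ {j} d∈
    ...   | d′ , d′∈ , refl = arc⁺ (from (twins (target d′) j) (d′ , d′∈ , ¬T-isOutᵈ ¬o , refl))
    start< : ∀ {k l} → TransClosure (Arcᵉ env) k l → k < n
    start< [ a ]   = arc-source a
    start< (a ∷ _) = arc-source a
    sink-root′ : ∀ {k} → k < n → Sink env k → k ≡ toℕ (proj₁ oneSink)
    sink-root′ k<n s with index< k<n
    ... | i , refl = cong toℕ (sym (proj₂ (proj₂ oneSink) (sink⁻ s)))
    W-multiple′ : ∀ k → suc n ∣ W env k
    W-multiple′ k with k <? n
    ... | no k≮n = subst (λ b → suc n ∣ proj₁ (proj₁ b)) (sym (outside k≮n)) (_ ∣0)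
    ... | yes k<n with index< k<n
    ...   | i , refl = subst (suc n ∣_) (sym (W≡ i)) (subst (λ m → suc m ∣ scaled wScaled rawBoxes (toℕ i)) #boxes (m∣m*n _))

-- From a realization to an order of points

⊕-cancel : ∀ {x y} p → x ⊕ p ≤ᴿ y ⊕ p → x ≤ᴿ y
⊕-cancel {x} {y} p h q Lq = L-≃ y (ℚₚ.≃-sym (q+p-p q p)) (h (q ℚ.+ p) (L-≃ x (q+p-p q p) Lq))

module Points {n : ℕ} (m : ℕ) (g : Fin n → ℝ) where

  -- Numbers that are no vertex get an arbitrary position, so that points are indexed by naturals as
  -- in the environment.
  extend : ℕ → ℝ
  extend k with k <? n
  ... | yes k<n = g (fromℕ< k<n)
  ... | no  _   = fromℚ 0ℚᵘ

  extend-toℕ : ∀ i → extend (toℕ i) ≡ g i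
  extend-toℕ i with toℕ i <? n
  ... | yes i<n = cong g (fromℕ<-toℕ i i<n)
  ... | no  i≮n = ⊥-elim (i≮n (toℕ<n i))

  fr : ℕ → ℚᵘ
  fr a = mkℚᵘ (pos a) m

  point : ℕ × ℕ → ℝ
  point (k , a) = extend k ⊕ fr a

  infix 4 _≼_
  _≼_ : ℕ × ℕ → ℕ × ℕ → Set
  p ≼ q = point p ≤ᴿ point q

  fr-+ : ∀ a c → fr (a + c) ≃ fr a ℚ.+ fr c
  fr-+ a c = ℚₚ.≃-sym (frac-+ m (pos a) (pos c))

  split-≤ : ∀ z a c → z ⊕ fr (a + c) ≤ᴿ (z ⊕ fr a) ⊕ fr c
  split-≤ z a c = ≤ᴿ-trans {z ⊕ fr (a + c)} {z ⊕ (fr a ℚ.+ fr c)} {(z ⊕ fr a) ⊕ fr c}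
    (⊕-monoʳ z (ℚₚ.≤-reflexive (fr-+ a c))) (⊕-assoc-≥ z (fr a) (fr c))

  split-≥ : ∀ z a c → (z ⊕ fr a) ⊕ fr c ≤ᴿ z ⊕ fr (a + c)
  split-≥ z a c = ≤ᴿ-trans {(z ⊕ fr a) ⊕ fr c} {z ⊕ (fr a ℚ.+ fr c)} {z ⊕ fr (a + c)}
    (⊕-assoc-≤ z (fr a) (fr c)) (⊕-monoʳ z (ℚₚ.≤-reflexive (ℚₚ.≃-sym (fr-+ a c))))

  shift : ∀ {i a j b} c → (i , a) ≼ (j , b) → (i , a + c) ≼ (j , b + c)
  shift {i} {a} {j} {b} c h = ≤ᴿ-trans {point (i , a + c)} {point (i , a) ⊕ fr c} {point (j , b + c)} (split-≤ (extend i) a c)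
    (≤ᴿ-trans {point (i , a) ⊕ fr c} {point (j , b) ⊕ fr c} {point (j , b + c)} (⊕-mono {point (i , a)} {point (j , b)} (fr c) h) (split-≥ (extend j) b c))

  unshift : ∀ {i a j b} c → (i , a + c) ≼ (j , b + c) → (i , a) ≼ (j , b)
  unshift {i} {a} {j} {b} c h = ⊕-cancel {point (i , a)} {point (j , b)} (fr c)
    (≤ᴿ-trans {point (i , a) ⊕ fr c} {point (i , a + c)} {point (j , b) ⊕ fr c} (split-≥ (extend i) a c)
      (≤ᴿ-trans {point (i , a + c)} {point (j , b + c)} {point (j , b) ⊕ fr c} h (split-≤ (extend j) b c)))

  mono : ∀ {i a b} → a ≤ b → (i , a) ≼ (i , b)
  mono {i} a≤b = ⊕-monoʳ (extend i) (frac-mono-≤ m (+≤+ a≤b))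

  anti : ∀ {i a b} → (i , a) ≼ (i , b) → a ≤ b
  anti {i} h = ℤₚ.drop‿+≤+ (frac-cancel-≤ m (shift-cancel (extend i) h))

  at-0-≤ : ∀ i → g i ≤ᴿ point (toℕ i , 0)
  at-0-≤ i rewrite extend-toℕ i = λ q → L-≃ (g i) (ℚₚ.≃-trans (ℚₚ.+-congʳ q (*≡* refl)) (ℚₚ.+-identityʳ q))

  at-0-≥ : ∀ i → point (toℕ i , 0) ≤ᴿ g i
  at-0-≥ i rewrite extend-toℕ i = λ q → L-≃ (g i) (ℚₚ.≃-sym (ℚₚ.≃-trans (ℚₚ.+-congʳ q (*≡* refl)) (ℚₚ.+-identityʳ q)))

  module _ {i : Fin n} {p : ℚᵘ} {a : ℕ} (p≃ : p ≃ fr a) where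

    at-≤ : g i ⊕ p ≤ᴿ point (toℕ i , a)
    at-≤ rewrite extend-toℕ i = ⊕-monoʳ (g i) (ℚₚ.≤-reflexive p≃)

    at-≥ : point (toℕ i , a) ≤ᴿ g i ⊕ p
    at-≥ rewrite extend-toℕ i = ⊕-monoʳ (g i) (ℚₚ.≤-reflexive (ℚₚ.≃-sym p≃))

    end≤start⁺ : ∀ {j} → g i ⊕ p ≤ᴿ g j → (toℕ i , a) ≼ (toℕ j , 0)
    end≤start⁺ {j} h = ≤ᴿ-trans {point (toℕ i , a)} {g i ⊕ p} {point (toℕ j , 0)} at-≥ (≤ᴿ-trans {g i ⊕ p} {g j} {point (toℕ j , 0)} h (at-0-≤ j))

    end≤start⁻ : ∀ {j} → (toℕ i , a) ≼ (toℕ j , 0) → g i ⊕ p ≤ᴿ g j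
    end≤start⁻ {j} h = ≤ᴿ-trans {g i ⊕ p} {point (toℕ i , a)} {g j} at-≤ (≤ᴿ-trans {point (toℕ i , a)} {point (toℕ j , 0)} {g j} h (at-0-≥ j))

    start≤end⁺ : ∀ {j} → g j ≤ᴿ g i ⊕ p → (toℕ j , 0) ≼ (toℕ i , a)
    start≤end⁺ {j} h = ≤ᴿ-trans {point (toℕ j , 0)} {g j} {point (toℕ i , a)} (at-0-≥ j) (≤ᴿ-trans {g j} {g i ⊕ p} {point (toℕ i , a)} h at-≤)

    start≤end⁻ : ∀ {j} → (toℕ j , 0) ≼ (toℕ i , a) → g j ≤ᴿ g i ⊕ p
    start≤end⁻ {j} h = ≤ᴿ-trans {g j} {point (toℕ j , 0)} {g i ⊕ p} (at-0-≤ j) (≤ᴿ-trans {point (toℕ j , 0)} {point (toℕ i , a)} {g i ⊕ p} h at-≥)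

  starts⁻ : ∀ {i j} → (toℕ i , 0) ≼ (toℕ j , 0) → g i ≤ᴿ g j
  starts⁻ {i} {j} h = ≤ᴿ-trans {g i} {point (toℕ i , 0)} {g j} (at-0-≤ i) (≤ᴿ-trans {point (toℕ i , 0)} {point (toℕ j , 0)} {g j} h (at-0-≥ j))

module FromRealization (I : Instance) (x y : Fin (Instance.n I) → ℝ) (realizes : HierarchicallyRealizes I x y) where
  open Instance I
  open PlaneDigraph graph
  open FromInstance I
  open Separation valid
  open HierarchicallyRealizes realizes
  open Placement I x y using (Touch; TopTouches; RightTouches)
  module X = Points unit-1 x
  module Y = Points unit-1 y

  arc-heights : ∀ {k l} → Arcᵉ env k l → (k , H env k) Y.≼ (l , 0) × (l , 0) Y.≼ (k , H env k)
  arc-heights a with index< (arc-source a) | index< (arc-target a)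
  ... | i , refl | j , refl = let ((le , ge) , _) = hierarchy i j (arc⁻ a) in
    Y.end≤start⁺ (height≃ i) le , Y.start≤end⁺ (height≃ i) ge

  -- Contacts determine each height from that of the parent. Along the path to the sink it follows
  -- that the point `S env k` above the bottom of box `k` is at the height of the top of the sink,
  -- for every `k`.
  same-level : ∀ {d k} → k < n → Depth d k → (k , S env k) Y.≼ (root , S env root) × (root , S env root) Y.≼ (k , S env k)
  same-level k<n (sink s) rewrite sink-root k<n s = Y.mono ≤-refl , Y.mono ≤-refl
  same-level {k = k} k<n (step ¬s d) =
    let (le , ge) = arc-heights (parent-arc ¬s)
        (le′ , ge′) = same-level (parent-< ¬s) d
        eq = trans (+-comm (H env k) (S env (parent env k))) (sym (S-step k<n ¬s)) in
    ≤ᴿ-trans {Y.point (k , S env k)} {Y.point (parent env k , S env (parent env k))} {Y.point (root , S env root)}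
      (subst (λ s → (k , s) Y.≼ (parent env k , S env (parent env k))) eq (Y.shift (S env (parent env k)) le)) le′ ,
    ≤ᴿ-trans {Y.point (root , S env root)} {Y.point (parent env k , S env (parent env k))} {Y.point (k , S env k)}
      ge′ (subst (λ s → (parent env k , S env (parent env k)) Y.≼ (k , s)) eq (Y.shift (S env (parent env k)) ge))

  levels : ∀ {k l} → k < n → l < n → (k , S env k) Y.≼ (l , S env l)
  levels {k} {l} k<n l<n = ≤ᴿ-trans {Y.point (k , S env k)} {Y.point (root , S env root)} {Y.point (l , S env l)}
    (proj₁ (same-level k<n (depth k<n))) (proj₂ (same-level l<n (depth l<n)))

  -- By `levels` the real heights differ by known integers. Vertical comparisons thus become
  -- comparisons of naturals and, unlike horizontal ones, are decidable.
  Y-≤ : ∀ {k l a b} → k < n → l < n → a + S env l ≤ b + S env k → (k , a) Y.≼ (l , b)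
  Y-≤ {k} {l} {a} {b} k<n l<n h = Y.unshift (S env l) (≤ᴿ-trans {Y.point (k , a + S env l)} {Y.point (k , b + S env k)} {Y.point (l , b + S env l)}
    (Y.mono h) (subst₂ (λ s t → (k , s) Y.≼ (l , t)) (+-comm (S env k) b) (+-comm (S env l) b) (Y.shift b (levels k<n l<n))))

  Y-≤⁻ : ∀ {k l a b} → k < n → l < n → (k , a) Y.≼ (l , b) → a + S env l ≤ b + S env k
  Y-≤⁻ {k} {l} {a} {b} k<n l<n h = Y.anti (≤ᴿ-trans {Y.point (k , a + S env l)} {Y.point (l , b + S env l)} {Y.point (k , b + S env k)}
    (Y.shift (S env l) h) (subst₂ (λ s t → (l , s) Y.≼ (k , t)) (+-comm (S env l) b) (+-comm (S env k) b) (Y.shift b (levels l<n k<n))))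

  level′ : Levelled env
  level′ {k} {l} a = let (le , ge) = arc-heights a in
    trans (≤-antisym (Y-≤⁻ (arc-target a) (arc-source a) ge) (Y-≤⁻ (arc-source a) (arc-target a) le)) (+-comm (H env k) (S env l))

  ¬≤⇒¬¬< : ∀ {u v} → ¬ v ≤ᴿ u → ¬ ¬ u <ᴿ v
  ¬≤⇒¬¬< {u} {v} h k = h (¬<ᴿ⇒≥ {u} {v} k)

  y-below : ∀ i j → S env (toℕ j) < S env (toℕ i) + H env (toℕ j) → ¬ ¬ y i <ᴿ y j ⊕ height j
  y-below i j lt = ¬≤⇒¬¬< {y i} {y j ⊕ height j} λ h → <⇒≱ lt (≤-trans (≤-reflexive (+-comm (S env (toℕ i)) _))
    (Y-≤⁻ (toℕ<n j) (toℕ<n i) (Y.end≤start⁺ (height≃ j) h)))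

  y-common : ∀ i j → StrictlyMeets (toℕ i) (toℕ j) → ¬ ¬ (∃[ b ] b ∈⟨ y i , height i ⟩ × b ∈⟨ y j , height j ⟩)
  y-common i j (lt , gt) k = y-below i j lt λ ij → y-below j i gt λ ji → <⊕ (y i) (height>0 i) λ ii → <⊕ (y j) (height>0 j) λ jj →
    k (common-point {y i} {y j} ii jj ij ji)

  x-common : ∀ i j → ¬ (toℕ i , W env (toℕ i)) X.≼ (toℕ j , 0) → ¬ (toℕ j , W env (toℕ j)) X.≼ (toℕ i , 0) →
    ¬ ¬ (∃[ a ] a ∈⟨ x i , width i ⟩ × a ∈⟨ x j , width j ⟩)
  x-common i j nij nji k =
    ¬≤⇒¬¬< {x i} {x j ⊕ width j} (λ h → nji (X.end≤start⁺ (width≃ j) h)) λ ij →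
    ¬≤⇒¬¬< {x j} {x i ⊕ width i} (λ h → nij (X.end≤start⁺ (width≃ i) h)) λ ji →
    <⊕ (x i) (width>0 i) λ ii → <⊕ (x j) (width>0 j) λ jj → k (common-point {x i} {x j} ii jj ij ji)

  ¬touch : ∀ {i j} → Sep (toℕ i) (toℕ j) → ¬ Touch i j
  ¬touch {i} {j} s t with to (contactGraph i j) t
  ... | inj₁ a = Sep.¬ij s (arc⁺ a)
  ... | inj₂ a = Sep.¬ji s (arc⁺ a)

  level-top : ∀ i j → S env (toℕ i) ≡ S env (toℕ j) + H env (toℕ i) → y i ⊕ height i ≈ᴿ y j
  level-top i j eq =
    Y.end≤start⁻ (height≃ i) (Y-≤ (toℕ<n i) (toℕ<n j) (≤-reflexive (trans (+-comm (H env (toℕ i)) _) (sym eq)))) ,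
    Y.start≤end⁻ (height≃ i) (Y-≤ (toℕ<n j) (toℕ<n i) (≤-reflexive (trans eq (+-comm _ (H env (toℕ i))))))

  -- Without a separation to either side the boxes overlap horizontally. If their heights overlap
  -- properly, the interiors intersect; if the heights only touch, there is a horizontal contact,
  -- which the contact graph excludes.
  disjoint′ : ∀ i j → Sep (toℕ i) (toℕ j) → ¬ (¬ (toℕ i , W env (toℕ i)) X.≼ (toℕ j , 0) × ¬ (toℕ j , W env (toℕ j)) X.≼ (toℕ i , 0))
  disjoint′ i j s (nij , nji) = x-common i j nij nji λ (a , ai , aj) →
    split a ai aj (m≤n⇒m<n∨m≡n (proj₁ (Sep.mts s))) (m≤n⇒m<n∨m≡n (proj₂ (Sep.mts s)))
    where
    split : ∀ a → a ∈⟨ x i , width i ⟩ → a ∈⟨ x j , width j ⟩ → _ → _ → ⊥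
    split a ai aj (inj₁ lt) (inj₁ gt) = y-common i j (lt , gt) λ (b , bi , bj) →
      disjointInteriors i j (λ eq → Sep.i≢j s (cong toℕ eq)) ((a , b) , (ai , bi) , (aj , bj))
    split a ai aj (inj₂ eq) _         = ¬touch s (inj₁ (inj₂ (level-top j i eq , a , aj , ai)))
    split a ai aj (inj₁ _)  (inj₂ eq) = ¬touch s (inj₁ (inj₁ (level-top i j eq , a , ai , aj)))

  -- Coinciding vertical sides at properly overlapping heights would be a contact, and nonadjacent
  -- boxes have none.
  apart′ : ∀ i j → Sep (toℕ i) (toℕ j) → StrictlyMeets (toℕ i) (toℕ j) → (toℕ i , W env (toℕ i)) X.≼ (toℕ j , 0) →
    ¬ (toℕ j , 0) X.≼ (toℕ i , W env (toℕ i))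
  apart′ i j s st le ge = y-common i j st λ b →
    ¬touch s (inj₂ (inj₁ ((X.end≤start⁻ (width≃ i) le , X.start≤end⁻ (width≃ i) ge) , b)))

  overlap′ : ∀ i j → Arc i j → ¬ (toℕ i , W env (toℕ i)) X.≼ (toℕ j , 0) × ¬ (toℕ j , W env (toℕ j)) X.≼ (toℕ i , 0)
  overlap′ i j a with hierarchy i j a
  ... | _ , c , (xi<c , c<xi) , (xj<c , c<xj) =
    (λ h → <ᴿ⇒¬≥ {x j} {x i ⊕ width i} (<ᴿ-trans {x j} {c} {x i ⊕ width i} xj<c c<xi) (X.end≤start⁻ (width≃ i) h)) ,
    (λ h → <ᴿ⇒¬≥ {x i} {x j ⊕ width j} (<ᴿ-trans {x i} {c} {x j ⊕ width j} xi<c c<xj) (X.end≤start⁻ (width≃ j) h))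

  realized : Realized n env valid
  realized = record
    { _≼_       = X._≼_
    ; ≼-trans   = λ {p} {q} {r} → ≤ᴿ-trans {X.point p} {X.point q} {X.point r}
    ; ≼-total   = λ {p} {q} → ≤ᴿ-total {X.point p} {X.point q}
    ; ≼-stable  = λ {p} {q} → ≤ᴿ-stable {X.point p} {X.point q}
    ; ≼-shift   = X.shift
    ; ≼-unshift = X.unshift
    ; ≼-mono    = X.mono
    ; ≼-anti    = X.anti
    ; level     = level′
    ; overlapʳ  = overlap″
    ; disjointʳ = disjoint″
    ; apartʳ    = apart″
    ; rotationʳ = rotation″
    ; outerʳ    = outer″
    }
    where
    overlap″ : ∀ {k l} → Arcᵉ env k l → ¬ (k , W env k) X.≼ (l , 0) × ¬ (l , W env l) X.≼ (k , 0)
    overlap″ a with index< (arc-source a) | index< (arc-target a)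
    ... | i , refl | j , refl = overlap′ i j (arc⁻ a)
    disjoint″ : ∀ {k l} → Sep k l → ¬ (¬ (k , W env k) X.≼ (l , 0) × ¬ (l , W env l) X.≼ (k , 0))
    disjoint″ s with index< (Sep.i<n s) | index< (Sep.j<n s)
    ... | i , refl | j , refl = disjoint′ i j s
    apart″ : ∀ {k l} → Sep k l → StrictlyMeets k l → (k , W env k) X.≼ (l , 0) → ¬ (l , 0) X.≼ (k , W env k)
    apart″ s with index< (Sep.i<n s) | index< (Sep.j<n s)
    ... | i , refl | j , refl = apart′ i j s
    left⁺ : ∀ {d d′ : HalfEdge n f} → x (target d) <ᴿ x (target d′) → ¬ (toℕ (target d′) , 0) X.≼ (toℕ (target d) , 0)
    left⁺ {d} {d′} lt h = <ᴿ⇒¬≥ {x (target d)} {x (target d′)} lt (X.starts⁻ h)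
    rotation″ : ∀ {k} → k < n → ∃[ ts ] ∃[ bs ] CyclicShift (rot env k) (ts ++ bs) ×
      All (λ d → T (isOut d)) ts × AllPairs (λ d d′ → ¬ (tgt d , 0) X.≼ (tgt d′ , 0)) ts ×
      All (λ d → ¬ T (isOut d)) bs × AllPairs (λ d d′ → ¬ (tgt d′ , 0) X.≼ (tgt d , 0)) bs
    rotation″ k<n with index< k<n
    ... | i , refl with embedding i
    ...   | ts , bs , (us , vs , req , eq) , outs , tpairs , ins , bpairs =
      map toHE ts , map toHE bs ,
      (map toHE us , map toHE vs , trans (rot≡ i) (trans (cong (map toHE) req) (map-++ toHE us vs)) ,
        trans (sym (map-++ toHE ts bs)) (trans (cong (map toHE) eq) (map-++ toHE vs us))) ,
      Allₚ.map⁺ (All.map (λ { {halfEdge out _ _} refl → _ }) outs) ,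
      AllPairsₚ.map⁺ (AllPairs.map (λ {d} {d′} lt → left⁺ {d′} {d} lt) tpairs) ,
      Allₚ.map⁺ (All.map (λ { {halfEdge in′ _ _} refl () }) ins) ,
      AllPairsₚ.map⁺ (AllPairs.map (λ {d} {d′} lt → left⁺ {d} {d′} lt) bpairs)
    outer″ : ∀ {d} → d ∈ rot env root → (∀ d′ → d′ ∈ rot env root → (tgt d′ , 0) X.≼ (tgt d , 0)) → fc d ≡ outerOf env
    outer″ d∈ h with ∈-rot⁻ {proj₁ oneSink} d∈
    ... | d , d∈′ , refl = trans (cong toℕ (outer (proj₁ oneSink) (proj₁ (proj₂ oneSink)) d d∈′ λ d′ d′∈ →
      X.starts⁻ (h (toHE d′) (∈-rot⁺ d′∈)))) (sym outer≡)

-- Soundness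

-- Both axes are instances: all coordinates are integers over the common denominator, so comparisons
-- of the corresponding reals reduce to integers.
module Coordinates {n : ℕ} (m : ℕ) (z : Fin n → ℤ) (len : Fin n → ℚᵘ) (L : Fin n → ℕ)
  (len≃ : ∀ i → len i ≃ mkℚᵘ (pos (L i)) m) (len>0 : ∀ i → 0ℚᵘ ℚ.< len i) where

  g : Fin n → ℝ
  g i = fromℚ (mkℚᵘ (z i) m)

  end : Fin n → ℚᵘ
  end i = mkℚᵘ (z i ℤ.+ pos (L i)) m

  end≃ : ∀ i → mkℚᵘ (z i) m ℚ.+ len i ≃ end i
  end≃ i = ℚₚ.≃-trans (ℚₚ.+-congʳ (mkℚᵘ (z i) m) (len≃ i)) (frac-+ m (z i) (pos (L i)))

  end-≤ : ∀ i → g i ⊕ len i ≤ᴿ fromℚ (end i)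
  end-≤ i = ≤ᴿ-trans {g i ⊕ len i} {fromℚ (mkℚᵘ (z i) m ℚ.+ len i)} {fromℚ (end i)}
    (fromℚ-⊕-≤ (mkℚᵘ (z i) m) (len i)) (fromℚ-mono-≤ (ℚₚ.≤-reflexive (end≃ i)))

  end-≥ : ∀ i → fromℚ (end i) ≤ᴿ g i ⊕ len i
  end-≥ i = ≤ᴿ-trans {fromℚ (end i)} {fromℚ (mkℚᵘ (z i) m ℚ.+ len i)} {g i ⊕ len i}
    (fromℚ-mono-≤ (ℚₚ.≤-reflexive (ℚₚ.≃-sym (end≃ i)))) (fromℚ-⊕-≥ (mkℚᵘ (z i) m) (len i))

  start<end⁺ : ∀ {i j} → z i ℤ.< z j ℤ.+ pos (L j) → g i <ᴿ g j ⊕ len j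
  start<end⁺ {i} {j} lt = <-≤ᴿ-trans {g i} {fromℚ (end j)} {g j ⊕ len j} (fromℚ-mono-< (frac-mono-< m lt)) (end-≥ j)

  start<end⁻ : ∀ {i j} → g i <ᴿ g j ⊕ len j → z i ℤ.< z j ℤ.+ pos (L j)
  start<end⁻ {i} {j} lt = frac-cancel-< m (fromℚ-cancel-< (<-≤ᴿ-trans {g i} {g j ⊕ len j} {fromℚ (end j)} lt (end-≤ j)))

  end≈start⁺ : ∀ {i j} → z i ℤ.+ pos (L i) ≡ z j → g i ⊕ len i ≈ᴿ g j
  end≈start⁺ {i} {j} eq = subst (λ w → g i ⊕ len i ≤ᴿ fromℚ (mkℚᵘ w m)) eq (end-≤ i) ,
                          subst (λ w → fromℚ (mkℚᵘ w m) ≤ᴿ g i ⊕ len i) eq (end-≥ i)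

  end≈start⁻ : ∀ {i j} → g i ⊕ len i ≈ᴿ g j → z i ℤ.+ pos (L i) ≡ z j
  end≈start⁻ {i} {j} (le , ge) = ℤₚ.≤-antisym
    (frac-cancel-≤ m (fromℚ-cancel-≤ (≤ᴿ-trans {fromℚ (end i)} {g i ⊕ len i} {g j} (end-≥ i) le)))
    (frac-cancel-≤ m (fromℚ-cancel-≤ (≤ᴿ-trans {g j} {g i ⊕ len i} {fromℚ (end i)} ge (end-≤ i))))

  starts< : ∀ {i j} → z i ℤ.< z j → g i <ᴿ g j
  starts< lt = fromℚ-mono-< (frac-mono-< m lt)

  starts≤⁻ : ∀ {i j} → g i ≤ᴿ g j → z i ℤ.≤ z j
  starts≤⁻ le = frac-cancel-≤ m (fromℚ-cancel-≤ le)

  inside : ∀ i → g i <ᴿ g i ⊕ len i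
  inside i = start<end⁺ (subst (ℤ._< z i ℤ.+ pos (L i)) (ℤₚ.+-identityʳ (z i)) (ℤₚ.+-monoʳ-< (z i)
    (frac-cancel-< m (ℚₚ.<-respʳ-≃ (len≃ i) (ℚₚ.≤-<-trans (ℚₚ.≤-reflexive (*≡* refl)) (len>0 i))))))

  common⁺ : ∀ i j → z i ℤ.< z j ℤ.+ pos (L j) → z j ℤ.< z i ℤ.+ pos (L i) →
    ∃[ a ] a ∈⟨ g i , len i ⟩ × a ∈⟨ g j , len j ⟩
  common⁺ i j lt gt = common-point {g i} {g j} (inside i) (inside j) (start<end⁺ lt) (start<end⁺ gt)

  common⁻ : ∀ i j {a} → a ∈⟨ g i , len i ⟩ → a ∈⟨ g j , len j ⟩ → z i ℤ.< z j ℤ.+ pos (L j) × z j ℤ.< z i ℤ.+ pos (L i)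
  common⁻ i j {a} (i<a , a<i) (j<a , a<j) = start<end⁻ (<ᴿ-trans {g i} {a} {g j ⊕ len j} i<a a<j) ,
                                            start<end⁻ (<ᴿ-trans {g j} {a} {g i ⊕ len i} j<a a<i)

-<⁻ : ∀ {a b c} → ℤ.- pos a ℤ.< ℤ.- pos b ℤ.+ pos c → b < a + c
-<⁻ {a} {b} {c} lt = ℤₚ.drop‿+<+ (subst₂ ℤ._<_ (left (pos a) (pos b)) (right (pos a) (pos b) (pos c)) (ℤₚ.+-monoˡ-< (pos a ℤ.+ pos b) lt))
  where
  left : ∀ a b → ℤ.- a ℤ.+ (a ℤ.+ b) ≡ b
  left = ℤSolver.solve-∀
  right : ∀ a b c → (ℤ.- b ℤ.+ c) ℤ.+ (a ℤ.+ b) ≡ a ℤ.+ c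
  right = ℤSolver.solve-∀

-≡ : ∀ {a b c} → a ≡ b + c → ℤ.- pos a ℤ.+ pos c ≡ ℤ.- pos b
-≡ {b = b} {c} refl = ring (pos b) (pos c)
  where ring : ∀ b c → ℤ.- (b ℤ.+ c) ℤ.+ c ≡ ℤ.- b
        ring = ℤSolver.solve-∀

-≡⁻ : ∀ {a b c} → ℤ.- pos a ℤ.+ pos c ≡ ℤ.- pos b → a ≡ b + c
-≡⁻ {a} {b} {c} eq = ℤₚ.+-injective (trans (left (pos a) (pos b) (pos c))
    (trans (cong (λ w → ℤ.- w ℤ.+ pos c) eq) (right (pos b) (pos c))))
  where
  left : ∀ a b c → a ≡ ℤ.- (ℤ.- a ℤ.+ c) ℤ.+ c
  left = ℤSolver.solve-∀
  right : ∀ b c → ℤ.- (ℤ.- b) ℤ.+ c ≡ b ℤ.+ c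
  right = ℤSolver.solve-∀

squeeze : ∀ {a b w s} → b < a + w → ¬ a + (w + s) ≤ b
squeeze {a} {w = w} {s} lt le = <⇒≱ lt (≤-trans (+-monoʳ-≤ a (m≤m+n w s)) le)

beyond : ∀ {a w b s} → T s → a + w ≡ b → ¬ a + (w + bit s) ≤ b
beyond {a} {w} {s = true} _ refl = <⇒≱ (+-monoʳ-< a (m<m+n w (s≤s z≤n)))

behind : ∀ {a w b v s} → a + w ≡ b → 0 < v → ¬ b + (v + s) ≤ a
behind {a} {w} {v = v} refl 0<v le = <⇒≱ (<-≤-trans (m<m+n (a + w) 0<v) (+-monoʳ-≤ (a + w) (m≤m+n v _))) (≤-trans le (m≤m+n a w))

shiftTo-shift : ∀ {A : Set} (p : A → Bool) xs → CyclicShift xs (shiftTo p xs)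
shiftTo-shift p xs = takeUntil p xs , dropUntil p xs , sym (takeUntil-dropUntil p xs) , refl

map-shiftTo : ∀ {A B : Set} (f : A → B) (p : B → Bool) xs → shiftTo p (map f xs) ≡ map f (shiftTo (p ∘ f) xs)
map-shiftTo f p xs = trans (cong₂ _++_ (drops xs) (takes xs)) (sym (map-++ f (dropUntil (p ∘ f) xs) (takeUntil (p ∘ f) xs)))
  where
  drops : ∀ xs → dropUntil p (map f xs) ≡ map f (dropUntil (p ∘ f) xs)
  drops []       = refl
  drops (x ∷ xs) with p (f x)
  ... | true  = refl
  ... | false = drops xs
  takes : ∀ xs → takeUntil p (map f xs) ≡ map f (takeUntil (p ∘ f) xs)
  takes []       = refl
  takes (x ∷ xs) with p (f x)
  ... | true  = refl
  ... | false = cong (f x ∷_) (takes xs)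

-- The verification works as a certificate check: every `sol` that passes it gives a realization,
-- wherever `sol` and `t` come from.
module FromSuccess (I : Instance) (t : ℕ) (sol : List (ℕ × ℕ)) (ok : T (verified (FromInstance.env I) t sol)) where
  open Instance I
  open PlaneDigraph graph
  open FromInstance I
  open Separation valid

  sat : T (satisfied sol (constraints env t))
  sat = proj₁ (T-∧⁻ ok)

  rest₁ = proj₂ (T-∧⁻ {satisfied sol (constraints env t)} ok)
  rest₂ = proj₂ (T-∧⁻ {levelled env} rest₁)

  lev : Levelled env
  lev {i} {j} a with T-∨⁻ {not (arc env i j)} (all⁻ (all⁻ (proj₁ (T-∧⁻ {levelled env} rest₁)) (∈-verts (arc-<ˡ a))) (∈-verts (arc-<ʳ a)))
  ... | inj₁ na = ⊥-elim (T-not⁻ na a)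
  ... | inj₂ eq = ≡ᵇ⇒≡ _ _ eq

  open Satisfied {sol} t sat

  module X = Coordinates unit-1 (λ i → pos (at sol (toℕ i))) width (λ i → W env (toℕ i)) width≃ width>0
  module Y = Coordinates unit-1 (λ i → ℤ.- pos (S env (toℕ i))) height (λ i → H env (toℕ i)) height≃ height>0

  open Placement I X.g Y.g using (TopTouches; RightTouches; Touch; RotationAt; OuterFaceAt)

  apart : ∀ {i j a} → Sep (toℕ i) (toℕ j) → a ∈⟨ X.g i , width i ⟩ → a ∈⟨ X.g j , width j ⟩ → ⊥
  apart {i} {j} {a} s ai aj = clash (sep-separates s)
    where
    crossing : pos (at sol (toℕ i)) ℤ.< pos (at sol (toℕ j) + W env (toℕ j)) × pos (at sol (toℕ j)) ℤ.< pos (at sol (toℕ i) + W env (toℕ i))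
    crossing = X.common⁻ i j {a} ai aj
    clash : at sol (toℕ i) + (W env (toℕ i) + bit (strictlyMeets env (toℕ i) (toℕ j))) ≤ at sol (toℕ j) ⊎
            at sol (toℕ j) + (W env (toℕ j) + bit (strictlyMeets env (toℕ j) (toℕ i))) ≤ at sol (toℕ i) → ⊥
    clash (inj₁ le) = squeeze {at sol (toℕ i)} {at sol (toℕ j)} {W env (toℕ i)} (ℤₚ.drop‿+<+ (proj₂ crossing)) le
    clash (inj₂ le) = squeeze {at sol (toℕ j)} {at sol (toℕ i)} {W env (toℕ j)} (ℤₚ.drop‿+<+ (proj₁ crossing)) le

  strict-¬arc : ∀ {k l} → StrictlyMeets k l → ¬ Arcᵉ env k l
  strict-¬arc (_ , lt) a = <-irrefl (lev a) lt

  strict : ∀ i j {b} → b ∈⟨ Y.g i , height i ⟩ → b ∈⟨ Y.g j , height j ⟩ → StrictlyMeets (toℕ i) (toℕ j)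
  strict i j {b} bi bj = let (lt , gt) = Y.common⁻ i j {b} bi bj in
    -<⁻ {S env (toℕ i)} {S env (toℕ j)} lt , -<⁻ {S env (toℕ j)} {S env (toℕ i)} gt

  strict-sep : ∀ {i j} → i ≢ j → StrictlyMeets (toℕ i) (toℕ j) → Sep (toℕ i) (toℕ j)
  strict-sep {i} {j} i≢j st@(lt , gt) = sep (toℕ<n i) (toℕ<n j) (λ eq → i≢j (toℕ-injective eq))
    (strict-¬arc st) (strict-¬arc (gt , lt)) (<⇒≤ lt , <⇒≤ gt)

  interiors : ∀ i j → i ≢ j → ¬ (∃[ p ] Placement.InInterior I X.g Y.g p i × Placement.InInterior I X.g Y.g p j)
  interiors i j i≢j ((a , b) , (ai , bi) , (aj , bj)) = apart {i} {j} {a} (strict-sep i≢j (strict i j {b} bi bj)) ai aj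

  top⁺ : ∀ {i j} → Arc i j → TopTouches i j
  top⁺ {i} {j} a = Y.end≈start⁺ (-≡ (lev (arc⁺ a))) ,
    let (lt , gt) = arc-overlap (arc⁺ a) in X.common⁺ i j (+<+ lt) (+<+ gt)

  -- Boxes with a horizontal contact have meeting heights. If they were not adjacent, a constraint
  -- would keep them from sharing the horizontal position `a`.
  top⁻ : ∀ {i j} → TopTouches i j → Adjacent i j
  top⁻ {i} {j} (eq , a , ai , aj) = decide (T-cases (arc env (toℕ i) (toℕ j))) (T-cases (arc env (toℕ j) (toℕ i)))
    where
    S≡ : S env (toℕ i) ≡ S env (toℕ j) + H env (toℕ i)
    S≡ = -≡⁻ (Y.end≈start⁻ eq)
    decide : _ → _ → Adjacent i j
    decide (inj₁ ij) _         = inj₁ (arc⁻ ij)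
    decide (inj₂ _)  (inj₁ ji) = inj₂ (arc⁻ ji)
    decide (inj₂ ¬ij) (inj₂ ¬ji) = ⊥-elim (apart {i} {j} {a} (sep (toℕ<n i) (toℕ<n j)
      (λ i≡j → <-irrefl (trans (cong (S env) (sym i≡j)) S≡) (m<m+n _ (H-pos (toℕ<n i)))) (T-not⁻ ¬ij) (T-not⁻ ¬ji)
      (≤-trans (m≤m+n _ _) (≤-trans (≤-reflexive (sym S≡)) (m≤m+n _ _)) , ≤-reflexive S≡)) ai aj)

  -- At properly overlapping heights the constraints leave a unit gap. If `i` is on the left, the
  -- gap excludes `x≡`; if `j` is on the left, its positive width does.
  right⁻ : ∀ {i j} → ¬ RightTouches i j
  right⁻ {i} {j} (eq , b , bi , bj) = clash (sep-separates (strict-sep i≢j st))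
    where
    st : StrictlyMeets (toℕ i) (toℕ j)
    st = strict i j {b} bi bj
    x≡ : at sol (toℕ i) + W env (toℕ i) ≡ at sol (toℕ j)
    x≡ = ℤₚ.+-injective (X.end≈start⁻ {i} {j} eq)
    i≢j : i ≢ j
    i≢j i≡j = m+n≢m (W-pos (toℕ<n i)) (trans x≡ (cong (λ k → at sol (toℕ k)) (sym i≡j)))
      where
      m+n≢m : ∀ {m n} → 0 < n → m + n ≢ m
      m+n≢m {m} {n} 0<n eq = <-irrefl (sym eq) (m<m+n m 0<n)
    clash : at sol (toℕ i) + (W env (toℕ i) + bit (strictlyMeets env (toℕ i) (toℕ j))) ≤ at sol (toℕ j) ⊎
            at sol (toℕ j) + (W env (toℕ j) + bit (strictlyMeets env (toℕ j) (toℕ i))) ≤ at sol (toℕ i) → ⊥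
    clash (inj₁ le) = beyond {at sol (toℕ i)} {W env (toℕ i)} (strictlyMeets⁺ st) x≡ le
    clash (inj₂ le) = behind {at sol (toℕ i)} {W env (toℕ i)} x≡ (W-pos (toℕ<n j)) le

  touch⁻ : ∀ {i j} → Touch i j → Adjacent i j
  touch⁻ (inj₁ (inj₁ h)) = top⁻ h
  touch⁻ (inj₁ (inj₂ h)) with top⁻ h
  ... | inj₁ a = inj₂ a
  ... | inj₂ a = inj₁ a
  touch⁻ (inj₂ (inj₁ h)) = ⊥-elim (right⁻ h)
  touch⁻ (inj₂ (inj₂ h)) = ⊥-elim (right⁻ h)

  touch⁺ : ∀ {i j} → Adjacent i j → Touch i j
  touch⁺ (inj₁ a) = inj₁ (inj₁ (top⁺ a))
  touch⁺ (inj₂ a) = inj₁ (inj₂ (top⁺ a))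

  LeftOf : HalfEdge n f → HalfEdge n f → Set
  LeftOf d e = X.g (target d) <ᴿ X.g (target e)

  decompose : ∀ ds → T (sorted sol (map toHE ds)) → ∃[ ts ] ∃[ bs ] ds ≡ ts ++ bs ×
    All (λ e → direction e ≡ out) ts × AllPairs (λ d e → LeftOf e d) ts ×
    All (λ e → direction e ≡ in′) bs × AllPairs LeftOf bs
  decompose [] _ = [] , [] , refl , [] , [] , [] , []
  decompose (d@(halfEdge out u _) ∷ ds) h with decompose ds (proj₂ (T-∧⁻ {all (precedes sol (toHE d)) (map toHE ds)} h))
  ... | ts , bs , refl , outs , tp , ins , bp =
    d ∷ ts , bs , refl , refl ∷ outs ,
    All.tabulate (λ {e} e∈ → lt e (All.lookup outs e∈) (all⁻ {p = precedes sol (toHE d)} (proj₁ (T-∧⁻ h)) (∈-map⁺ toHE (∈-++⁺ˡ e∈)))) ∷ tp , ins , bp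
    where
    lt : ∀ e → direction e ≡ out → T (precedes sol (toHE d) (toHE e)) → LeftOf e d
    lt (halfEdge out v _) refl p = X.starts< (+<+ (≤ᵇ⇒≤ _ _ p))
  decompose (d@(halfEdge in′ u _) ∷ ds) h with decompose ds (proj₂ (T-∧⁻ {all (precedes sol (toHE d)) (map toHE ds)} h))
  -- `precedes` rejects an incoming half-edge ahead of an outgoing one, so the type of `h` reduces
  -- to the empty type.
  ... | halfEdge out _ _ ∷ ts , bs , refl , refl ∷ outs , tp , ins , bp = ⊥-elim h
  ... | [] , bs , refl , outs , tp , ins , bp =
    [] , d ∷ bs , refl , [] , [] , refl ∷ ins ,
    All.tabulate (λ {e} e∈ → lt e (All.lookup ins e∈) (all⁻ {p = precedes sol (toHE d)} (proj₁ (T-∧⁻ h)) (∈-map⁺ toHE e∈))) ∷ bp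
    where
    lt : ∀ e → direction e ≡ in′ → T (precedes sol (toHE d) (toHE e)) → LeftOf d e
    lt (halfEdge in′ v _) refl p = X.starts< (+<+ (≤ᵇ⇒≤ _ _ p))

  rotation-at : ∀ i → RotationAt i
  rotation-at i = from-sorted (T-∨⁻ {sorted sol (rot env (toℕ i))} (all⁻ (proj₁ (T-∧⁻ {all (rotationOK env sol) (verts env)} rest₂)) (∈-verts (toℕ<n i))))
    where
    finish : ∀ ds → CyclicShift (rotation i) ds → T (sorted sol (map toHE ds)) → RotationAt i
    finish ds shift srt with decompose ds srt
    ... | ts , bs , refl , h = ts , bs , shift , h
    from-sorted : _ → RotationAt i
    from-sorted (inj₁ srt) = finish (rotation i) ([] , rotation i , refl , sym (++-identityʳ _))
      (subst (λ ds → T (sorted sol ds)) (rot≡ i) srt)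
    from-sorted (inj₂ h) with any⁻ (rot env (toℕ i)) h
    ... | d , _ , srt = finish (shiftTo (λ d′ → toℕ (target d′) ≡ᵇ tgt d) (rotation i)) (shiftTo-shift _ (rotation i))
      (subst (λ ds → T (sorted sol ds)) (trans (cong (shiftTo (λ d′ → tgt d′ ≡ᵇ tgt d)) (rot≡ i)) (map-shiftTo toHE _ (rotation i))) srt)

  outer-face : ∀ s → IsSink s → OuterFaceAt s
  outer-face s sink-s e e∈ most with T-∨⁻ {not (isSink env (toℕ s))} (all⁻ (proj₂ (T-∧⁻ {all (rotationOK env sol) (verts env)} rest₂)) (∈-verts (toℕ<n s)))
  ... | inj₁ ns = ⊥-elim (T-not⁻ ns (sink⁺ sink-s))
  ... | inj₂ h with T-∨⁻ {not (all (λ d′ → at sol (tgt d′) ≤ᵇ at sol (toℕ (target e))) (rot env (toℕ s)))} (all⁻ h (∈-rot⁺ e∈))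
  ...   | inj₂ eq = toℕ-injective (trans (≡ᵇ⇒≡ _ _ eq) outer≡)
  ...   | inj₁ no-most = ⊥-elim (T-not⁻ no-most (all⁺ (rot env (toℕ s)) λ d d∈ → rightmost (∈-rot⁻ {s} d∈)))
    where
    rightmost : ∀ {d} → ∃[ d′ ] d′ ∈ rotation s × d ≡ toHE d′ → T (at sol (tgt d) ≤ᵇ at sol (toℕ (target e)))
    rightmost (d′ , d′∈ , refl) = ≤⇒≤ᵇ (ℤₚ.drop‿+≤+ (X.starts≤⁻ (most d′ d′∈)))

  realizes : HierarchicallyRealizes I X.g Y.g
  realizes = record
    { disjointInteriors = interiors
    ; contactGraph      = λ i j → mk⇔ touch⁻ touch⁺
    ; hierarchy         = λ i j → top⁺
    ; embedding         = rotation-at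
    ; outer             = outer-face
    }

-- Encoding the output and assembling the theorem

encode-negative : ∀ s → encodeℤ (ℤ.- pos s) ≡ enc (𝔹 ⊗ ℕ̂) ((s ≡ᵇ 0) , s)
encode-negative zero    = refl
encode-negative (suc s) = refl

module _ (I : Instance) where
  open Instance I
  open FromInstance I

  place : ℕ → Fin n → ℚᵘ × ℚᵘ
  place t i = mkℚᵘ (pos (at (solution env t) (toℕ i))) unit-1 , mkℚᵘ (ℤ.- pos (S env (toℕ i))) unit-1

  placement : List ℕ → Maybe (Fin n → ℚᵘ × ℚᵘ)
  placement []      = nothing
  placement (t ∷ _) = just (place t)

  encode-place : ∀ t i → cons (encodeℚ (proj₁ (place t i))) (encodeℚ (proj₂ (place t i))) ≡
                         enc (ℚ̂ ⊗ ℚ̂) (coordinates (unit rawBoxes) env t (toℕ i))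
  encode-place t i = cong₂ cons
    (cong (λ m → cons (encodeℤ (pos (at (solution env t) (toℕ i)))) (encodeℕ m)) unit≡)
    (cong₂ (λ s m → cons s (encodeℕ m)) (encode-negative (S env (toℕ i))) unit≡)

  encode-outcome : ∀ ts → enc (𝕄 (𝕃 (ℚ̂ ⊗ ℚ̂))) (outcome (unit rawBoxes) env ts) ≡ encodePlacement (placement ts)
  encode-outcome []      = refl
  encode-outcome (t ∷ _) = cong (cons nil) (sym
    (trans (encodeList-map {B = ℚ̂ ⊗ ℚ̂} {g = λ i → coordinates (unit rawBoxes) env t (toℕ i)} (encode-place t) (allFin n))
      (cong (enc (𝕃 (ℚ̂ ⊗ ℚ̂))) (trans (map-tabulate (λ i → i) _)
        (sym (trans (cong (map (coordinates (unit rawBoxes) env t)) verts≡) (map-tabulate toℕ _)))))))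

  answer≡ : answer raw ≡ outcome (unit rawBoxes) env (successes env)
  answer≡ = cong (λ e → outcome (unit rawBoxes) e (successes e)) (sym env≡)

  placement-correct : ∀ ts → successes env ≡ ts → CorrectAnswer I (placement ts)
  placement-correct []      eq = λ (x , y , realizes) →
    Success.successes-nonempty (FromRealization.realized I x y realizes) eq
  placement-correct (t ∷ _) eq = FromSuccess.realizes I t (solution env t)
    (proj₂ (∈-filter⁻ (λ t → T? (verified env t (solution env t))) {xs = verts env} (subst (t ∈_) (sym eq) (here refl))))

theorem3 : PolynomialTime Hi-WRAC
theorem3 = polynomialTime Hi-WRAC
  (answer′ ∘′ recode {A = data′ Instance encodeInstance} {f = FromInstance.raw} FromInstance.encode-raw)
  (λ I → placement I (successes (FromInstance.env I)))
  (λ I → trans (cong (enc (𝕄 (𝕃 (ℚ̂ ⊗ ℚ̂)))) (answer≡ I)) (encode-outcome I (successes (FromInstance.env I))))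
  (λ I → placement-correct I (successes (FromInstance.env I)) refl)
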